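{- For any $\varepsilon>0$, there exists an algorithm for the problem $BW^{\min}$ that, given any instance that has a feasible solution, outputs a set $S$ of items whose total weight is at most $(1+\varepsilon)$ times the total weight of an optimal solution, such that $$(1-\varepsilon)\,l_i^w\le\sum_{j\in V_i\cap S}w_j^{(i)}\le(1+\varepsilon)\,u_i^w\qquad\text{for all }i\in[m],$$ and the total value of $S$ is at least $L$. The running time of the algorithm is $$O\!\left(\frac{n^2\,m\,\log^3 m\;\log_{1+\varepsilon}^{3}\!\left(\frac{W}{w_{\min}}\right)}{\varepsilon}\right),$$ where $w_{\min}=\min\{w_j^{(i)} : i\in[m],\ j\in V_i,\ w_j^{(i)}>0\}$ and $W=\sum_{i=1}^{m}\sum_{j\in V_i}w_j^{(i)}$.
   Context: Items are partitioned into $m$ categories; $V_i$ is the set of items of category $i\in[m]=\{1,\dots,m\}$. Item $j\in V_i$ has a non-negative weight $w_j^{(i)}$ and a non-negative value $v_j^{(i)}$ (rational numbers). At least one item has positive weight, so that $w_{\min}$ is defined. $n=\max_{i\in[m]}|V_i|$. Problem $BW^{\min}$: given the items, bounds $0\le l_i^w\le u_i^w$ for each $i\in[m]$, and a value lower bound $L$, find a subset $S\subseteq\bigcup_i V_i$ minimizing the total weight $\sum_{i}\sum_{j\in S\cap V_i}w_j^{(i)}$ subject to $l_i^w\le\sum_{j\in S\cap V_i}w_j^{(i)}\le u_i^w$ for all $i\in[m]$ and $\sum_i\sum_{j\in S\cap V_i}v_j^{(i)}\ge L$. A feasible solution is a subset satisfying all these constraints; an optimal solution is a feasible solution of minimum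 total weight. Running time counts elementary operations (arithmetic, comparison, rounding) on numbers, each at unit cost. Inside the $O(\cdot)$, each logarithmic factor $x$ is read as $\max\{1,x\}$ (so that the bound is meaningful e.g. for $m=1$). -}

module Defs where

open import Algebra.Bundles using (module CommutativeRing)
open import Data.Bool.Base using (Bool; if_then_else_)
open import Data.Fin.Base using (Fin)
import Data.Fin.Properties as Fin
open import Data.Fin.Subset using (Subset)
open import Data.Integer.Base using (+_; ∣_∣)
open import Data.List.Base as List using (List; []; _∷_)
import Data.List.Membership.DecPropositional as DecMembership
open import Data.List.Membership.Propositional using (_∈_)
open import Data.List.Relation.Unary.All as All using (All; []; _∷_)
open import Data.Nat.Base as ℕ using (ℕ; suc)
open import Data.Product.Base using (Σ; ∃₂; _×_; _,_; proj₁; proj₂)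
open import Data.Product.Properties using (≡-dec)
open import Data.Rational.Base hiding (∣_∣)
open import Data.Rational.Properties
  using (_≟_; pos⇒nonZero; +-0-commutativeMonoid; +-*-commutativeRing)
import Data.Vec.Base as Vec
import Data.Vec.Functional as Vector
open import Relation.Binary.Definitions using (DecidableEquality)
open import Relation.Binary.PropositionalEquality using (_≡_)
open import Relation.Nullary.Decidable using (does; yes; no)

open import Algebra.Properties.CommutativeMonoid.Sum +-0-commutativeMonoid public
  using (sum)
open import Algebra.Properties.Semiring.Exp (CommutativeRing.semiring +-*-commutativeRing) public
  using (_^_)

ι : ℕ → ℚ
ι k = + k / 1

record Instance : Set where
  field
    m     : ℕ
    size  : Fin m → ℕ
    w v   : (i : Fin m) → Fin (size i) → ℚ
    l u   : Fin m → ℚ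
    L     : ℚ
    w≥0   : ∀ i j → 0ℚ ≤ w i j
    v≥0   : ∀ i j → 0ℚ ≤ v i j
    l≥0   : ∀ i → 0ℚ ≤ l i
    l≤u   : ∀ i → l i ≤ u i
    ∃w>0  : ∃₂ λ i j → 0ℚ < w i j

  Item : Set
  Item = Σ (Fin m) λ i → Fin (size i)

  _≟ᴵ_ : DecidableEquality Item
  _≟ᴵ_ = ≡-dec Fin._≟_ Fin._≟_

  ItemSet : Set
  ItemSet = (i : Fin m) → Subset (size i)

  sumOver : ∀ {k} → Subset k → (Fin k → ℚ) → ℚ
  sumOver s f = sum λ j → if Vec.lookup s j then f j else 0ℚ

  categoryWeight : ItemSet → Fin m → ℚ
  categoryWeight S i = sumOver (S i) (w i)

  weight : ItemSet → ℚ
  weight S = sum (categoryWeight S)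

  value : ItemSet → ℚ
  value S = sum λ i → sumOver (S i) (v i)

  record Feasible (S : ItemSet) : Set where
    field
      lower    : ∀ i → l i ≤ categoryWeight S i
      upper    : ∀ i → categoryWeight S i ≤ u i
      valuable : L ≤ value S

  Optimal : ItemSet → Set
  Optimal S = Feasible S × (∀ S′ → Feasible S′ → weight S ≤ weight S′)

  record Approximate (ε : ℚ) (S : ItemSet) : Set where
    field
      lower    : ∀ i → (1ℚ - ε) * l i ≤ categoryWeight S i
      upper    : ∀ i → categoryWeight S i ≤ (1ℚ + ε) * u i
      valuable : L ≤ value S
      nearOpt  : ∀ O → Optimal O → weight S ≤ (1ℚ + ε) * weight O

  n : ℕ
  n = Vector.foldr ℕ._⊔_ 0 size

  W : ℚ
  W = sum λ i → sum (w i)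

  record IsMinPositiveWeight (x : ℚ) : Set where
    field
      isPositive : Positive x
      attained   : ∃₂ λ i j → w i j ≡ x
      minimal    : ∀ i j → 0ℚ < w i j → x ≤ w i j

-- The model of computation: a simply typed call-by-value language with
-- unit-cost rational arithmetic, comparison and rounding.  A program is a
-- term whose only free variable is the input, so its text does not depend on
-- the instance.  Every evaluated construct costs one unit, not only the
-- operations on numbers.

infixr 6 _⇒_
infixr 7 _⊗_

-- `item` is the type of item names; no construct inspects them.
data Ty : Set where
  num bool item : Ty
  list          : Ty → Ty
  _⊗_ _⇒_       : Ty → Ty → Ty

data Arith : Set where
  add sub mul div : Arith

data Tm (Γ : List Ty) : Ty → Set where
  var     : ∀ {A} → A ∈ Γ → Tm Γ A
  lam     : ∀ {A B} → Tm (A ∷ Γ) B → Tm Γ (A ⇒ B)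
  app     : ∀ {A B} → Tm Γ (A ⇒ B) → Tm Γ A → Tm Γ B
  pair    : ∀ {A B} → Tm Γ A → Tm Γ B → Tm Γ (A ⊗ B)
  fst     : ∀ {A B} → Tm Γ (A ⊗ B) → Tm Γ A
  snd     : ∀ {A B} → Tm Γ (A ⊗ B) → Tm Γ B
  nil     : ∀ {A} → Tm Γ (list A)
  cons    : ∀ {A} → Tm Γ A → Tm Γ (list A) → Tm Γ (list A)
  -- rec t s b c  is  f t s  for the recursive function defined by
  --   f []       s = b
  --   f (x ∷ xs) s = c   (with x, xs, f xs and s in scope)
  -- where f xs is a closure, so only the recursive calls made are charged.
  rec     : ∀ {A B S} → Tm Γ (list A) → Tm Γ S →
            Tm (S ∷ Γ) B → Tm (S ∷ (S ⇒ B) ∷ list A ∷ A ∷ Γ) B → Tm Γ B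
  cond    : ∀ {A} → Tm Γ bool → Tm Γ A → Tm Γ A → Tm Γ A
  lit     : ℚ → Tm Γ num
  arith   : Arith → Tm Γ num → Tm Γ num → Tm Γ num
  round↓  : Tm Γ num → Tm Γ num
  leq     : Tm Γ num → Tm Γ num → Tm Γ bool

Costed : Set → Set
Costed A = A × ℕ

return : ∀ {A} → A → Costed A
return a = a , 0

infixl 1 _>>=_
_>>=_ : ∀ {A B} → Costed A → (A → Costed B) → Costed B
(a , j) >>= f = proj₁ (f a) , j ℕ.+ proj₂ (f a)

tick : ∀ {A} → Costed A → Costed A
tick (a , k) = a , suc k

recList : ∀ {A B S : Set} → (S → Costed B) →
          (A → List A → (S → Costed B) → S → Costed B) →
          List A → S → Costed B
recList b c []       s = b s
recList b c (x ∷ xs) s = c x xs (recList b c xs) s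

-- Division by zero yields zero.
evalArith : Arith → ℚ → ℚ → ℚ
evalArith add p q = p + q
evalArith sub p q = p - q
evalArith mul p q = p * q
evalArith div p q with q ≟ 0ℚ
... | yes _   = 0ℚ
... | no  q≢0 = (p ÷ q) {{≢-nonZero q≢0}}

module Semantics (Item : Set) where

  ⟦_⟧ : Ty → Set
  ⟦ num ⟧    = ℚ
  ⟦ bool ⟧   = Bool
  ⟦ item ⟧   = Item
  ⟦ list A ⟧ = List ⟦ A ⟧
  ⟦ A ⊗ B ⟧  = ⟦ A ⟧ × ⟦ B ⟧
  ⟦ A ⇒ B ⟧  = ⟦ A ⟧ → Costed ⟦ B ⟧

  eval : ∀ {Γ A} → Tm Γ A → All ⟦_⟧ Γ → Costed ⟦ A ⟧
  eval (var x)       ρ = tick (return (All.lookup ρ x))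
  eval (lam t)       ρ = tick (return λ a → eval t (a ∷ ρ))
  eval (app t s)     ρ = tick (eval t ρ >>= λ f → eval s ρ >>= f)
  eval (pair t s)    ρ = tick (eval t ρ >>= λ a → eval s ρ >>= λ b → return (a , b))
  eval (fst t)       ρ = tick (eval t ρ >>= λ p → return (proj₁ p))
  eval (snd t)       ρ = tick (eval t ρ >>= λ p → return (proj₂ p))
  eval nil           ρ = tick (return [])
  eval (cons t s)    ρ = tick (eval t ρ >>= λ a → eval s ρ >>= λ as → return (a ∷ as))
  eval (rec t s b c) ρ = tick (eval t ρ >>= λ as → eval s ρ >>= recList
    (λ z → eval b (z ∷ ρ)) (λ x xs f z → eval c (z ∷ f ∷ xs ∷ x ∷ ρ)) as)
  eval (cond t s r)  ρ = tick (eval t ρ >>= λ b → if b then eval s ρ else eval r ρ)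
  eval (lit q)       ρ = tick (return q)
  eval (arith o t s) ρ = tick (eval t ρ >>= λ p → eval s ρ >>= λ q → return (evalArith o p q))
  eval (round↓ t)    ρ = tick (eval t ρ >>= λ q → return (floor q / 1))
  eval (leq t s)     ρ = tick (eval t ρ >>= λ p → eval s ρ >>= λ q → return (p ≤ᵇ q))

-- The value bound L and, for each category, (lᵢ , uᵢ , its items), an item
-- being given by (name , weight , value).
Input : Ty
Input = num ⊗ list (num ⊗ num ⊗ list (item ⊗ num ⊗ num))

Program : Set
Program = Tm (Input ∷ []) (list item)

module _ (P : Program) (I : Instance) where
  open Instance I
  open Semantics Item
  open DecMembership _≟ᴵ_ using (_∈?_)

  input : ⟦ Input ⟧
  input = L , List.tabulate λ i →
    l i , u i , List.tabulate λ j → (i , j) , w i j , v i j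

  run : Costed (List Item)
  run = eval P (input ∷ [])

  output : ItemSet
  output i = Vec.tabulate λ j → does ((i , j) ∈? proj₁ run)

  runningTime : ℕ
  runningTime = proj₂ run

-- max {1 , log_b x} ≤ q, for b > 1 and x > 0: with q = a / d in lowest terms,
-- log_b x ≤ q means x ^ d ≤ b ^ a.  (The absolute value is harmless as q ≥ 1.)
record Max1Log≤ (b x q : ℚ) : Set where
  field
    1≤q   : 1ℚ ≤ q
    log≤q : x ^ ↧ₙ q ≤ b ^ ∣ ↥ q ∣

-- t ≤ C · n² m λ³ μ³ / ε, where λ = max {1 , log₂ m} and
-- μ = max {1 , log_{1+ε} (W / w_min)}.  These reals are given by their rational
-- upper bounds: the right-hand side is continuous and increasing in λ and μ, so
-- bounding t for all rational p ≥ λ and q ≥ μ is the same as bounding it at λ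
-- and μ.
WithinBound : (C ε : ℚ) .{{_ : Positive ε}} → Instance → ℕ → Set
WithinBound C ε I t =
  ∀ {wmin} (isMin : IsMinPositiveWeight wmin) {p q} →
  Max1Log≤ (1ℚ + 1ℚ) (ι m) p →
  Max1Log≤ (1ℚ + ε) ((W ÷ wmin) {{pos⇒nonZero wmin {{IsMinPositiveWeight.isPositive isMin}}}}) q →
  ι t ≤ C * ((ι n ^ 2 * ι m * p ^ 3 * q ^ 3) ÷ ε) {{pos⇒nonZero ε}}
  where open Instance I

{-# OPTIONS --safe #-}

-- Each category, and then the list of all categories, is processed by a balanced
-- tree of merges of tables of partial solutions.  A table keeps one most valuable
-- entry per weight cell.  Its cells are anchored at weights that occur (a grid of
-- powers could not be enumerated by recursion on lists), and successive anchors
-- differ by a factor above 1 + δ, so a table has O(log_{1+δ} (W / w_min)) entries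
-- while a merge distorts weights by a factor of at most (1 + δ)².
--
-- The precision δ shrinks by the factor 9/10 from one level of a tree to the next.
-- The errors of the levels then form a geometric series, which is kept below ε.
-- A level costs (number of tables) · (table size)³; the number of tables halves
-- and the cube of their size grows by (10/9)³ < 2, so the costs form a decreasing
-- geometric series too.  Hence a tree over N tables costs O(N · s³), where s is
-- the table size of its lowest level, and its result has size s′ with s′³ ≤ N · s³.
-- The two trees together cost O(n m log_{1+ε}³ (W / w_min)).
module Submission where

open import Defs
open import Algebra.Bundles using (module CommutativeRing)
import Algebra.Properties.Semiring.Exp as Exp
open import Data.Bool.Base using (Bool; true; false; T; if_then_else_)
open import Data.Empty using (⊥-elim)
open import Data.Fin.Base using (Fin; zero; suc)
import Data.Fin.Properties as Fin
open import Data.Fin.Subset using (Subset)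
import Data.Integer.Base as ℤ
import Data.Integer.Properties as ℤ
open import Data.List.Base using (List; []; _∷_; [_]; _++_; length; map; concat; tabulate)
import Data.List.Membership.DecPropositional as DecMembership
open import Data.List.Membership.Propositional using (_∈_)
import Data.List.Membership.Propositional.Properties as List
import Data.List.Properties as List
open import Data.List.Relation.Binary.Pointwise as Pointwise using (Pointwise; []; _∷_)
open import Data.List.Relation.Unary.All as All using (All; []; _∷_)
import Data.List.Relation.Unary.All.Properties as All
open import Data.List.Relation.Unary.AllPairs using (AllPairs; []; _∷_)
open import Data.List.Relation.Unary.Any using (here; there)
open import Data.Nat.Base as ℕ using (ℕ; zero; suc)
import Data.Nat.DivMod as ℕ
import Data.Nat.Properties as ℕ
import Data.Nat.Tactic.RingSolver as ℕ-RingSolver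
open import Data.Product.Base using (∃; ∃₂; ∃-syntax; _×_; _,_; proj₁; proj₂)
open import Data.Rational.Base
open import Data.Rational.Properties
open import Algebra.Properties.CommutativeMonoid.Sum +-0-commutativeMonoid using (sum-cong-≗)
import Data.Rational.Unnormalised.Base as ℚᵘ
import Data.Rational.Unnormalised.Properties as ℚᵘ
open import Data.Sum.Base as Sum using (_⊎_; inj₁; inj₂)
import Data.Vec.Base as Vec
import Data.Vec.Functional as Vector
import Data.Vec.Properties as Vec
open import Function.Base using (_∘_; id)
open import Level using (Level)
open import Relation.Binary.Definitions using (tri<; tri≈; tri>)
open import Relation.Binary.PropositionalEquality
open import Relation.Nullary.Decidable using (does; dec⇒maybe; dec-true; dec-false)
open import Tactic.RingSolver using (solve-∀)
open import Tactic.RingSolver.Core.AlmostCommutativeRing using (AlmostCommutativeRing; fromCommutativeRing)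

open Exp (CommutativeRing.semiring +-*-commutativeRing) using (^-homo-*; ^-assocʳ)

-- Rounding decides only which entries are dropped: an entry that stays carries the exact weight and
-- value of an actual set. Soundness is therefore free of error. Factors are lost in coverage alone:
-- every feasible selection must have an entry of nearly its weight and no less value. A merge loses
-- one factor `1 + δ` from a join to the anchor of its cell and one from that anchor to the entry
-- that the cell finally holds.
--
-- The interval of a category is enforced by a filter between the two trees. It is relaxed by `ε`,
-- which is at least the error `60 * δ` of the first tree, so an entry near each feasible selection
-- survives. The second tree spends another `60 * δ`, whence `δ = min (ε , 1) / 120`.
--
-- By Bernoulli's inequality the lowest tables have length of order
-- `(ε / δ) * log_{1+ε} (W / w_min)`, and `ε / δ` is at most `120 * max (ε̄ , 1)`. As `δ` stays at
-- most 1/120 however large `ε` is, the constant depends on the cap `ε̄`. The claimed bound has the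
-- further factors `n`, `log³ m` and `1 / ε`, each at least 1 up to that constant.

ℚ-ring : AlmostCommutativeRing _ _
ℚ-ring = fromCommutativeRing +-*-commutativeRing λ x → dec⇒maybe (0ℚ ≟ x)

decay : ℚ
decay = ℤ.+ 9 / 10

ℕ-interchange : ∀ a b c d → (a ℕ.+ b) ℕ.+ (c ℕ.+ d) ≡ (a ℕ.+ c) ℕ.+ (b ℕ.+ d)
ℕ-interchange = ℕ-RingSolver.solve-∀

-- Generic in the operation: the tables of a level are paired by `merge` and their specifications by
-- `_++_`, and one recursion keeps the two aligned.
pairUp : ∀ {a} {A : Set a} → (A → A → A) → List A → List A
pairUp _∙_ (x ∷ y ∷ zs) = (x ∙ y) ∷ pairUp _∙_ zs
pairUp _∙_ xs           = xs

-- The program as a term of the object language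

-- An entry is (anchor , weight , value , set of items).  Sets are difference
-- lists, so that a union costs O(1).  The anchor is the weight of the first
-- entry that fell into the cell.
entryᵀ tableᵀ setᵀ : Ty
setᵀ   = list item ⇒ list item
entryᵀ = num ⊗ num ⊗ num ⊗ setᵀ
tableᵀ = list entryᵀ

private variable
  Γ : List Ty

v₀ : ∀ {A} → Tm (A ∷ Γ) A
v₀ = var (here refl)
v₁ : ∀ {A B} → Tm (B ∷ A ∷ Γ) A
v₁ = var (there (here refl))
v₂ : ∀ {A B C} → Tm (C ∷ B ∷ A ∷ Γ) A
v₂ = var (there (there (here refl)))
v₃ : ∀ {A B C D} → Tm (D ∷ C ∷ B ∷ A ∷ Γ) A
v₃ = var (there (there (there (here refl))))
v₄ : ∀ {A B C D E} → Tm (E ∷ D ∷ C ∷ B ∷ A ∷ Γ) A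
v₄ = var (there (there (there (there (here refl)))))
v₅ : ∀ {A B C D E F} → Tm (F ∷ E ∷ D ∷ C ∷ B ∷ A ∷ Γ) A
v₅ = var (there (there (there (there (there (here refl))))))
v₆ : ∀ {A B C D E F G} → Tm (G ∷ F ∷ E ∷ D ∷ C ∷ B ∷ A ∷ Γ) A
v₆ = var (there (there (there (there (there (there (here refl)))))))
v₇ : ∀ {A B C D E F G H} → Tm (H ∷ G ∷ F ∷ E ∷ D ∷ C ∷ B ∷ A ∷ Γ) A
v₇ = var (there (there (there (there (there (there (there (here refl))))))))
v₈ : ∀ {A B C D E F G H J} → Tm (J ∷ H ∷ G ∷ F ∷ E ∷ D ∷ C ∷ B ∷ A ∷ Γ) A
v₈ = var (there (there (there (there (there (there (there (there (here refl)))))))))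
v₉ : ∀ {A B C D E F G H J K} → Tm (K ∷ J ∷ H ∷ G ∷ F ∷ E ∷ D ∷ C ∷ B ∷ A ∷ Γ) A
v₉ = var (there (there (there (there (there (there (there (there (there (here refl))))))))))
v₁₀ : ∀ {A B C D E F G H J K L} → Tm (L ∷ K ∷ J ∷ H ∷ G ∷ F ∷ E ∷ D ∷ C ∷ B ∷ A ∷ Γ) A
v₁₀ = var (there (there (there (there (there (there (there (there (there (there (here refl)))))))))))

anchorᵗ weightᵗ valueᵗ : Tm Γ entryᵀ → Tm Γ num
anchorᵗ t = fst t
weightᵗ t = fst (snd t)
valueᵗ  t = fst (snd (snd t))

setᵗ : Tm Γ entryᵀ → Tm Γ setᵀ
setᵗ t = snd (snd (snd t))

composeᵗ : Tm Γ (setᵀ ⇒ setᵀ ⇒ setᵀ)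
composeᵗ = lam (lam (lam (app v₂ (app v₁ v₀))))

emptyᵗ : Tm Γ entryᵀ
emptyᵗ = pair (lit 0ℚ) (pair (lit 0ℚ) (pair (lit 0ℚ) (lam v₀)))

-- Opaque, so that evaluating a caller does not unfold its callees.
opaque
  joinᵗ : Tm Γ (entryᵀ ⇒ entryᵀ ⇒ entryᵀ)
  joinᵗ = lam (lam (pair (arith add (weightᵗ v₁) (weightᵗ v₀))
                   (pair (arith add (weightᵗ v₁) (weightᵗ v₀))
                   (pair (arith add (valueᵗ v₁) (valueᵗ v₀))
                         (app (app composeᵗ (setᵗ v₁)) (setᵗ v₀))))))

insertStep : Tm (num ∷ (num ⇒ tableᵀ) ∷ tableᵀ ∷ entryᵀ ∷ tableᵀ ∷ entryᵀ ∷ num ∷ Γ) tableᵀ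
insertStep =
  cond (leq (anchorᵗ v₃) (arith mul v₆ (weightᵗ v₅)))
    (cond (leq (weightᵗ v₅) (arith mul v₆ (anchorᵗ v₃)))
      (cond (leq (valueᵗ v₅) (valueᵗ v₃))
        (cons v₃ v₂)
        -- Only weight, value and set are replaced. A new anchor could come too close to its
        -- neighbours, and the weights of a cell could drift.
        (cons (pair (anchorᵗ v₃) (snd v₅)) v₂))
      (cons v₃ (app v₁ v₀)))
    (cons v₅ (cons v₃ v₂))

insertBody : Tm (tableᵀ ∷ entryᵀ ∷ num ∷ Γ) tableᵀ
-- The recursion carries no information in its state; `0ℚ` is a dummy, here and in the other
-- stateless loops.
insertBody = rec v₀ (lit 0ℚ) (cons v₂ nil) insertStep

opaque
  insertᵗ : Tm Γ (num ⇒ entryᵀ ⇒ tableᵀ ⇒ tableᵀ)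
  insertᵗ = lam (lam (lam insertBody))

mergeRowStep : Tm (tableᵀ ∷ (tableᵀ ⇒ tableᵀ) ∷ tableᵀ ∷ entryᵀ ∷
                   tableᵀ ∷ (tableᵀ ⇒ tableᵀ) ∷ tableᵀ ∷ entryᵀ ∷
                   tableᵀ ∷ tableᵀ ∷ num ∷ Γ) tableᵀ
mergeRowStep = app v₁ (app (app (app insertᵗ v₁₀) (app (app joinᵗ v₇) v₃)) v₀)

mergeStep : Tm (tableᵀ ∷ (tableᵀ ⇒ tableᵀ) ∷ tableᵀ ∷ entryᵀ ∷ tableᵀ ∷ tableᵀ ∷ num ∷ Γ) tableᵀ
mergeStep = app v₁ (rec v₄ v₀ v₀ mergeRowStep)

mergeBody : Tm (tableᵀ ∷ tableᵀ ∷ num ∷ Γ) tableᵀ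
mergeBody = rec v₁ nil v₀ mergeStep

opaque
  mergeᵗ : Tm Γ (num ⇒ tableᵀ ⇒ tableᵀ ⇒ tableᵀ)
  mergeᵗ = lam (lam (lam mergeBody))

pairUpMerge : Tm (num ∷ (num ⇒ list tableᵀ) ∷ list tableᵀ ∷ tableᵀ ∷
                  list tableᵀ ∷ (list tableᵀ ⇒ list tableᵀ) ∷ list tableᵀ ∷ tableᵀ ∷
                  list tableᵀ ∷ num ∷ Γ) (list tableᵀ)
pairUpMerge = cons (app (app (app mergeᵗ v₉) v₃) v₇) (app v₅ nil)

-- The state is the list of the at most one table that waits for its partner.
pairUpStep : Tm (list tableᵀ ∷ (list tableᵀ ⇒ list tableᵀ) ∷ list tableᵀ ∷ tableᵀ ∷
                 list tableᵀ ∷ num ∷ Γ) (list tableᵀ)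
pairUpStep = rec v₀ (lit 0ℚ) (app v₂ (cons v₄ nil)) pairUpMerge

pairUpBody : Tm (list tableᵀ ∷ num ∷ Γ) (list tableᵀ)
pairUpBody = rec v₀ nil v₀ pairUpStep

opaque
  pairUpᵗ : Tm Γ (num ⇒ list tableᵀ ⇒ list tableᵀ)
  pairUpᵗ = lam (lam pairUpBody)

treeLevel : Tm (num ∷ (num ⇒ tableᵀ) ∷ list tableᵀ ∷ tableᵀ ∷
                num ∷ (num ⇒ tableᵀ) ∷ list tableᵀ ∷ tableᵀ ∷
                (num ⊗ list tableᵀ) ∷ (num ⊗ list tableᵀ ⇒ tableᵀ) ∷ Γ) tableᵀ
treeLevel = app v₉ (pair (arith mul (lit decay) (fst v₈))
                         (app (app pairUpᵗ (arith add (lit 1ℚ) (fst v₈))) (snd v₈)))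

-- `rec` is the only eliminator of lists. Inside `treeStep`, two nested uses that never call their
-- own recursive argument tell apart no table, one table and at least two.
treeTail : Tm (num ∷ (num ⇒ tableᵀ) ∷ list tableᵀ ∷ tableᵀ ∷
               (num ⊗ list tableᵀ) ∷ (num ⊗ list tableᵀ ⇒ tableᵀ) ∷ Γ) tableᵀ
treeTail = rec v₂ (lit 0ℚ) v₄ treeLevel

-- The list that is recursed on serves as fuel only.
treeStep : Tm ((num ⊗ list tableᵀ) ∷ (num ⊗ list tableᵀ ⇒ tableᵀ) ∷ list tableᵀ ∷ tableᵀ ∷ Γ) tableᵀ
treeStep = rec (snd v₀) (lit 0ℚ) (cons emptyᵗ nil) treeTail

treeBody : ℚ → Tm (list tableᵀ ∷ Γ) tableᵀ
treeBody δ = rec v₀ (pair (lit δ) v₀) (cons emptyᵗ nil) treeStep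

opaque
  treeᵗ : ℚ → Tm Γ (list tableᵀ ⇒ tableᵀ)
  treeᵗ δ = lam (treeBody δ)

mapStep : ∀ {A B} → Tm (num ∷ (num ⇒ list B) ∷ list A ∷ A ∷ list A ∷ (A ⇒ B) ∷ Γ) (list B)
mapStep = cons (app v₅ v₃) (app v₁ v₀)

mapBody : ∀ {A B} → Tm (list A ∷ (A ⇒ B) ∷ Γ) (list B)
mapBody = rec v₀ (lit 0ℚ) nil mapStep

opaque
  mapᵗ : ∀ {A B} → Tm Γ ((A ⇒ B) ⇒ list A ⇒ list B)
  mapᵗ = lam (lam mapBody)

opaque
  leafᵗ : Tm Γ (item ⊗ num ⊗ num ⇒ tableᵀ)
  leafᵗ = lam (cons emptyᵗ (cons (pair (fst (snd v₀)) (pair (fst (snd v₀))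
    (pair (snd (snd v₀)) (lam (cons (fst v₁) v₀))))) nil))

filterStep : Tm (num ∷ (num ⇒ tableᵀ) ∷ tableᵀ ∷ entryᵀ ∷ tableᵀ ∷ num ∷ num ∷ Γ) tableᵀ
filterStep =
  cond (leq v₆ (weightᵗ v₃))
    (cond (leq (weightᵗ v₃) v₅)
      (cons v₃ (app v₁ v₀))
      (app v₁ v₀))
    (app v₁ v₀)

filterBody : Tm (tableᵀ ∷ num ∷ num ∷ Γ) tableᵀ
filterBody = rec v₀ (lit 0ℚ) nil filterStep

opaque
  filterᵗ : Tm Γ (num ⇒ num ⇒ tableᵀ ⇒ tableᵀ)
  filterᵗ = lam (lam (lam filterBody))

selectStep : Tm (entryᵀ ∷ (entryᵀ ⇒ entryᵀ) ∷ tableᵀ ∷ entryᵀ ∷ tableᵀ ∷ entryᵀ ∷ num ∷ Γ) entryᵀ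
selectStep =
  cond (leq v₆ (valueᵗ v₃))
    (cond (leq v₆ (valueᵗ v₀))
      (cond (leq (weightᵗ v₃) (weightᵗ v₀))
        (app v₁ v₃)
        (app v₁ v₀))
      (app v₁ v₃))
    (app v₁ v₀)

selectBody : Tm (tableᵀ ∷ entryᵀ ∷ num ∷ Γ) entryᵀ
selectBody = rec v₀ v₁ v₀ selectStep

opaque
  selectᵗ : Tm Γ (num ⇒ entryᵀ ⇒ tableᵀ ⇒ entryᵀ)
  selectᵗ = lam (lam (lam selectBody))

categoryBody : (ε δ : ℚ) → Tm ((num ⊗ num ⊗ list (item ⊗ num ⊗ num)) ∷ Γ) tableᵀ
categoryBody ε δ = app (app (app filterᵗ
  (arith mul (lit (1ℚ - ε)) (fst v₀)))
  (arith mul (lit (1ℚ + ε)) (fst (snd v₀))))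
  (app (treeᵗ δ) (app (app mapᵗ leafᵗ) (snd (snd v₀))))

opaque
  categoryᵗ : (ε δ : ℚ) → Tm Γ (num ⊗ num ⊗ list (item ⊗ num ⊗ num) ⇒ tableᵀ)
  categoryᵗ ε δ = lam (categoryBody ε δ)

-- Its value L - 1 tells it apart from the entries that meet the value bound.
failureᵗ : Tm (Input ∷ Γ) entryᵀ
failureᵗ = pair (lit 0ℚ) (pair (lit 0ℚ) (pair (arith sub (fst v₀) (lit 1ℚ)) (lam v₀)))

tablesᵗ : (ε δ : ℚ) → Tm (Input ∷ Γ) (list tableᵀ)
tablesᵗ ε δ = app (app mapᵗ (categoryᵗ ε δ)) (snd v₀)

bestᵗ : (ε δ : ℚ) → Tm (Input ∷ Γ) entryᵀ
bestᵗ ε δ = app (app (app selectᵗ (fst v₀)) failureᵗ) (app (treeᵗ δ) (tablesᵗ ε δ))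

programᵗ : (ε δ : ℚ) → Program
programᵗ ε δ = app (setᵗ (bestᵗ ε δ)) nil

-- Cost semantics: each program computes its counterpart on lists within a stated cost

module Operational (Item : Set) where
  open Semantics Item

  Env : List Ty → Set
  Env = All ⟦_⟧

  infix 3 _⇓_⟨_∣_⟩ _⊢_⇓_⟨_∣_⟩

  -- The cost bound j + k is split into a numeral j and a symbolic part k, so
  -- that the constants of straight-line code are compared by evaluation.
  record _⇓_⟨_∣_⟩ {A : Set} (c : Costed A) (a : A) (j k : ℕ) : Set where
    constructor _▹_
    field
      result : proj₁ c ≡ a
      cost   : proj₂ c ℕ.≤ j ℕ.+ k

  open _⇓_⟨_∣_⟩ public

  record _⊢_⇓_⟨_∣_⟩ (ρ : Env Γ) {A : Ty} (t : Tm Γ A) (a : ⟦ A ⟧) (j k : ℕ) : Set where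
    constructor ⟪_⟫
    field evaluates : eval t ρ ⇓ a ⟨ j ∣ k ⟩

  open _⊢_⇓_⟨_∣_⟩ public

  loop : ∀ {A B S} → Env Γ → Tm (S ∷ Γ) B → Tm (S ∷ (S ⇒ B) ∷ list A ∷ A ∷ Γ) B →
         List ⟦ A ⟧ → ⟦ S ⟧ → Costed ⟦ B ⟧
  loop ρ b c = recList (λ z → eval b (z ∷ ρ)) (λ x xs f z → eval c (z ∷ f ∷ xs ∷ x ∷ ρ))

  record Loop (ρ : Env Γ) {A B S} (b : Tm (S ∷ Γ) B) (c : Tm (S ∷ (S ⇒ B) ∷ list A ∷ A ∷ Γ) B)
              (xs : List ⟦ A ⟧) (z : ⟦ S ⟧) (a : ⟦ B ⟧) (j k : ℕ) : Set where
    constructor ⟪_⟫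
    field iterates : loop ρ b c xs z ⇓ a ⟨ j ∣ k ⟩

  open Loop public

  exact : ∀ {A : Set} {c : Costed A} → c ⇓ proj₁ c ⟨ proj₂ c ∣ 0 ⟩
  exact = refl ▹ ℕ.≤-reflexive (sym (ℕ.+-identityʳ _))

  tick⇓ : ∀ {A : Set} {c : Costed A} {a i k} → c ⇓ a ⟨ i ∣ k ⟩ → tick c ⇓ a ⟨ suc i ∣ k ⟩
  tick⇓ (p ▹ q) = p ▹ ℕ.s≤s q

  bind⇓ : ∀ {A B : Set} {c : Costed A} {f : A → Costed B} {a b i j k l} →
          c ⇓ a ⟨ i ∣ k ⟩ → f a ⇓ b ⟨ j ∣ l ⟩ → (c >>= f) ⇓ b ⟨ i ℕ.+ j ∣ k ℕ.+ l ⟩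
  bind⇓ {c = _ , _} {i = i} {j} {k} {l} (refl ▹ q) (p′ ▹ q′) =
    p′ ▹ ℕ.≤-trans (ℕ.+-mono-≤ q q′) (ℕ.≤-reflexive (ℕ-interchange i k j l))

  return⇓ : ∀ {A B : Set} {c : Costed A} {f : A → B} {a i k} →
            c ⇓ a ⟨ i ∣ k ⟩ → (c >>= λ x → return (f x)) ⇓ f a ⟨ i ∣ k ⟩
  return⇓ {c = _ , _} (refl ▹ q) = refl ▹ ℕ.≤-trans (ℕ.≤-reflexive (ℕ.+-identityʳ _)) q

  bounded : ∀ {A : Set} {c : Costed A} {a i k j l} → c ⇓ a ⟨ i ∣ k ⟩ →
            i ℕ.+ k ℕ.≤ j ℕ.+ l → c ⇓ a ⟨ j ∣ l ⟩
  bounded (p ▹ q) q′ = p ▹ ℕ.≤-trans q q′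

  module _ {ρ : Env Γ} {A : Ty} {t : Tm Γ A} where

    -- Rounds the numeral up, the inequality being decided by evaluation. This gives the branches of
    -- a `cond` a common bound, and the iterations of a loop a fixed one.
    widen : ∀ {a i j k} → ρ ⊢ t ⇓ a ⟨ i ∣ k ⟩ → {_ : T (i ℕ.≤ᵇ j)} → ρ ⊢ t ⇓ a ⟨ j ∣ k ⟩
    widen {i = i} {j} {k} ⟪ d ⟫ {t} = ⟪ bounded d (ℕ.+-monoˡ-≤ k (ℕ.≤ᵇ⇒≤ i j t)) ⟫

    relax : ∀ {a i j k l} → ρ ⊢ t ⇓ a ⟨ i ∣ k ⟩ → i ℕ.+ k ℕ.≤ j ℕ.+ l → ρ ⊢ t ⇓ a ⟨ j ∣ l ⟩
    relax ⟪ d ⟫ h = ⟪ bounded d h ⟫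

    lengthen : ∀ {a i k l} → ρ ⊢ t ⇓ a ⟨ i ∣ k ⟩ → k ℕ.≤ l → ρ ⊢ t ⇓ a ⟨ i ∣ l ⟩
    lengthen {i = i} d k≤l = relax d (ℕ.+-monoʳ-≤ i k≤l)

    -- Turns a numeral into part of the symbolic bound: the constant spent by one iteration becomes
    -- a summand of the cost of its loop.
    shift : ∀ {a k} i j → ρ ⊢ t ⇓ a ⟨ i ℕ.+ j ∣ k ⟩ → ρ ⊢ t ⇓ a ⟨ i ∣ j ℕ.+ k ⟩
    shift {k = k} i j ⟪ d ⟫ = ⟪ bounded d (ℕ.≤-reflexive (ℕ.+-assoc i j k)) ⟫

    now : ρ ⊢ t ⇓ proj₁ (eval t ρ) ⟨ proj₂ (eval t ρ) ∣ 0 ⟩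
    now = ⟪ exact ⟫

    simple : ∀ {j k} → {_ : T (proj₂ (eval t ρ) ℕ.≤ᵇ j)} → ρ ⊢ t ⇓ proj₁ (eval t ρ) ⟨ j ∣ k ⟩
    simple {j} {k} {t} = ⟪ refl ▹ ℕ.≤-trans (ℕ.≤ᵇ⇒≤ _ j t) (ℕ.m≤m+n j k) ⟫

  module _ {ρ : Env Γ} where

    app⇓ : ∀ {A B} {t : Tm Γ (A ⇒ B)} {s : Tm Γ A} {f a b i i′ j k k′ l} →
           ρ ⊢ t ⇓ f ⟨ i ∣ k ⟩ → ρ ⊢ s ⇓ a ⟨ i′ ∣ k′ ⟩ → f a ⇓ b ⟨ j ∣ l ⟩ →
           ρ ⊢ app t s ⇓ b ⟨ suc (i ℕ.+ (i′ ℕ.+ j)) ∣ k ℕ.+ (k′ ℕ.+ l) ⟩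
    app⇓ ⟪ p ⟫ ⟪ q ⟫ r = ⟪ tick⇓ (bind⇓ p (bind⇓ q r)) ⟫

    pair⇓ : ∀ {A B} {t : Tm Γ A} {s : Tm Γ B} {a b i j k l} →
            ρ ⊢ t ⇓ a ⟨ i ∣ k ⟩ → ρ ⊢ s ⇓ b ⟨ j ∣ l ⟩ →
            ρ ⊢ pair t s ⇓ (a , b) ⟨ suc (i ℕ.+ j) ∣ k ℕ.+ l ⟩
    pair⇓ ⟪ p ⟫ ⟪ q ⟫ = ⟪ tick⇓ (bind⇓ p (return⇓ q)) ⟫

    cons⇓ : ∀ {A} {t : Tm Γ A} {s : Tm Γ (list A)} {a as i j k l} →
            ρ ⊢ t ⇓ a ⟨ i ∣ k ⟩ → ρ ⊢ s ⇓ as ⟨ j ∣ l ⟩ →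
            ρ ⊢ cons t s ⇓ (a ∷ as) ⟨ suc (i ℕ.+ j) ∣ k ℕ.+ l ⟩
    cons⇓ ⟪ p ⟫ ⟪ q ⟫ = ⟪ tick⇓ (bind⇓ p (return⇓ q)) ⟫

    snd⇓ : ∀ {A B} {t : Tm Γ (A ⊗ B)} {ab : ⟦ A ⟧ × ⟦ B ⟧} {i k} →
           ρ ⊢ t ⇓ ab ⟨ i ∣ k ⟩ → ρ ⊢ snd t ⇓ proj₂ ab ⟨ suc i ∣ k ⟩
    snd⇓ ⟪ p ⟫ = ⟪ tick⇓ (return⇓ p) ⟫

    rec⇓ : ∀ {A B S} {t : Tm Γ (list A)} {s : Tm Γ S} {b : Tm (S ∷ Γ) B}
             {c : Tm (S ∷ (S ⇒ B) ∷ list A ∷ A ∷ Γ) B} {xs z a i i′ j k k′ l} →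
           ρ ⊢ t ⇓ xs ⟨ i ∣ k ⟩ → ρ ⊢ s ⇓ z ⟨ i′ ∣ k′ ⟩ → Loop ρ b c xs z a j l →
           ρ ⊢ rec t s b c ⇓ a ⟨ suc (i ℕ.+ (i′ ℕ.+ j)) ∣ k ℕ.+ (k′ ℕ.+ l) ⟩
    rec⇓ ⟪ p ⟫ ⟪ q ⟫ ⟪ r ⟫ = ⟪ tick⇓ (bind⇓ p (bind⇓ q r)) ⟫

    cond⇓ : ∀ {A} {t : Tm Γ bool} {s r : Tm Γ A} {b a a′ i j k} →
            ρ ⊢ t ⇓ b ⟨ i ∣ 0 ⟩ → ρ ⊢ s ⇓ a ⟨ j ∣ k ⟩ → ρ ⊢ r ⇓ a′ ⟨ j ∣ k ⟩ →
            ρ ⊢ cond t s r ⇓ (if b then a else a′) ⟨ suc (i ℕ.+ j) ∣ k ⟩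
    cond⇓ {t = t} {s} {r} {b = b} {a} {a′} {j = j} {k} ⟪ p ⟫ ⟪ q ⟫ ⟪ q′ ⟫ =
      ⟪ tick⇓ (bind⇓ {f = λ x → if x then eval s ρ else eval r ρ} p (branch b)) ⟫
      where
      branch : ∀ x → (if x then eval s ρ else eval r ρ) ⇓ (if x then a else a′) ⟨ j ∣ k ⟩
      branch true  = q
      branch false = q′

    base : ∀ {A B S} {b : Tm (S ∷ Γ) B} {c : Tm (S ∷ (S ⇒ B) ∷ list A ∷ A ∷ Γ) B} {z a j k} →
           (z ∷ ρ) ⊢ b ⇓ a ⟨ j ∣ k ⟩ → Loop ρ b c [] z a j k
    base ⟪ p ⟫ = ⟪ p ⟫

    step : ∀ {A B S} {b : Tm (S ∷ Γ) B} {c : Tm (S ∷ (S ⇒ B) ∷ list A ∷ A ∷ Γ) B} {x xs z a j k} →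
           (z ∷ loop ρ b c xs ∷ xs ∷ x ∷ ρ) ⊢ c ⇓ a ⟨ j ∣ k ⟩ → Loop ρ b c (x ∷ xs) z a j k
    step ⟪ p ⟫ = ⟪ p ⟫

    app₁⇓ : ∀ {A B} {t : Tm (A ∷ Γ) B} {s₁ a₁ b i₁ k₁ j k} →
            ρ ⊢ s₁ ⇓ a₁ ⟨ i₁ ∣ k₁ ⟩ → (a₁ ∷ ρ) ⊢ t ⇓ b ⟨ j ∣ k ⟩ →
            ρ ⊢ app (lam t) s₁ ⇓ b ⟨ 2 ℕ.+ (i₁ ℕ.+ j) ∣ k₁ ℕ.+ k ⟩
    app₁⇓ p₁ ⟪ q ⟫ = app⇓ now p₁ q

    app₂⇓ : ∀ {A₁ A₂ B} {t : Tm (A₂ ∷ A₁ ∷ Γ) B} {s₁ s₂ a₁ a₂ b i₁ i₂ k₂ j k} →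
            ρ ⊢ s₁ ⇓ a₁ ⟨ i₁ ∣ 0 ⟩ → ρ ⊢ s₂ ⇓ a₂ ⟨ i₂ ∣ k₂ ⟩ → (a₂ ∷ a₁ ∷ ρ) ⊢ t ⇓ b ⟨ j ∣ k ⟩ →
            ρ ⊢ app (app (lam (lam t)) s₁) s₂ ⇓ b ⟨ 4 ℕ.+ (i₁ ℕ.+ (i₂ ℕ.+ j)) ∣ k₂ ℕ.+ k ⟩
    app₂⇓ {i₁ = i₁} {i₂} {k₂} {j} {k} p₁ p₂ ⟪ q ⟫ =
      relax (app⇓ (app⇓ now p₁ exact) p₂ q) (ℕ.≤-reflexive (rearrange i₁ (i₂ ℕ.+ j) (k₂ ℕ.+ k)))
      where
      rearrange : ∀ a b c → suc (suc (suc (a ℕ.+ 1)) ℕ.+ b) ℕ.+ c ≡ 4 ℕ.+ (a ℕ.+ b) ℕ.+ c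
      rearrange = ℕ-RingSolver.solve-∀

    app₃⇓ : ∀ {A₁ A₂ A₃ B} {t : Tm (A₃ ∷ A₂ ∷ A₁ ∷ Γ) B} {s₁ s₂ s₃ a₁ a₂ a₃ b i₁ i₂ i₃ k₃ j k} →
            ρ ⊢ s₁ ⇓ a₁ ⟨ i₁ ∣ 0 ⟩ → ρ ⊢ s₂ ⇓ a₂ ⟨ i₂ ∣ 0 ⟩ → ρ ⊢ s₃ ⇓ a₃ ⟨ i₃ ∣ k₃ ⟩ →
            (a₃ ∷ a₂ ∷ a₁ ∷ ρ) ⊢ t ⇓ b ⟨ j ∣ k ⟩ →
            ρ ⊢ app (app (app (lam (lam (lam t))) s₁) s₂) s₃ ⇓ b
              ⟨ 6 ℕ.+ (i₁ ℕ.+ (i₂ ℕ.+ (i₃ ℕ.+ j))) ∣ k₃ ℕ.+ k ⟩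
    app₃⇓ {i₁ = i₁} {i₂} {i₃} {k₃} {j} {k} p₁ p₂ p₃ ⟪ q ⟫ =
      relax (app⇓ (app⇓ (app⇓ now p₁ exact) p₂ exact) p₃ q) (ℕ.≤-reflexive (rearrange i₁ i₂ (i₃ ℕ.+ j) (k₃ ℕ.+ k)))
      where
      rearrange : ∀ a b c d → suc (suc (suc (suc (a ℕ.+ 1)) ℕ.+ (b ℕ.+ 1)) ℕ.+ c) ℕ.+ d ≡ 6 ℕ.+ (a ℕ.+ (b ℕ.+ c)) ℕ.+ d
      rearrange = ℕ-RingSolver.solve-∀

  Entry Table : Set
  Entry = ⟦ entryᵀ ⟧
  Table = List Entry

  anchor wt val : Entry → ℚ
  anchor = proj₁
  wt     = proj₁ ∘ proj₂
  val    = proj₁ ∘ proj₂ ∘ proj₂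

  push : Entry → List Item → Costed (List Item)
  push = proj₂ ∘ proj₂ ∘ proj₂

  emptyEntry : Entry
  emptyEntry = 0ℚ , 0ℚ , 0ℚ , λ is → is , 1

  -- The set component is the evaluated body of `composeᵗ`, so that it agrees with the closure built
  -- by the program, cost included, by computation alone.
  join : Entry → Entry → Entry
  join x y = wt x + wt y , wt x + wt y , val x + val y ,
    λ is → eval (app v₂ (app v₁ v₀)) (is ∷ push y ∷ push x ∷ [])

  insert : ℚ → Entry → Table → Table
  insert r x []       = x ∷ []
  insert r x (y ∷ ys) =
    if anchor y ≤ᵇ r * wt x
    then (if wt x ≤ᵇ r * anchor y
          then (if val x ≤ᵇ val y then y ∷ ys else (anchor y , proj₂ x) ∷ ys)
          else y ∷ insert r x ys)
    else x ∷ y ∷ ys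

  opaque
    unfolding joinᵗ

    join⇓ : ∀ {ρ : Env Γ} {t s x y i j} → ρ ⊢ t ⇓ x ⟨ i ∣ 0 ⟩ → ρ ⊢ s ⇓ y ⟨ j ∣ 0 ⟩ →
            ρ ⊢ app (app joinᵗ t) s ⇓ join x y ⟨ 4 ℕ.+ (i ℕ.+ (j ℕ.+ 40)) ∣ 0 ⟩
    join⇓ p q = app₂⇓ p q (widen now)

  opaque
    unfolding insertᵗ

    insert⇓ : ∀ {ρ : Env Γ} {t₁ t₂ t₃ r x S i₁ i₂ i₃} →
      ρ ⊢ t₁ ⇓ r ⟨ i₁ ∣ 0 ⟩ → ρ ⊢ t₂ ⇓ x ⟨ i₂ ∣ 0 ⟩ → ρ ⊢ t₃ ⇓ S ⟨ i₃ ∣ 0 ⟩ →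
      ρ ⊢ app (app (app insertᵗ t₁) t₂) t₃ ⇓ insert r x S
        ⟨ 6 ℕ.+ (i₁ ℕ.+ (i₂ ℕ.+ (i₃ ℕ.+ 20))) ∣ length S ℕ.* 80 ⟩
    insert⇓ {ρ = ρ} {r = r} {x} {S} p₁ p₂ p₃ = app₃⇓ p₁ p₂ p₃ (widen (rec⇓ now now (steps S)))
      where
      steps : ∀ ys → Loop (S ∷ x ∷ r ∷ ρ) (cons v₂ nil) insertStep ys 0ℚ (insert r x ys) 10 (length ys ℕ.* 80)
      steps []       = base simple
      steps (y ∷ ys) = step (shift 10 80
        (widen (cond⇓ now (widen {j = 65} (cond⇓ now (widen {j = 30} (cond⇓ now (simple {j = 15}) simple))
                                  (widen (cons⇓ now (app⇓ now now (iterates (steps ys)))))))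
                      simple)))

  -- Tables only grow during a merge, so the length of the result bounds every intermediate table
  -- and thereby the cost of every insertion.
  length-insert : ∀ r x S → length S ℕ.≤ length (insert r x S)
  length-insert r x []       = ℕ.z≤n
  length-insert r x (y ∷ ys) with anchor y ≤ᵇ r * wt x | wt x ≤ᵇ r * anchor y | val x ≤ᵇ val y
  ... | true  | true  | true  = ℕ.≤-refl
  ... | true  | true  | false = ℕ.≤-refl
  ... | true  | false | _     = ℕ.s≤s (length-insert r x ys)
  ... | false | _     | _     = ℕ.n≤1+n _

  mergeRow : ℚ → Entry → Table → Table → Table
  mergeRow r x []       acc = acc
  mergeRow r x (y ∷ ys) acc = mergeRow r x ys (insert r (join x y) acc)

  mergeInto : ℚ → Table → Table → Table → Table
  mergeInto r []       S acc = acc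
  mergeInto r (x ∷ xs) S acc = mergeInto r xs S (mergeRow r x S acc)

  merge : ℚ → Table → Table → Table
  merge r R S = mergeInto r R S []

  length-mergeRow : ∀ r x S acc → length acc ℕ.≤ length (mergeRow r x S acc)
  length-mergeRow r x []       acc = ℕ.≤-refl
  length-mergeRow r x (y ∷ ys) acc =
    ℕ.≤-trans (length-insert r (join x y) acc) (length-mergeRow r x ys _)

  length-mergeInto : ∀ r R S acc → length acc ℕ.≤ length (mergeInto r R S acc)
  length-mergeInto r []       S acc = ℕ.≤-refl
  length-mergeInto r (x ∷ xs) S acc =
    ℕ.≤-trans (length-mergeRow r x S acc) (length-mergeInto r xs S _)

  opaque
    -- Each join of an entry of the first table with one of the second scans a table no longer than
    -- the result. The successors absorb the overhead of the loops.
    mergeCost : (a b c : ℕ) → ℕ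
    mergeCost a b c = 100 ℕ.* (suc a ℕ.* (suc b ℕ.* suc c))

    mergeCost≡ : ∀ a b c → mergeCost a b c ≡ 100 ℕ.* (suc a ℕ.* (suc b ℕ.* suc c))
    mergeCost≡ a b c = refl

  opaque
    unfolding mergeᵗ

    merge⇓ : ∀ {ρ : Env Γ} {t₁ t₂ t₃ r R S i₁ i₂ i₃} →
      ρ ⊢ t₁ ⇓ r ⟨ i₁ ∣ 0 ⟩ → ρ ⊢ t₂ ⇓ R ⟨ i₂ ∣ 0 ⟩ → ρ ⊢ t₃ ⇓ S ⟨ i₃ ∣ 0 ⟩ →
      ρ ⊢ app (app (app mergeᵗ t₁) t₂) t₃ ⇓ merge r R S
        ⟨ 6 ℕ.+ (i₁ ℕ.+ (i₂ ℕ.+ (i₃ ℕ.+ 0))) ∣ mergeCost (length R) (length S) (length (merge r R S)) ⟩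
    merge⇓ {ρ = ρ} {r = r} {R} {S} p₁ p₂ p₃ =
      app₃⇓ p₁ p₂ p₃ (relax (widen {j = 20} (rec⇓ now now (rows R [] ℕ.≤-refl))) (cost-bound (length R) (length S) N))
      where
      N M : ℕ
      N = length (merge r R S)
      M = 100 ℕ.+ N ℕ.* 80

      row : ∀ {acc₀ f rest} x ys acc → length (mergeRow r x ys acc) ℕ.≤ N →
            Loop (acc₀ ∷ f ∷ rest ∷ x ∷ S ∷ R ∷ r ∷ ρ) v₀ mergeRowStep ys acc (mergeRow r x ys acc) 5 (length ys ℕ.* M)
      row x []       acc _ = base simple
      row {acc₀} {f} {rest} x (y ∷ ys) acc h = step (shift 5 100 (widen
        (app⇓ now (lengthen (insert⇓ now (join⇓ now now) now) short) (iterates (row {acc₀} {f} {rest} x ys _ h)))))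
        where
        short : length acc ℕ.* 80 ℕ.≤ N ℕ.* 80
        short = ℕ.*-monoˡ-≤ 80 (ℕ.≤-trans (length-mergeRow r x (y ∷ ys) acc) h)

      rows : ∀ xs acc → length (mergeInto r xs S acc) ℕ.≤ N →
             Loop (S ∷ R ∷ r ∷ ρ) v₀ mergeStep xs acc (mergeInto r xs S acc) 5 (length xs ℕ.* (60 ℕ.+ length S ℕ.* M))
      rows []       acc _ = base simple
      rows (x ∷ xs) acc h = step (shift 5 60 (widen
        (app⇓ now (rec⇓ now now (row x S acc (ℕ.≤-trans (length-mergeInto r xs S _) h))) (iterates (rows xs _ h)))))

      cost-bound : ∀ a b n → 20 ℕ.+ a ℕ.* (60 ℕ.+ b ℕ.* (100 ℕ.+ n ℕ.* 80)) ℕ.≤ mergeCost a b n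
      cost-bound a b n = ℕ.m+n≤o⇒m≤o _ {slack a b n} (ℕ.≤-reflexive (trans (expand a b n) (sym (mergeCost≡ a b n))))
        where
        slack : ℕ → ℕ → ℕ → ℕ
        slack a b n = 80 ℕ.+ 40 ℕ.* a ℕ.+ 100 ℕ.* b ℕ.+ 100 ℕ.* n ℕ.+ 100 ℕ.* (a ℕ.* n) ℕ.+ 100 ℕ.* (b ℕ.* n)
                      ℕ.+ 20 ℕ.* (a ℕ.* (b ℕ.* n))

        expand : ∀ a b n → 20 ℕ.+ a ℕ.* (60 ℕ.+ b ℕ.* (100 ℕ.+ n ℕ.* 80)) ℕ.+
          (80 ℕ.+ 40 ℕ.* a ℕ.+ 100 ℕ.* b ℕ.+ 100 ℕ.* n ℕ.+ 100 ℕ.* (a ℕ.* n) ℕ.+ 100 ℕ.* (b ℕ.* n)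
           ℕ.+ 20 ℕ.* (a ℕ.* (b ℕ.* n))) ≡ 100 ℕ.* ((1 ℕ.+ a) ℕ.* ((1 ℕ.+ b) ℕ.* (1 ℕ.+ n)))
        expand = ℕ-RingSolver.solve-∀

  pairUpCost : ℚ → List Table → ℕ
  pairUpCost r (R ∷ S ∷ ts) = 60 ℕ.+ (mergeCost (length R) (length S) (length (merge r R S)) ℕ.+ pairUpCost r ts)
  pairUpCost r _            = 0

  opaque
    unfolding pairUpᵗ

    pairUp⇓ : ∀ {ρ : Env Γ} {t₁ t₂ r ts i₁ i₂} →
      ρ ⊢ t₁ ⇓ r ⟨ i₁ ∣ 0 ⟩ → ρ ⊢ t₂ ⇓ ts ⟨ i₂ ∣ 0 ⟩ →
      ρ ⊢ app (app pairUpᵗ t₁) t₂ ⇓ pairUp (merge r) ts ⟨ 4 ℕ.+ (i₁ ℕ.+ (i₂ ℕ.+ 30)) ∣ pairUpCost r ts ⟩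
    pairUp⇓ {ρ = ρ} {r = r} {ts} p₁ p₂ = app₂⇓ p₁ p₂ (widen (rec⇓ now now (steps ts)))
      where
      PairLoop : List Table → List Table → List Table → ℕ → ℕ → Set
      PairLoop = Loop (ts ∷ r ∷ ρ) v₀ pairUpStep

      stop : ∀ us → PairLoop [] us us 1 0
      stop us = base now

      steps : ∀ us → PairLoop us [] (pairUp (merge r) us) 20 (pairUpCost r us)

      pending : ∀ R S us → PairLoop (S ∷ us) (R ∷ []) (merge r R S ∷ pairUp (merge r) us) 60
                  (mergeCost (length R) (length S) (length (merge r R S)) ℕ.+ pairUpCost r us)
      pending R S us = step (widen (rec⇓ now now (step
        (cons⇓ (merge⇓ now now now) (app⇓ now now (iterates (steps us)))))))

      steps []           = base simple
      steps (R ∷ [])     = step (widen (rec⇓ now now (base (app⇓ now now (iterates (stop (R ∷ [])))))))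
      steps (R ∷ S ∷ us) = step (shift 20 60 (widen (rec⇓ now now (base (app⇓ now now (iterates (pending R S us)))))))

  tree : ℕ → ℚ → List Table → Table
  tree (suc k) δ (t ∷ [])        = t
  tree (suc k) δ ts@(_ ∷ _ ∷ _) = tree k (decay * δ) (pairUp (merge (1ℚ + δ)) ts)
  -- Also the answer when the fuel runs out. With as much fuel as tables this occurs for the empty
  -- list alone, since pairing shortens every list of two or more.
  tree _       _ _              = emptyEntry ∷ []

  treeCost : ℕ → ℚ → List Table → ℕ
  treeCost (suc k) δ ts@(_ ∷ _ ∷ _) =
    100 ℕ.+ (pairUpCost (1ℚ + δ) ts ℕ.+ treeCost k (decay * δ) (pairUp (merge (1ℚ + δ)) ts))
  treeCost _       _ _              = 0

  opaque
    unfolding treeᵗ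

    tree⇓ : ∀ {ρ : Env Γ} δ {t ts i k} → ρ ⊢ t ⇓ ts ⟨ i ∣ k ⟩ →
      ρ ⊢ app (treeᵗ δ) t ⇓ tree (length ts) δ ts ⟨ 2 ℕ.+ (i ℕ.+ 50) ∣ k ℕ.+ treeCost (length ts) δ ts ⟩
    tree⇓ {ρ = ρ} δ {ts = ts} p = app₁⇓ p (widen (rec⇓ now now (steps ts δ ts)))
      where
      steps : ∀ fuel δ us → Loop (ts ∷ ρ) (cons emptyᵗ nil) treeStep fuel (δ , us)
                (tree (length fuel) δ us) 30 (treeCost (length fuel) δ us)
      steps []         δ us            = base simple
      steps (_ ∷ fuel) δ []            = step (widen (rec⇓ now now (base now)))
      steps (_ ∷ fuel) δ (t ∷ [])      = step (widen (rec⇓ now now (step (rec⇓ now now (base now)))))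
      steps (_ ∷ fuel) δ (t ∷ t′ ∷ us) = step (shift 30 100 (widen (rec⇓ now now (step (rec⇓ now now (step
        (app⇓ now (pair⇓ now (pairUp⇓ now now)) (iterates (steps fuel (decay * δ) _)))))))))

  mapCost : ∀ {A : Set} → (A → ℕ) → List A → ℕ
  mapCost κ []       = 0
  mapCost κ (x ∷ xs) = 20 ℕ.+ (κ x ℕ.+ mapCost κ xs)

  opaque
    unfolding mapᵗ

    map⇓ : ∀ {ρ : Env Γ} {A B} {t₁ : Tm Γ (A ⇒ B)} {t₂ f xs g κ i₁ i₂} →
      ρ ⊢ t₁ ⇓ f ⟨ i₁ ∣ 0 ⟩ → ρ ⊢ t₂ ⇓ xs ⟨ i₂ ∣ 0 ⟩ → (∀ x → f x ⇓ g x ⟨ 0 ∣ κ x ⟩) →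
      ρ ⊢ app (app mapᵗ t₁) t₂ ⇓ map g xs ⟨ 4 ℕ.+ (i₁ ℕ.+ (i₂ ℕ.+ 20)) ∣ mapCost κ xs ⟩
    map⇓ {ρ = ρ} {f = f} {xs} {g} {κ} p₁ p₂ h = app₂⇓ p₁ p₂ (widen (rec⇓ now now (steps xs)))
      where
      steps : ∀ ys → Loop (xs ∷ f ∷ ρ) nil mapStep ys 0ℚ (map g ys) 10 (mapCost κ ys)
      steps []       = base simple
      steps (y ∷ ys) = step (shift 10 20 (widen (cons⇓ (app⇓ now now (h y)) (app⇓ now now (iterates (steps ys))))))

  leaf : Item × ℚ × ℚ → Table
  leaf (i , w , v) = emptyEntry ∷ (w , w , v , λ is → i ∷ is , 4) ∷ []

  opaque
    unfolding leafᵗ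

    leafᵗ⇓ : ∀ {ρ : Env Γ} → ρ ⊢ leafᵗ ⇓ proj₁ (eval leafᵗ ρ) ⟨ 1 ∣ 0 ⟩
    leafᵗ⇓ = now

    leaf⇓ : ∀ {ρ : Env Γ} x → proj₁ (eval leafᵗ ρ) x ⇓ leaf x ⟨ 0 ∣ 50 ⟩
    leaf⇓ x = refl ▹ ℕ.≤ᵇ⇒≤ _ 50 _

  restrict : (lo hi : ℚ) → Table → Table
  restrict lo hi []       = []
  restrict lo hi (x ∷ xs) =
    if lo ≤ᵇ wt x
    then (if wt x ≤ᵇ hi then x ∷ restrict lo hi xs else restrict lo hi xs)
    else restrict lo hi xs

  opaque
    unfolding filterᵗ

    restrict⇓ : ∀ {ρ : Env Γ} {t₁ t₂ t₃ lo hi S i₁ i₂ i₃ k} →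
      ρ ⊢ t₁ ⇓ lo ⟨ i₁ ∣ 0 ⟩ → ρ ⊢ t₂ ⇓ hi ⟨ i₂ ∣ 0 ⟩ → ρ ⊢ t₃ ⇓ S ⟨ i₃ ∣ k ⟩ →
      ρ ⊢ app (app (app filterᵗ t₁) t₂) t₃ ⇓ restrict lo hi S
        ⟨ 6 ℕ.+ (i₁ ℕ.+ (i₂ ℕ.+ (i₃ ℕ.+ 20))) ∣ k ℕ.+ length S ℕ.* 40 ⟩
    restrict⇓ {ρ = ρ} {lo = lo} {hi} {S} p₁ p₂ p₃ = app₃⇓ p₁ p₂ p₃ (widen (rec⇓ now now (steps S)))
      where
      steps : ∀ ys → Loop (S ∷ hi ∷ lo ∷ ρ) nil filterStep ys 0ℚ (restrict lo hi ys) 10 (length ys ℕ.* 40)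
      steps []       = base simple
      steps (y ∷ ys) = step (shift 10 40 (widen
        (cond⇓ now (widen {j = 30} (cond⇓ now (widen {j = 20} (cons⇓ now (app⇓ now now (iterates (steps ys)))))
                                              (widen (app⇓ now now (iterates (steps ys))))))
                   (widen (app⇓ now now (iterates (steps ys)))))))

  select : ℚ → Entry → Table → Entry
  select L z []       = z
  select L z (x ∷ xs) =
    if L ≤ᵇ val x
    then (if L ≤ᵇ val z
          then (if wt x ≤ᵇ wt z then select L x xs else select L z xs)
          else select L x xs)
    else select L z xs

  opaque
    unfolding selectᵗ

    select⇓ : ∀ {ρ : Env Γ} {t₁ t₂ t₃ L z S i₁ i₂ i₃ k} →
      ρ ⊢ t₁ ⇓ L ⟨ i₁ ∣ 0 ⟩ → ρ ⊢ t₂ ⇓ z ⟨ i₂ ∣ 0 ⟩ → ρ ⊢ t₃ ⇓ S ⟨ i₃ ∣ k ⟩ →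
      ρ ⊢ app (app (app selectᵗ t₁) t₂) t₃ ⇓ select L z S
        ⟨ 6 ℕ.+ (i₁ ℕ.+ (i₂ ℕ.+ (i₃ ℕ.+ 20))) ∣ k ℕ.+ length S ℕ.* 60 ⟩
    select⇓ {ρ = ρ} {L = L} {z} {S} p₁ p₂ p₃ = app₃⇓ p₁ p₂ p₃ (widen (rec⇓ now now (steps S z)))
      where
      steps : ∀ ys z′ → Loop (S ∷ z ∷ L ∷ ρ) v₀ selectStep ys z′ (select L z′ ys) 10 (length ys ℕ.* 60)
      steps []       z′ = base simple
      steps (y ∷ ys) z′ = step (shift 10 60 (widen
        (cond⇓ now (widen {j = 50} (cond⇓ now (widen {j = 30} (cond⇓ now (widen {j = 20} (app⇓ now now (iterates (steps ys y))))
                                                                          (widen (app⇓ now now (iterates (steps ys z′))))))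
                                              (widen (app⇓ now now (iterates (steps ys y))))))
                   (widen (app⇓ now now (iterates (steps ys z′)))))))

  module _ (ε δ : ℚ) where

    itemTables : List (Item × ℚ × ℚ) → List Table
    itemTables = map leaf

    itemTree : List (Item × ℚ × ℚ) → Table
    itemTree xs = tree (length (itemTables xs)) δ (itemTables xs)

    category : ℚ × ℚ × List (Item × ℚ × ℚ) → Table
    category (l , u , xs) = restrict ((1ℚ - ε) * l) ((1ℚ + ε) * u) (itemTree xs)

    categoryCost : ℚ × ℚ × List (Item × ℚ × ℚ) → ℕ
    categoryCost (l , u , xs) = 150 ℕ.+ ((mapCost (λ _ → 50) xs ℕ.+
      treeCost (length (itemTables xs)) δ (itemTables xs)) ℕ.+ length (itemTree xs) ℕ.* 40)

    opaque
      unfolding categoryᵗ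

      categoryᵗ⇓ : ∀ {ρ : Env Γ} → ρ ⊢ categoryᵗ ε δ ⇓ proj₁ (eval (categoryᵗ ε δ) ρ) ⟨ 1 ∣ 0 ⟩
      categoryᵗ⇓ = now

      category⇓ : ∀ {ρ : Env Γ} x → proj₁ (eval (categoryᵗ ε δ) ρ) x ⇓ category x ⟨ 0 ∣ categoryCost x ⟩
      category⇓ {ρ = ρ} x = evaluates {ρ = x ∷ ρ} {t = categoryBody ε δ} (shift 0 150 (widen
        (restrict⇓ now now (tree⇓ δ (map⇓ leafᵗ⇓ now leaf⇓)))))

    categoryTables : List (ℚ × ℚ × List (Item × ℚ × ℚ)) → List Table
    categoryTables = map category

    finalTable : List (ℚ × ℚ × List (Item × ℚ × ℚ)) → Table
    finalTable cs = tree (length (categoryTables cs)) δ (categoryTables cs)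

    failure : ℚ → Entry
    failure L = 0ℚ , 0ℚ , L - 1ℚ , λ is → is , 1

    best : ⟦ Input ⟧ → Entry
    best (L , cs) = select L (failure L) (finalTable cs)

    programCost : ⟦ Input ⟧ → ℕ
    programCost (L , cs) = (mapCost categoryCost cs ℕ.+
      treeCost (length (categoryTables cs)) δ (categoryTables cs)) ℕ.+ length (finalTable cs) ℕ.* 60

    best⇓ : ∀ x → (x ∷ []) ⊢ bestᵗ ε δ ⇓ best x ⟨ 180 ∣ programCost x ⟩
    best⇓ x = widen (select⇓ now now (tree⇓ δ (map⇓ categoryᵗ⇓ now category⇓)))

    program⇓ : ∀ x → (x ∷ []) ⊢ programᵗ ε δ ⇓ proj₁ (push (best x) [])
      ⟨ 190 ∣ programCost x ℕ.+ proj₂ (push (best x) []) ⟩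
    program⇓ x = widen (app⇓ (snd⇓ (snd⇓ (snd⇓ (best⇓ x)))) now (refl ▹ ℕ.≤-refl))

-- Order on the rationals, and the pairing of a level

0≤1 : 0ℚ ≤ 1ℚ
0≤1 = nonNegative⁻¹ 1ℚ

0<1 : 0ℚ < 1ℚ
0<1 = positive⁻¹ 1ℚ

*-monoˡ : ∀ {r p q} → 0ℚ ≤ r → p ≤ q → r * p ≤ r * q
*-monoˡ {r} 0≤r = *-monoˡ-≤-nonNeg r {{nonNegative 0≤r}}

*-monoʳ : ∀ {r p q} → 0ℚ ≤ r → p ≤ q → p * r ≤ q * r
*-monoʳ {r} 0≤r = *-monoʳ-≤-nonNeg r {{nonNegative 0≤r}}

*-mono : ∀ {p q r s} → 0ℚ ≤ p → 0ℚ ≤ s → p ≤ q → r ≤ s → p * r ≤ q * s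
*-mono 0≤p 0≤s p≤q r≤s = ≤-trans (*-monoˡ 0≤p r≤s) (*-monoʳ 0≤s p≤q)

0≤* : ∀ {p q} → 0ℚ ≤ p → 0ℚ ≤ q → 0ℚ ≤ p * q
0≤* {p} 0≤p 0≤q = ≤-trans (≤-reflexive (sym (*-zeroʳ p))) (*-monoˡ 0≤p 0≤q)

0≤+ : ∀ {p q} → 0ℚ ≤ p → 0ℚ ≤ q → 0ℚ ≤ p + q
0≤+ = +-mono-≤

≤-scale : ∀ {r p} → 1ℚ ≤ r → 0ℚ ≤ p → p ≤ r * p
≤-scale {r} {p} 1≤r 0≤p = ≤-trans (≤-reflexive (sym (*-identityˡ p))) (*-monoʳ 0≤p 1≤r)

cancel-≤ : ∀ {r p q} → 0ℚ < r → r * p ≤ r * q → p ≤ q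
cancel-≤ {r} 0<r = *-cancelˡ-≤-pos r {{positive 0<r}}

≤ᵇ-cases : ∀ p q → (p ≤ q × (p ≤ᵇ q) ≡ true) ⊎ (q < p × (p ≤ᵇ q) ≡ false)
≤ᵇ-cases p q with p ≤ᵇ q in eq
... | true  = inj₁ (≤ᵇ⇒≤ (subst T (sym eq) _) , refl)
... | false = inj₂ (≰⇒> (λ p≤q → subst T eq (≤⇒≤ᵇ p≤q)) , refl)

-- An odd last element passes to the next level unmerged; for it the relation is weakened from `R`
-- to `R′`.
pairUp-Pointwise : ∀ {a b} {A : Set a} {B : Set b} {r s} {R : A → B → Set r} {R′ : A → B → Set s}
  {_∙_ : A → A → A} {_∘_ : B → B → B} →
  (∀ {x y} → R x y → R′ x y) → (∀ {x x′ y y′} → R x y → R x′ y′ → R′ (x ∙ x′) (y ∘ y′)) →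
  ∀ {xs ys} → Pointwise R xs ys → Pointwise R′ (pairUp _∙_ xs) (pairUp _∘_ ys)
pairUp-Pointwise h k []           = []
pairUp-Pointwise h k (p ∷ [])     = h p ∷ []
pairUp-Pointwise h k (p ∷ q ∷ ps) = k p q ∷ pairUp-Pointwise h k ps

concat-pairUp : ∀ {a} {A : Set a} (xss : List (List A)) → concat (pairUp _++_ xss) ≡ concat xss
concat-pairUp []               = refl
concat-pairUp (xs ∷ [])        = refl
concat-pairUp (xs ∷ ys ∷ zss) =
  trans (cong ((xs ++ ys) ++_) (concat-pairUp zss)) (List.++-assoc xs ys (concat zss))

length-pairUp : ∀ {a} {A : Set a} (_∙_ : A → A → A) xs → length (pairUp _∙_ xs) ℕ.≤ length xs
length-pairUp _∙_ []           = ℕ.z≤n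
length-pairUp _∙_ (_ ∷ [])     = ℕ.≤-refl
length-pairUp _∙_ (_ ∷ _ ∷ xs) = ℕ.s≤s (ℕ.m≤n⇒m≤1+n (length-pairUp _∙_ xs))

-- The error of a tree

-- The error accumulated by a tree whose next level has precision δ.  One level
-- adds at most 6 δ = 60 δ - 60 (decay * δ), which makes the total telescope to
-- at most 1 + η.
errorFactor : ℚ → ℚ → ℚ
errorFactor η δ = 1ℚ + (η - ι 60 * δ)

0≤decay : 0ℚ ≤ decay
0≤decay = nonNegative⁻¹ decay

0≤60 : 0ℚ ≤ ι 60
0≤60 = nonNegative⁻¹ (ι 60)

decay-≤ : ∀ {δ} → 0ℚ ≤ δ → decay * δ ≤ δ
decay-≤ {δ} 0≤δ = ≤-trans (*-monoʳ 0≤δ (≤ᵇ⇒≤ {decay} {1ℚ} _)) (≤-reflexive (*-identityˡ δ))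

module _ {η δ : ℚ} where

  open ≤-Reasoning

  errorFactor≤ : 0ℚ ≤ δ → errorFactor η δ ≤ 1ℚ + η
  errorFactor≤ 0≤δ = +-monoʳ-≤ 1ℚ (begin
    η - ι 60 * δ   ≤⟨ +-monoʳ-≤ η (neg-antimono-≤ (0≤* 0≤60 0≤δ)) ⟩
    η - 0ℚ         ≡⟨ +-identityʳ η ⟩
    η              ∎)

  1≤errorFactor : ι 60 * δ ≤ η → 1ℚ ≤ errorFactor η δ
  1≤errorFactor δ≤η = begin
    1ℚ                                  ≡⟨ +-identityʳ 1ℚ ⟨
    1ℚ + 0ℚ                             ≡⟨ cong (1ℚ +_) (+-inverseʳ (ι 60 * δ)) ⟨
    1ℚ + (ι 60 * δ - ι 60 * δ)          ≤⟨ +-monoʳ-≤ 1ℚ (+-monoˡ-≤ (- (ι 60 * δ)) δ≤η) ⟩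
    errorFactor η δ                     ∎

  errorFactor-decay : 0ℚ ≤ δ → errorFactor η δ ≤ errorFactor η (decay * δ)
  errorFactor-decay 0≤δ =
    +-monoʳ-≤ 1ℚ (+-monoʳ-≤ η (neg-antimono-≤ (*-monoˡ 0≤60 (decay-≤ 0≤δ))))

  -- With `F` the present factor, the increase is `(2 δ + δ²) * F`. Here `δ ≤ 1` bounds the bracket
  -- by 3 δ and `η ≤ 1` bounds `F` by 2, which gives the 6 δ that one level may spend.
  errorFactor-step : 0ℚ ≤ δ → ι 60 * δ ≤ η → η ≤ 1ℚ →
    (1ℚ + δ) * (1ℚ + δ) * errorFactor η δ ≤ errorFactor η (decay * δ)
  errorFactor-step 0≤δ δ≤η η≤1 = begin
    (1ℚ + δ) * (1ℚ + δ) * F                    ≡⟨ expand δ F ⟩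
    F + (ι 2 * δ + δ * δ) * F                  ≤⟨ +-monoʳ-≤ F (*-mono 0≤2δ+δδ (nonNegative⁻¹ (ι 2)) 2δ+δδ≤ F≤2) ⟩
    F + (ι 2 * δ + δ * 1ℚ) * ι 2               ≡⟨ collect η δ ⟩
    errorFactor η (decay * δ)                  ∎
    where
    F = errorFactor η δ
    F≤2 : F ≤ ι 2
    F≤2 = ≤-trans (errorFactor≤ 0≤δ) (+-monoʳ-≤ 1ℚ η≤1)
    δ≤1 : δ ≤ 1ℚ
    δ≤1 = ≤-trans (≤-scale (≤ᵇ⇒≤ {1ℚ} {ι 60} _) 0≤δ) (≤-trans δ≤η η≤1)
    0≤2δ+δδ : 0ℚ ≤ ι 2 * δ + δ * δ
    0≤2δ+δδ = 0≤+ (0≤* (nonNegative⁻¹ (ι 2)) 0≤δ) (0≤* 0≤δ 0≤δ)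
    2δ+δδ≤ : ι 2 * δ + δ * δ ≤ ι 2 * δ + δ * 1ℚ
    2δ+δδ≤ = +-monoʳ-≤ (ι 2 * δ) (*-monoˡ 0≤δ δ≤1)
    expand : ∀ δ F → (1ℚ + δ) * (1ℚ + δ) * F ≡ F + (ι 2 * δ + δ * δ) * F
    expand = solve-∀ ℚ-ring
    collect : ∀ η δ → (1ℚ + (η - ι 60 * δ)) + (ι 2 * δ + δ * 1ℚ) * ι 2 ≡ 1ℚ + (η - ι 60 * (decay * δ))
    collect = solve-∀ ℚ-ring

-- Powers, logarithms and the change of base

private
  toℚᵘ-ι : ∀ k → toℚᵘ (ι k) ℚᵘ.≃ ℚᵘ.mkℚᵘ (ℤ.+ k) 0
  toℚᵘ-ι k = toℚᵘ-fromℚᵘ (ℚᵘ.mkℚᵘ (ℤ.+ k) 0)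

ι-+ : ∀ m n → ι (m ℕ.+ n) ≡ ι m + ι n
ι-+ m n = toℚᵘ-injective (ℚᵘ.≃-trans (toℚᵘ-ι (m ℕ.+ n)) (ℚᵘ.≃-trans
  (ℚᵘ.*≡* (trans (ℤ.*-identityʳ (ℤ.+ (m ℕ.+ n))) (sym (trans (ℤ.*-identityʳ _)
    (cong₂ ℤ._+_ (ℤ.*-identityʳ (ℤ.+ m)) (ℤ.*-identityʳ (ℤ.+ n)))))))
  (ℚᵘ.≃-sym (ℚᵘ.≃-trans (toℚᵘ-homo-+ (ι m) (ι n)) (ℚᵘ.+-cong (toℚᵘ-ι m) (toℚᵘ-ι n))))))

ι-* : ∀ m n → ι (m ℕ.* n) ≡ ι m * ι n
ι-* m n = toℚᵘ-injective (ℚᵘ.≃-trans (toℚᵘ-ι (m ℕ.* n)) (ℚᵘ.≃-trans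
  (ℚᵘ.*≡* (cong (ℤ._* ℤ.+ 1) (ℤ.pos-* m n)))
  (ℚᵘ.≃-sym (ℚᵘ.≃-trans (toℚᵘ-homo-* (ι m) (ι n)) (ℚᵘ.*-cong (toℚᵘ-ι m) (toℚᵘ-ι n))))))

0≤ι : ∀ k → 0ℚ ≤ ι k
0≤ι k = nonNegative⁻¹ (ι k) {{normalize-nonNeg k 1}}

ι-mono : ∀ {m n} → m ℕ.≤ n → ι m ≤ ι n
ι-mono {m} {n} m≤n = begin
  ι m                    ≡⟨ +-identityʳ (ι m) ⟨
  ι m + 0ℚ               ≤⟨ +-monoʳ-≤ (ι m) (0≤ι (n ℕ.∸ m)) ⟩
  ι m + ι (n ℕ.∸ m)      ≡⟨ ι-+ m (n ℕ.∸ m) ⟨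
  ι (m ℕ.+ (n ℕ.∸ m))    ≡⟨ cong ι (ℕ.m+[n∸m]≡n m≤n) ⟩
  ι n                    ∎
  where open ≤-Reasoning

0≤^ : ∀ {p} n → 0ℚ ≤ p → 0ℚ ≤ p ^ n
0≤^ zero    0≤p = 0≤1
0≤^ (suc n) 0≤p = 0≤* 0≤p (0≤^ n 0≤p)

^-monoˡ : ∀ {p q} n → 0ℚ ≤ p → p ≤ q → p ^ n ≤ q ^ n
^-monoˡ zero    0≤p p≤q = ≤-refl
^-monoˡ (suc n) 0≤p p≤q = *-mono 0≤p (0≤^ n (≤-trans 0≤p p≤q)) p≤q (^-monoˡ n 0≤p p≤q)

1≤^ : ∀ {p} n → 1ℚ ≤ p → 1ℚ ≤ p ^ n
1≤^ zero    1≤p = ≤-refl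
1≤^ (suc n) 1≤p = ≤-trans (1≤^ n 1≤p) (≤-scale 1≤p (≤-trans 0≤1 (1≤^ n 1≤p)))

^-distrib-* : ∀ p q n → (p * q) ^ n ≡ p ^ n * q ^ n
^-distrib-* p q zero    = refl
^-distrib-* p q (suc n) = trans (cong (p * q *_) (^-distrib-* p q n)) (interchange p q (p ^ n) (q ^ n))
  where
  interchange : ∀ p q s t → p * q * (s * t) ≡ p * s * (q * t)
  interchange = solve-∀ ℚ-ring

^-monoʳ-< : ∀ {r m n} → 1ℚ < r → m ℕ.< n → r ^ m < r ^ n
^-monoʳ-< {r} {m} {n} 1<r m<n = begin-strict
  r ^ m                          ≡⟨ *-identityˡ (r ^ m) ⟨
  1ℚ * r ^ m                     <⟨ *-monoˡ-<-pos (r ^ m) {{positive (<-≤-trans 0<1 (1≤^ m (<⇒≤ 1<r)))}} 1<r ⟩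
  r ^ suc m                      ≤⟨ ≤-scale (1≤^ (n ℕ.∸ suc m) (<⇒≤ 1<r)) (0≤^ (suc m) (≤-trans 0≤1 (<⇒≤ 1<r))) ⟩
  r ^ (n ℕ.∸ suc m) * r ^ suc m  ≡⟨ ^-homo-* r (n ℕ.∸ suc m) (suc m) ⟨
  r ^ (n ℕ.∸ suc m ℕ.+ suc m)    ≡⟨ cong (r ^_) (ℕ.m∸n+n≡m m<n) ⟩
  r ^ n                          ∎
  where
  open ≤-Reasoning

bernoulli : ∀ {δ} n → 0ℚ ≤ δ → 1ℚ + ι n * δ ≤ (1ℚ + δ) ^ n
bernoulli {δ} zero    0≤δ = ≤-reflexive (trans (cong (1ℚ +_) (*-zeroˡ δ)) (+-identityʳ 1ℚ))
bernoulli {δ} (suc n) 0≤δ = begin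
  1ℚ + ι (suc n) * δ                     ≡⟨ cong (λ k → 1ℚ + k * δ) (ι-+ 1 n) ⟩
  1ℚ + (1ℚ + ι n) * δ                    ≡⟨ rearrange (ι n) δ ⟩
  (1ℚ + ι n * δ) + δ * 1ℚ                ≤⟨ +-mono-≤ (bernoulli n 0≤δ) (*-monoˡ 0≤δ (1≤^ n (+-mono-≤ (≤-refl {1ℚ}) 0≤δ))) ⟩
  (1ℚ + δ) ^ n + δ * (1ℚ + δ) ^ n        ≡⟨ collect δ ((1ℚ + δ) ^ n) ⟩
  (1ℚ + δ) * (1ℚ + δ) ^ n                ∎
  where
  open ≤-Reasoning
  rearrange : ∀ k δ → 1ℚ + (1ℚ + k) * δ ≡ (1ℚ + k * δ) + δ * 1ℚ
  rearrange = solve-∀ ℚ-ring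
  collect : ∀ δ x → x + δ * x ≡ (1ℚ + δ) * x
  collect = solve-∀ ℚ-ring

numerator-denominator : ∀ {q} → 0ℚ ≤ q → q * ι (↧ₙ q) ≡ ι ℤ.∣ ↥ q ∣
numerator-denominator {q@(mkℚ (ℤ.+ a) d-1 c)} _ = toℚᵘ-injective (ℚᵘ.≃-trans
  (ℚᵘ.≃-trans (toℚᵘ-homo-* q (ι (suc d-1))) (ℚᵘ.*-congˡ {toℚᵘ q} (toℚᵘ-ι (suc d-1))))
  (ℚᵘ.≃-trans (ℚᵘ.*≡* (trans (ℤ.*-identityʳ _) (cong (ℤ.+ a ℤ.*_) (cong ℤ.+_ (sym (ℕ.*-identityʳ (suc d-1)))))))
    (ℚᵘ.≃-sym (toℚᵘ-ι a))))
numerator-denominator {mkℚ (ℤ.-[1+ _ ]) _ _} (*≤* ())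

ceiling-exists : ∀ {p} → 0ℚ ≤ p → ∃ λ M → p ≤ ι M × ι M ≤ p + 1ℚ
ceiling-exists {mkℚ (ℤ.-[1+ _ ]) _ _} (*≤* ())
ceiling-exists {p@(mkℚ (ℤ.+ a) d-1 c)} 0≤p = suc M , upper , lower
  where
  d M : ℕ
  d = suc d-1
  M = a ℕ./ d
  p*d : p * ι d ≡ ι a
  p*d = numerator-denominator 0≤p
  0<d : 0ℚ < ι d
  0<d = positive⁻¹ (ι d) {{normalize-pos d 1}}
  open ≤-Reasoning
  upper : p ≤ ι (suc M)
  upper = *-cancelʳ-≤-pos (ι d) {{positive 0<d}} (begin
    p * ι d                  ≡⟨ p*d ⟩
    ι a                      ≤⟨ ι-mono (ℕ.<⇒≤ (subst (ℕ._< suc M ℕ.* d) (sym (ℕ.m≡m%n+[m/n]*n a d)) (ℕ.+-monoˡ-< (M ℕ.* d) (ℕ.m%n<n a d)))) ⟩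
    ι (suc M ℕ.* d)          ≡⟨ ι-* (suc M) d ⟩
    ι (suc M) * ι d          ∎)
  lower : ι (suc M) ≤ p + 1ℚ
  lower = *-cancelʳ-≤-pos (ι d) {{positive 0<d}} (begin
    ι (suc M) * ι d          ≡⟨ ι-* (suc M) d ⟨
    ι (d ℕ.+ M ℕ.* d)        ≤⟨ ι-mono (ℕ.≤-trans (ℕ.+-monoʳ-≤ d (ℕ.m/n*n≤m a d)) (ℕ.≤-reflexive (ℕ.+-comm d a))) ⟩
    ι (a ℕ.+ d)              ≡⟨ ι-+ a d ⟩
    ι a + ι d                ≡⟨ cong₂ _+_ (sym p*d) (sym (*-identityˡ (ι d))) ⟩
    p * ι d + 1ℚ * ι d       ≡⟨ *-distribʳ-+ (ι d) p 1ℚ ⟨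
    (p + 1ℚ) * ι d           ∎)

-- Bernoulli gives `1 + ε ≤ (1 + δ) ^ M` for a natural `M` with `ε / δ ≤ M ≤ ε / δ + 1`. Raising the
-- hypothesis to the denominator `d` of `q = a / d` leaves a comparison of powers of `1 + δ` with
-- natural exponents, `k * d ≤ M * a`. Hence `k ≤ M * q`, without any real logarithm.
log-bound : ∀ {ε δ x q k} → 0ℚ < δ → 0ℚ ≤ ε → Max1Log≤ (1ℚ + ε) x q → (1ℚ + δ) ^ k ≤ x →
            ι k * δ ≤ (ε + δ) * q
log-bound {ε} {δ} {x} {q} {k} 0<δ 0≤ε log r^k≤x = begin
  ι k * δ             ≤⟨ *-monoʳ 0≤δ k≤Mq ⟩
  ι M * q * δ         ≡⟨ rearrange (ι M) q δ ⟩
  ι M * δ * q         ≤⟨ *-monoʳ (≤-trans 0≤1 1≤q) Mδ≤ ⟩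
  (ε + δ) * q         ∎
  where
  open ≤-Reasoning
  open Max1Log≤ log
  instance
    δ-pos : Positive δ
    δ-pos = positive 0<δ
    δ-nonZero : NonZero δ
    δ-nonZero = pos⇒nonZero δ
  0≤δ = <⇒≤ 0<δ
  r = 1ℚ + δ
  d a M : ℕ
  d = ↧ₙ q
  a = ℤ.∣ ↥ q ∣
  0≤ε/δ : 0ℚ ≤ ε ÷ δ
  0≤ε/δ = 0≤* 0≤ε (<⇒≤ (positive⁻¹ (1/ δ) {{1/pos⇒pos δ}}))
  M = proj₁ (ceiling-exists 0≤ε/δ)
  ε/δ*δ : ε ÷ δ * δ ≡ ε
  ε/δ*δ = trans (*-assoc ε (1/ δ) δ) (trans (cong (ε *_) (*-inverseˡ δ)) (*-identityʳ ε))
  rearrange : ∀ M q δ → M * q * δ ≡ M * δ * q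
  rearrange = solve-∀ ℚ-ring
  ε≤Mδ : ε ≤ ι M * δ
  ε≤Mδ = ≤-trans (≤-reflexive (sym ε/δ*δ)) (*-monoʳ 0≤δ (proj₁ (proj₂ (ceiling-exists 0≤ε/δ))))
  Mδ≤ : ι M * δ ≤ ε + δ
  Mδ≤ = begin
    ι M * δ                  ≤⟨ *-monoʳ 0≤δ (proj₂ (proj₂ (ceiling-exists 0≤ε/δ))) ⟩
    (ε ÷ δ + 1ℚ) * δ         ≡⟨ *-distribʳ-+ δ (ε ÷ δ) 1ℚ ⟩
    ε ÷ δ * δ + 1ℚ * δ       ≡⟨ cong₂ _+_ ε/δ*δ (*-identityˡ δ) ⟩
    ε + δ                    ∎
  0≤r : 0ℚ ≤ r
  0≤r = 0≤+ 0≤1 0≤δ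
  1<r : 1ℚ < r
  1<r = subst (_< r) (+-identityʳ 1ℚ) (+-monoʳ-< 1ℚ 0<δ)
  r^kd≤r^Ma : r ^ (k ℕ.* d) ≤ r ^ (M ℕ.* a)
  r^kd≤r^Ma = begin
    r ^ (k ℕ.* d)      ≡⟨ ^-assocʳ r k d ⟨
    (r ^ k) ^ d        ≤⟨ ^-monoˡ d (0≤^ k 0≤r) r^k≤x ⟩
    x ^ d              ≤⟨ log≤q ⟩
    (1ℚ + ε) ^ a       ≤⟨ ^-monoˡ a (0≤+ 0≤1 0≤ε) (≤-trans (+-monoʳ-≤ 1ℚ ε≤Mδ) (bernoulli M 0≤δ)) ⟩
    (r ^ M) ^ a        ≡⟨ ^-assocʳ r M a ⟩
    r ^ (M ℕ.* a)      ∎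
  kd≤Ma : k ℕ.* d ℕ.≤ M ℕ.* a
  kd≤Ma = ℕ.≮⇒≥ λ Ma<kd → <-irrefl refl (<-≤-trans (^-monoʳ-< 1<r Ma<kd) r^kd≤r^Ma)
  k≤Mq : ι k ≤ ι M * q
  k≤Mq = *-cancelʳ-≤-pos (ι d) {{normalize-pos d 1}} (begin
    ι k * ι d           ≡⟨ ι-* k d ⟨
    ι (k ℕ.* d)         ≤⟨ ι-mono kd≤Ma ⟩
    ι (M ℕ.* a)         ≡⟨ ι-* M a ⟩
    ι M * ι a           ≡⟨ cong (ι M *_) (numerator-denominator (≤-trans 0≤1 1≤q)) ⟨
    ι M * (q * ι d)     ≡⟨ *-assoc (ι M) q (ι d) ⟨
    ι M * q * ι d       ∎)

-- Level costs as a geometric series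

cube-product : ∀ {a b c X} → 0ℚ ≤ a → 0ℚ ≤ b → 0ℚ ≤ c → a ^ 3 ≤ X → b ^ 3 ≤ X → c ^ 3 ≤ X → a * (b * c) ≤ X
cube-product {a} {b} {c} {X} 0≤a 0≤b 0≤c a³ b³ c³ = largest (≤-total a b) (≤-total b c) (≤-total a c)
  where
  dominated : ∀ {m} → 0ℚ ≤ m → m ^ 3 ≤ X → a ≤ m → b ≤ m → c ≤ m → a * (b * c) ≤ X
  dominated {m} 0≤m m³ a≤m b≤m c≤m = ≤-trans (*-mono 0≤a (0≤* 0≤m 0≤m) a≤m (*-mono 0≤b 0≤m b≤m c≤m))
    (≤-trans (≤-reflexive (cong (λ x → m * (m * x)) (sym (*-identityʳ m)))) m³)
  largest : a ≤ b ⊎ b ≤ a → b ≤ c ⊎ c ≤ b → a ≤ c ⊎ c ≤ a → a * (b * c) ≤ X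
  largest (inj₁ a≤b) (inj₁ b≤c) _          = dominated 0≤c c³ (≤-trans a≤b b≤c) b≤c ≤-refl
  largest (inj₁ a≤b) (inj₂ c≤b) _          = dominated 0≤b b³ a≤b ≤-refl c≤b
  largest (inj₂ b≤a) _          (inj₁ a≤c) = dominated 0≤c c³ a≤c (≤-trans b≤a a≤c) ≤-refl
  largest (inj₂ b≤a) _          (inj₂ c≤a) = dominated 0≤a a³ ≤-refl b≤a c≤a

-- An odd number of tables leaves one unpaired, so the ratio 1/2 holds only up to rounding. The
-- worst case is three tables, of which two remain.
length-pairUp-2+ : ∀ {a} {A : Set a} (_∙_ : A → A → A) x y xs →
  3 ℕ.* length (pairUp _∙_ (x ∷ y ∷ xs)) ℕ.≤ 2 ℕ.* length (x ∷ y ∷ xs)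
length-pairUp-≤ : ∀ {a} {A : Set a} (_∙_ : A → A → A) xs → 3 ℕ.* length (pairUp _∙_ xs) ℕ.≤ suc (2 ℕ.* length xs)
length-pairUp-2+ _∙_ x y xs = begin
  3 ℕ.* suc (length (pairUp _∙_ xs))        ≡⟨ ℕ.*-suc 3 _ ⟩
  3 ℕ.+ 3 ℕ.* length (pairUp _∙_ xs)        ≤⟨ ℕ.+-monoʳ-≤ 3 (length-pairUp-≤ _∙_ xs) ⟩
  3 ℕ.+ suc (2 ℕ.* length xs)               ≡⟨ rearrange (length xs) ⟩
  2 ℕ.* (2 ℕ.+ length xs)                   ∎
  where
  open ℕ.≤-Reasoning
  rearrange : ∀ k → 3 ℕ.+ suc (2 ℕ.* k) ≡ 2 ℕ.* (2 ℕ.+ k)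
  rearrange = ℕ-RingSolver.solve-∀
length-pairUp-≤ _∙_ []           = ℕ.z≤n
length-pairUp-≤ _∙_ (_ ∷ [])     = ℕ.≤-refl
length-pairUp-≤ _∙_ (x ∷ y ∷ xs) = ℕ.m≤n⇒m≤1+n (length-pairUp-2+ _∙_ x y xs)

-- One level of a tree multiplies the bound on the cubes of the table sizes by
-- growth = 7/5 ≥ decay⁻³ and the number of tables by at most 2/3, so that their
-- product shrinks by the factor shrink = 14/15.
rate : ℚ
rate = ℤ.+ 7 / 15

growth shrink : ℚ
growth = ι 3 * rate
shrink = ι 2 * rate

≤-growth : ∀ {X} → 0ℚ ≤ X → X ≤ growth * X
≤-growth = ≤-scale (≤ᵇ⇒≤ {1ℚ} {growth} _)

-- Holds because (9/10)³ · 7/5 = 1.0206 exceeds 1. It carries the bound `K ^ 3 ≤ X * δ ^ 3` from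
-- level to level while `X` grows by 7/5 only.
precision-step : ∀ {k X δ} → 0ℚ ≤ X → 0ℚ ≤ δ → k ≤ X * δ ^ 3 → k ≤ growth * X * (decay * δ) ^ 3
precision-step {k} {X} {δ} 0≤X 0≤δ k≤ = begin
  k                                                  ≤⟨ k≤ ⟩
  X * δ ^ 3                                          ≤⟨ ≤-scale (≤ᵇ⇒≤ {1ℚ} {decay * (decay * (decay * growth))} _) (0≤* 0≤X (0≤^ 3 0≤δ)) ⟩
  decay * (decay * (decay * growth)) * (X * δ ^ 3)   ≡⟨ rearrange decay growth X δ ⟩
  growth * X * (decay * δ) ^ 3                       ∎
  where
  open ≤-Reasoning
  rearrange : ∀ d g X δ → d * (d * (d * g)) * (X * (δ * (δ * (δ * 1ℚ)))) ≡ g * X * ((d * δ) * ((d * δ) * ((d * δ) * 1ℚ)))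
  rearrange = solve-∀ ℚ-ring

volume-step : ∀ {a b X} → 0ℚ ≤ X → 3 ℕ.* a ℕ.≤ 2 ℕ.* b → ι a * (growth * X) ≤ shrink * (ι b * X)
volume-step {a} {b} {X} 0≤X 3a≤2b = begin
  ι a * (growth * X)         ≡⟨ split rate (ι a) X ⟩
  (ι 3 * ι a) * (rate * X)      ≡⟨ cong (_* (rate * X)) (ι-* 3 a) ⟨
  ι (3 ℕ.* a) * (rate * X)      ≤⟨ *-monoʳ (0≤* (≤ᵇ⇒≤ {0ℚ} {rate} _) 0≤X) (ι-mono 3a≤2b) ⟩
  ι (2 ℕ.* b) * (rate * X)      ≡⟨ cong (_* (rate * X)) (ι-* 2 b) ⟩
  (ι 2 * ι b) * (rate * X)      ≡⟨ regroup rate (ι b) X ⟩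
  shrink * (ι b * X)         ∎
  where
  open ≤-Reasoning
  split : ∀ rate N X → N * (ι 3 * rate * X) ≡ (ι 3 * N) * (rate * X)
  split = solve-∀ ℚ-ring
  regroup : ∀ rate N X → (ι 2 * N) * (rate * X) ≡ (ι 2 * rate) * (N * X)
  regroup = solve-∀ ℚ-ring

-- Sums the geometric series. A level of volume `y` costs at most 80 y, and its constant 100 is
-- below 7 y because `y` is at least 16. The remaining levels start from a volume of at most 14/15
-- y, and 87 + 87 · 14 = 87 · 15.
cost-step : ∀ {p t y z} → ι 2 * ι 8 ≤ y → p ≤ ι 80 * y → t ≤ ι 87 * (ι 15 * z) → z ≤ shrink * y →
            ι 100 + (p + t) ≤ ι 87 * (ι 15 * y)
cost-step {p} {t} {y} {z} 16≤y p≤ t≤ z≤ = begin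
  ι 100 + (p + t)
    ≤⟨ +-mono-≤ (≤-trans (≤ᵇ⇒≤ {ι 100} {ι 7 * (ι 2 * ι 8)} _) (*-monoˡ (0≤ι 7) 16≤y))
         (+-mono-≤ p≤ (≤-trans t≤ (*-monoˡ (0≤ι 87) (*-monoˡ (0≤ι 15) z≤)))) ⟩
  ι 7 * y + (ι 80 * y + ι 87 * (ι 15 * (shrink * y)))
    ≡⟨ cong (λ x → ι 7 * y + (ι 80 * y + ι 87 * x)) (*-assoc (ι 15) shrink y) ⟨
  ι 7 * y + (ι 80 * y + ι 87 * (ι 14 * y))
    ≡⟨ collect y ⟩
  ι 87 * (ι 15 * y)
    ∎
  where
  open ≤-Reasoning
  collect : ∀ y → ι 7 * y + (ι 80 * y + ι 87 * (ι 14 * y)) ≡ ι 87 * (ι 15 * y)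
  collect = solve-∀ ℚ-ring

-- Tables: cells, separation and representation

module Tables (Item : Set) where
  open Operational Item

  -- Used between a weight and an anchor only, never between the weights of two entries, so its
  -- failure to be transitive does no harm. Among nonnegative numbers zero shares a cell with zero
  -- alone.
  SameCell : ℚ → ℚ → ℚ → Set
  SameCell r p q = p ≤ r * q × q ≤ r * p

  data Insertion (r : ℚ) (x y : Entry) (ys : Table) : Table → Set where
    kept     : SameCell r (wt x) (anchor y) → val x ≤ val y → Insertion r x y ys (y ∷ ys)
    replaced : SameCell r (wt x) (anchor y) → val y ≤ val x → Insertion r x y ys ((anchor y , proj₂ x) ∷ ys)
    later    : r * anchor y < wt x → Insertion r x y ys (y ∷ insert r x ys)
    before   : r * wt x < anchor y → Insertion r x y ys (x ∷ y ∷ ys)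

  insertion : ∀ r x y ys → Insertion r x y ys (insert r x (y ∷ ys))
  insertion r x y ys with ≤ᵇ-cases (anchor y) (r * wt x)
  ... | inj₂ (p , eq) rewrite eq = before p
  ... | inj₁ (p , eq) rewrite eq with ≤ᵇ-cases (wt x) (r * anchor y)
  ...   | inj₂ (q , eq′) rewrite eq′ = later q
  ...   | inj₁ (q , eq′) rewrite eq′ with ≤ᵇ-cases (val x) (val y)
  ...     | inj₁ (v , eq″) rewrite eq″ = kept (q , p) v
  ...     | inj₂ (v , eq″) rewrite eq″ = replaced (q , p) (<⇒≤ v)

  Payload : Set
  Payload = ℚ × ℚ × (List Item → Costed (List Item))

  private variable
    ℓ₀ : Level

  -- Anchor and payload have separate predicates because a replacement combines the anchor of one
  -- entry with the payload of another.
  Both : (ℚ → Set) → (Payload → Set ℓ₀) → Entry → Set ℓ₀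
  Both A P e = A (anchor e) × P (proj₂ e)

  insert-All : ∀ {A} {P : Payload → Set ℓ₀} {r x S} → Both A P x → All (Both A P) S → All (Both A P) (insert r x S)
  insert-All px [] = px ∷ []
  insert-All {r = r} {x} {y ∷ ys} px (py ∷ pys) with insert r x (y ∷ ys) | insertion r x y ys
  ... | _ | kept _ _     = py ∷ pys
  ... | _ | replaced _ _ = (proj₁ py , proj₂ px) ∷ pys
  ... | _ | later _      = py ∷ insert-All px pys
  ... | _ | before _     = px ∷ py ∷ pys

  Close : ℚ → Entry → Set
  Close r e = SameCell r (wt e) (anchor e)

  insert-Close : ∀ {r x S} → Close r x → All (Close r) S → All (Close r) (insert r x S)
  insert-Close px [] = px ∷ []
  insert-Close {r} {x} {y ∷ ys} px (py ∷ pys) with insert r x (y ∷ ys) | insertion r x y ys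
  ... | _ | kept _ _     = py ∷ pys
  ... | _ | replaced c _ = c ∷ pys
  ... | _ | later _      = py ∷ insert-Close px pys
  ... | _ | before _     = px ∷ py ∷ pys

  -- Compares with the anchor of `e` and not with its weight: later replacements in the cell change
  -- the weight, never lower the value, and keep the anchor.
  Represented : ℚ → Entry → Table → Set
  Represented r x S = ∃ λ e → e ∈ S × SameCell r (wt x) (anchor e) × val x ≤ val e

  insert-new : ∀ {r x} → SameCell r (wt x) (anchor x) → ∀ S → Represented r x (insert r x S)
  insert-new {x = x} c [] = x , here refl , c , ≤-refl
  insert-new {r} {x} c (y ∷ ys) with insert r x (y ∷ ys) | insertion r x y ys
  ... | _ | kept c′ v     = y , here refl , c′ , v
  ... | _ | replaced c′ _ = _ , here refl , c′ , ≤-refl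
  ... | _ | before _      = x , here refl , c , ≤-refl
  ... | _ | later _       with insert-new c ys
  ...   | e , e∈ , c′ , v = e , there e∈ , c′ , v

  insert-old : ∀ {r x z S} → Represented r z S → Represented r z (insert r x S)
  insert-old {r} {x} {z} {y ∷ ys} (e , e∈ , c , v) with insert r x (y ∷ ys) | insertion r x y ys
  ... | _ | kept _ _ = e , e∈ , c , v
  ... | _ | before _ = e , there e∈ , c , v
  insert-old (e , here refl , c , v) | _ | replaced _ v′ = _ , here refl , c , ≤-trans v v′
  insert-old (e , there e∈ , c , v)  | _ | replaced _ _  = e , there e∈ , c , v
  insert-old (e , here refl , c , v) | _ | later _       = e , here refl , c , v
  insert-old {r} {x} {z} {y ∷ ys} (e , there e∈ , c , v)  | _ | later _ with insert-old {r} {x} {z} {ys} (e , e∈ , c , v)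
  ... | e′ , e′∈ , c′ , v′ = e′ , there e′∈ , c′ , v′

  Separated : ℚ → Table → Set
  Separated r = AllPairs λ y z → r * anchor y < anchor z

  -- A comparison that fails in `insert` is a strict inequality with the factor `r`, which is the
  -- separation needed on that side of `y`. Beyond `y`, `1 ≤ r` makes separation transitive.
  insert-Separated : ∀ {r x S} → 1ℚ ≤ r → anchor x ≡ wt x → 0ℚ ≤ wt x → All (λ e → 0ℚ ≤ anchor e) S →
                     Separated r S → Separated r (insert r x S)
  insert-Separated {S = []} 1≤r eq 0≤w _ _ = [] ∷ []
  insert-Separated {r} {x} {y ∷ ys} 1≤r eq 0≤w (0≤y ∷ 0≤ys) (y<ys ∷ ys-sep)
    with insert r x (y ∷ ys) | insertion r x y ys
  ... | _ | kept _ _     = y<ys ∷ ys-sep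
  ... | _ | replaced _ _ = y<ys ∷ ys-sep
  ... | _ | later p      =
    -- Insertion adds to the anchors of the tail at most that of `x`. `insert-All` says so when its
    -- payload predicate holds trivially, as `0ℚ ≤ 0ℚ` does.
    All.map proj₁ (insert-All {A = λ g → r * anchor y < g} {P = λ _ → 0ℚ ≤ 0ℚ}
      (subst (r * anchor y <_) (sym eq) p , ≤-refl) (All.map {P = λ z → r * anchor y < anchor z} (λ q → q , ≤-refl) y<ys))
    ∷ insert-Separated 1≤r eq 0≤w 0≤ys ys-sep
  ... | _ | before p rewrite sym eq =
    (p ∷ All.map (λ q → <-trans p (≤-<-trans (≤-scale 1≤r 0≤y) q)) y<ys) ∷ y<ys ∷ ys-sep

  mergeRow-preserves : ∀ {r x S acc} (I : Table → Set ℓ₀) →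
    (∀ {y acc} → y ∈ S → I acc → I (insert r (join x y) acc)) → I acc → I (mergeRow r x S acc)
  mergeRow-preserves {S = []}     I h i = i
  mergeRow-preserves {S = y ∷ ys} I h i = mergeRow-preserves {S = ys} I (h ∘ there) (h (here refl) i)

  mergeInto-preserves : ∀ {r R S acc} (I : Table → Set ℓ₀) →
    (∀ {x y acc} → x ∈ R → y ∈ S → I acc → I (insert r (join x y) acc)) → I acc → I (mergeInto r R S acc)
  mergeInto-preserves {R = []} I h i = i
  mergeInto-preserves {R = x ∷ xs} {S} I h i =
    mergeInto-preserves {R = xs} I (h ∘ there) (mergeRow-preserves {S = S} I (h (here refl)) i)

  module _ {r : ℚ} (1≤r : 1ℚ ≤ r) where

    self-cell : ∀ {p} → 0ℚ ≤ p → SameCell r p p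
    self-cell 0≤p = ≤-scale 1≤r 0≤p , ≤-scale 1≤r 0≤p

    mergeRow-represents : ∀ {x y S} acc → y ∈ S → 0ℚ ≤ wt (join x y) → Represented r (join x y) (mergeRow r x S acc)
    mergeRow-represents {x} {y} {_ ∷ ys} acc (here refl) 0≤w =
      mergeRow-preserves {S = ys} (Represented r (join x y)) (λ {y′} _ → insert-old {x = join x y′} {z = join x y}) (insert-new (self-cell 0≤w) acc)
    mergeRow-represents acc (there y∈) 0≤w = mergeRow-represents _ y∈ 0≤w

    mergeInto-represents : ∀ {x y R S} acc → x ∈ R → y ∈ S → 0ℚ ≤ wt (join x y) →
                           Represented r (join x y) (mergeInto r R S acc)
    mergeInto-represents {x} {y} {_ ∷ xs} acc (here refl) y∈ 0≤w =
      mergeInto-preserves {R = xs} (Represented r (join x y)) (λ {x′} {y′} _ _ → insert-old {x = join x′ y′} {z = join x y}) (mergeRow-represents acc y∈ 0≤w)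
    mergeInto-represents {R = _ ∷ _} acc (there x∈) y∈ 0≤w = mergeInto-represents _ x∈ y∈ 0≤w

    record Grid (A : ℚ → Set) (P : Payload → Set ℓ₀) (S : Table) : Set ℓ₀ where
      field
        payloads  : All (Both A P) S
        close     : All (Close r) S
        separated : Separated r S

    -- `A` stays a parameter for two uses: nonnegativity for correctness, and `InRange` for the size
    -- of the table.
    merge-Grid : ∀ {A} {P : Payload → Set ℓ₀} {R S} → (∀ {g} → A g → 0ℚ ≤ g) →
      (∀ {x y} → x ∈ R → y ∈ S → Both A P (join x y)) → Grid A P (merge r R S)
    merge-Grid {A = A} {P} {R} 0≤A h = mergeInto-preserves {R = R} (Grid A P) extend record { payloads = [] ; close = [] ; separated = [] }
      where
      extend : ∀ {x y acc} → x ∈ R → y ∈ _ → Grid A P acc → Grid A P (insert r (join x y) acc)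
      extend x∈ y∈ g = record
        { payloads  = insert-All (h x∈ y∈) payloads
        ; close     = insert-Close (self-cell 0≤w) close
        ; separated = insert-Separated 1≤r refl 0≤w (All.map (0≤A ∘ proj₁) payloads) separated
        }
        where
        open Grid g
        0≤w = 0≤A (proj₁ (h x∈ y∈))

  -- Specifications: what a table contains and what it approximates

  Triple : Set
  Triple = List Item × ℚ × ℚ

  wgt gain : Triple → ℚ
  wgt  = proj₁ ∘ proj₂
  gain = proj₂ ∘ proj₂

  ∅ : Triple
  ∅ = [] , 0ℚ , 0ℚ

  infixr 5 _⊕_
  _⊕_ : Triple → Triple → Triple
  (is , w , v) ⊕ (is′ , w′ , v′) = is ++ is′ , w + w′ , v + v′

  ⊕-identityˡ : ∀ x → ∅ ⊕ x ≡ x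
  ⊕-identityˡ (is , w , v) = cong₂ (λ w v → is , w , v) (+-identityˡ w) (+-identityˡ v)

  ⊕-assoc : ∀ x y z → (x ⊕ y) ⊕ z ≡ x ⊕ (y ⊕ z)
  ⊕-assoc (is , w , v) (is′ , w′ , v′) (is″ , w″ , v″) =
    cong₂ _,_ (List.++-assoc is is′ is″) (cong₂ _,_ (+-assoc w w′ w″) (+-assoc v v′ v″))

  -- The Minkowski sum of a list of sets of triples.
  data ⨁ : List (Triple → Set) → Triple → Set₁ where
    []  : ⨁ [] ∅
    _∷_ : ∀ {P Ps x y} → P x → ⨁ Ps y → ⨁ (P ∷ Ps) (x ⊕ y)

  ⨁-++ : ∀ {Ps Qs x y} → ⨁ Ps x → ⨁ Qs y → ⨁ (Ps ++ Qs) (x ⊕ y)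
  ⨁-++ {y = y} [] qs rewrite ⊕-identityˡ y = qs
  ⨁-++ {y = y} (_∷_ {x = x} {y = x′} p ps) qs rewrite ⊕-assoc x x′ y = p ∷ ⨁-++ ps qs

  ⨁-split : ∀ Ps {Qs z} → ⨁ (Ps ++ Qs) z → ∃₂ λ x y → ⨁ Ps x × ⨁ Qs y × z ≡ x ⊕ y
  ⨁-split []       {z = z} qs = ∅ , z , [] , qs , sym (⊕-identityˡ z)
  ⨁-split (P ∷ Ps) (_∷_ {x = x} p r) with ⨁-split Ps r
  ... | x′ , y , ps , qs , refl = x ⊕ x′ , y , p ∷ ps , qs , sym (⊕-assoc x x′ y)

  -- What a table may contain for one item or category (sound), and what it has
  -- to approximate (target).  `load` bounds the weight, and `chain` the cost of
  -- a difference list.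
  record Leaf : Set₁ where
    field
      sound target   : Triple → Set
      load           : ℚ
      chain          : ℕ
      0≤load         : 0ℚ ≤ load
      sound-nonneg   : ∀ {x} → sound x → 0ℚ ≤ wgt x
      sound-bounded  : ∀ {x} → sound x → wgt x ≤ load
      target-nonneg  : ∀ {x} → target x → 0ℚ ≤ wgt x

  open Leaf public

  Block : Set₁
  Block = List Leaf

  sounds targets : Block → List (Triple → Set)
  sounds  = map sound
  targets = map target

  loads : Block → ℚ
  loads []      = 0ℚ
  loads (ℓ ∷ B) = load ℓ + loads B

  chains : Block → ℕ
  chains []      = 0
  chains (ℓ ∷ B) = chain ℓ ℕ.+ chains B

  ⨁-sounds-nonneg : ∀ {B x} → ⨁ (sounds B) x → 0ℚ ≤ wgt x
  ⨁-sounds-nonneg {[]}    []       = ≤-refl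
  ⨁-sounds-nonneg {ℓ ∷ B} (p ∷ ps) = 0≤+ (sound-nonneg ℓ p) (⨁-sounds-nonneg ps)

  ⨁-targets-nonneg : ∀ {B x} → ⨁ (targets B) x → 0ℚ ≤ wgt x
  ⨁-targets-nonneg {[]}    []       = ≤-refl
  ⨁-targets-nonneg {ℓ ∷ B} (p ∷ ps) = 0≤+ (target-nonneg ℓ p) (⨁-targets-nonneg ps)

  ⨁-bounded : ∀ {B x} → ⨁ (sounds B) x → wgt x ≤ loads B
  ⨁-bounded {[]}    []       = ≤-refl
  ⨁-bounded {ℓ ∷ B} (p ∷ ps) = +-mono-≤ (sound-bounded ℓ p) (⨁-bounded ps)

  record Realizes (κ : ℕ) (x : Triple) (p : Payload) : Set where
    field
      weighs : proj₁ p ≡ wgt x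
      gains  : proj₁ (proj₂ p) ≡ gain x
      pushes : ∀ is → proj₁ (proj₂ (proj₂ p) is) ≡ proj₁ x ++ is
      -- 5 units are spent on composing two difference lists.
      cheap  : ∀ is → 5 ℕ.+ proj₂ (proj₂ (proj₂ p) is) ℕ.≤ κ

  SoundPayload : ℕ → Block → Payload → Set₁
  SoundPayload κ B p = ∃ λ x → ⨁ (sounds B) x × Realizes κ x p

  Sound : ℕ → Block → Table → Set₁
  Sound κ B = All (SoundPayload κ B ∘ proj₂)

  Near : ℚ → Entry → Triple → Set
  Near F e x = wt e ≤ F * wgt x × wgt x ≤ F * wt e × gain x ≤ val e

  Covers : ℚ → Block → Table → Set₁
  Covers F B S = ∀ {x} → ⨁ (targets B) x → ∃ λ e → e ∈ S × Near F e x

  Realizes-mono : ∀ {κ κ′ x p} → κ ℕ.≤ κ′ → Realizes κ x p → Realizes κ′ x p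
  Realizes-mono κ≤κ′ ρ = record
    { weighs = weighs ; gains = gains ; pushes = pushes ; cheap = λ is → ℕ.≤-trans (cheap is) κ≤κ′ }
    where open Realizes ρ

  Sound-mono : ∀ {κ κ′ B S} → κ ℕ.≤ κ′ → Sound κ B S → Sound κ′ B S
  Sound-mono κ≤κ′ = All.map λ (x , s , ρ) → x , s , Realizes-mono κ≤κ′ ρ

  -- Both operands hold 5 units in reserve. One reserve pays for the composition and the other
  -- remains for the next one, so that `κ` is additive.
  join-Realizes : ∀ {κ κ′ x x′} {e e′ : Entry} → Realizes κ x (proj₂ e) → Realizes κ′ x′ (proj₂ e′) →
                  Realizes (κ ℕ.+ κ′) (x ⊕ x′) (proj₂ (join e e′))
  join-Realizes {κ} {κ′} {x} {x′} {e} {e′} ρ ρ′ = record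
    { weighs = cong₂ _+_ (weighs ρ) (weighs ρ′)
    ; gains  = cong₂ _+_ (gains ρ) (gains ρ′)
    ; pushes = λ is → trans (pushes ρ _) (trans (cong (proj₁ x ++_) (pushes ρ′ is)) (sym (List.++-assoc (proj₁ x) (proj₁ x′) is)))
    ; cheap  = λ is → ℕ.≤-trans (ℕ.≤-reflexive (rearrange (proj₂ (push e′ is)) (proj₂ (push e (proj₁ (push e′ is))))))
                                (ℕ.+-mono-≤ (cheap ρ (proj₁ (push e′ is))) (cheap ρ′ is))
    }
    where
    open Realizes
    rearrange : ∀ a b → 10 ℕ.+ (a ℕ.+ b) ≡ (5 ℕ.+ b) ℕ.+ (5 ℕ.+ a)
    rearrange = ℕ-RingSolver.solve-∀

  chains-++ : ∀ B C → chains (B ++ C) ≡ chains B ℕ.+ chains C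
  chains-++ []      C = refl
  chains-++ (ℓ ∷ B) C = trans (cong (chain ℓ ℕ.+_) (chains-++ B C)) (sym (ℕ.+-assoc (chain ℓ) (chains B) (chains C)))

  loads-++ : ∀ B C → loads (B ++ C) ≡ loads B + loads C
  loads-++ []      C = sym (+-identityˡ (loads C))
  loads-++ (ℓ ∷ B) C = trans (cong (load ℓ +_) (loads-++ B C)) (sym (+-assoc (load ℓ) (loads B) (loads C)))

  join-SoundPayload : ∀ {B C} {e e′ : Entry} → SoundPayload (chains B) B (proj₂ e) → SoundPayload (chains C) C (proj₂ e′) →
                      SoundPayload (chains (B ++ C)) (B ++ C) (proj₂ (join e e′))
  join-SoundPayload {B} {C} {e} {e′} (x , s , ρ) (x′ , s′ , ρ′) =
    x ⊕ x′ , subst (λ Ps → ⨁ Ps (x ⊕ x′)) (sym (List.map-++ sound B C)) (⨁-++ s s′) ,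
    subst (λ κ → Realizes κ (x ⊕ x′) (proj₂ (join e e′))) (sym (chains-++ B C)) (join-Realizes {e = e} {e′} ρ ρ′)

  sound-nonneg-entry : ∀ {κ B} {e : Entry} → SoundPayload κ B (proj₂ e) → 0ℚ ≤ wt e
  sound-nonneg-entry (x , s , ρ) = ≤-trans (⨁-sounds-nonneg s) (≤-reflexive (sym (Realizes.weighs ρ)))

  merge-Sound : ∀ {r} (1≤r : 1ℚ ≤ r) {A B C R S} → (∀ {g} → A g → 0ℚ ≤ g) →
    (∀ {x} → ⨁ (sounds (B ++ C)) x → A (wgt x)) → Sound (chains B) B R → Sound (chains C) C S →
    Grid 1≤r A (SoundPayload (chains (B ++ C)) (B ++ C)) (merge r R S)
  merge-Sound 1≤r {A} {B} {C} {R} {S} 0≤A inA sR sS = merge-Grid 1≤r 0≤A both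
    where
    both : ∀ {e e′} → e ∈ R → e′ ∈ S → Both A (SoundPayload (chains (B ++ C)) (B ++ C)) (join e e′)
    both {e} {e′} e∈ e′∈ with join-SoundPayload {B} {C} {e} {e′} (All.lookup sR e∈) (All.lookup sS e′∈)
    ... | p@(x , s , ρ) = subst A (sym (Realizes.weighs ρ)) (inA s) , p

  -- However many joins meet in a cell, the loss is `r * r`: both cell relations refer to the
  -- anchor, which never changes, so errors do not accumulate over insertions.
  merge-Covers : ∀ {r F F′ B C R S} → 1ℚ ≤ r → 0ℚ ≤ F → r * r * F ≤ F′ →
    Sound (chains B) B R → Sound (chains C) C S → Covers F B R → Covers F C S → Covers F′ (B ++ C) (merge r R S)
  merge-Covers {r} {F} {F′} {B} {C} {R} {S} 1≤r 0≤F bound sR sS cR cS {z} t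
    with ⨁-split (targets B) (subst (λ Ps → ⨁ Ps z) (List.map-++ target B C) t)
  ... | x , y , tx , ty , refl with cR tx | cS ty
  ...   | e₁ , e₁∈ , near₁ | e₂ , e₂∈ , near₂
    with mergeInto-represents 1≤r {R = R} {S} [] e₁∈ e₂∈
           (0≤+ (sound-nonneg-entry {e = e₁} (All.lookup sR e₁∈)) (sound-nonneg-entry {e = e₂} (All.lookup sS e₂∈)))
  ...     | e , e∈ , cell , v = e , e∈ , upper , lower ,
    ≤-trans (+-mono-≤ (proj₂ (proj₂ near₁)) (proj₂ (proj₂ near₂))) v
    where
    grid = merge-Sound 1≤r {A = 0ℚ ≤_} {B} {C} {R} {S} id (⨁-sounds-nonneg {B ++ C}) sR sS
    module G = Grid grid
    j = join e₁ e₂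
    closeE : SameCell r (wt e) (anchor e)
    closeE = All.lookup G.close e∈
    0≤r = ≤-trans 0≤1 1≤r
    0≤wt : 0ℚ ≤ wt e
    0≤wt = sound-nonneg-entry {e = e} (proj₂ (All.lookup G.payloads e∈))
    0≤z : 0ℚ ≤ wgt x + wgt y
    0≤z = 0≤+ (⨁-targets-nonneg {B} tx) (⨁-targets-nonneg {C} ty)
    open ≤-Reasoning
    assoc : ∀ r F w → r * (r * (F * w)) ≡ r * r * F * w
    assoc = solve-∀ ℚ-ring
    assoc′ : ∀ r F w → F * (r * (r * w)) ≡ r * r * F * w
    assoc′ = solve-∀ ℚ-ring
    upper : wt e ≤ F′ * (wgt x + wgt y)
    upper = begin
      wt e                                ≤⟨ proj₁ closeE ⟩
      r * anchor e                        ≤⟨ *-monoˡ 0≤r (proj₂ cell) ⟩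
      r * (r * wt j)                      ≤⟨ *-monoˡ 0≤r (*-monoˡ 0≤r (+-mono-≤ (proj₁ near₁) (proj₁ near₂))) ⟩
      r * (r * (F * wgt x + F * wgt y))   ≡⟨ cong (λ q → r * (r * q)) (*-distribˡ-+ F (wgt x) (wgt y)) ⟨
      r * (r * (F * (wgt x + wgt y)))     ≡⟨ assoc r F (wgt x + wgt y) ⟩
      r * r * F * (wgt x + wgt y)         ≤⟨ *-monoʳ 0≤z bound ⟩
      F′ * (wgt x + wgt y)                ∎
    lower : wgt x + wgt y ≤ F′ * wt e
    lower = begin
      wgt x + wgt y            ≤⟨ +-mono-≤ (proj₁ (proj₂ near₁)) (proj₁ (proj₂ near₂)) ⟩
      F * wt e₁ + F * wt e₂    ≡⟨ *-distribˡ-+ F (wt e₁) (wt e₂) ⟨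
      F * wt j                 ≤⟨ *-monoˡ 0≤F (proj₁ cell) ⟩
      F * (r * anchor e)       ≤⟨ *-monoˡ 0≤F (*-monoˡ 0≤r (proj₂ closeE)) ⟩
      F * (r * (r * wt e))     ≡⟨ assoc′ r F (wt e) ⟩
      r * r * F * wt e         ≤⟨ *-monoʳ 0≤wt bound ⟩
      F′ * wt e                ∎

  Covers-mono : ∀ {F F′ κ B S} → F ≤ F′ → Sound κ B S → Covers F B S → Covers F′ B S
  Covers-mono {B = B} F≤F′ s c t with c t
  ... | e , e∈ , a , b , v = e , e∈ , ≤-trans a (*-monoʳ (⨁-targets-nonneg {B} t) F≤F′) ,
    ≤-trans b (*-monoʳ (sound-nonneg-entry {e = e} (All.lookup s e∈)) F≤F′) , v

  record Models (F : ℚ) (B : Block) (S : Table) : Set₁ where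
    constructor models
    field
      is-sound : Sound (chains B) B S
      covers   : Covers F B S

  merge-Models : ∀ {δ F F′ B C R S} → 0ℚ ≤ δ → 0ℚ ≤ F → (1ℚ + δ) * (1ℚ + δ) * F ≤ F′ →
    Models F B R → Models F C S → Models F′ (B ++ C) (merge (1ℚ + δ) R S)
  merge-Models {B = B} {C} {R} {S} 0≤δ 0≤F bound (models sR cR) (models sS cS) = models
    (All.map proj₂ (Grid.payloads (merge-Sound 1≤r {A = 0ℚ ≤_} {B} {C} {R} {S} id (⨁-sounds-nonneg {B ++ C}) sR sS)))
    (merge-Covers {B = B} {C} {R} {S} 1≤r 0≤F bound sR sS cR cS)
    where 1≤r = +-mono-≤ (≤-refl {1ℚ}) 0≤δ

  empty-Realizes : Realizes 6 ∅ (proj₂ emptyEntry)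
  empty-Realizes = record { weighs = refl ; gains = refl ; pushes = λ _ → refl ; cheap = λ _ → ℕ.≤-refl }

  empty-Sound : Sound 6 [] (emptyEntry ∷ [])
  empty-Sound = (∅ , [] , empty-Realizes) ∷ []

  empty-Covers : ∀ {F} → Covers F [] (emptyEntry ∷ [])
  empty-Covers {F} [] = emptyEntry , here refl , F0 , F0 , ≤-refl
    where F0 = ≤-reflexive (sym (*-zeroʳ F))

  -- Pairing leaves `concat Bs` unchanged, so the claim about the whole block survives every level
  -- while the error moves from `errorFactor η δ` towards `1 + η`. The 6 covers the default table of
  -- the empty list, where `chains` is zero.
  tree-Models : ∀ {η} k {δ Bs ts} → length ts ℕ.≤ k → 0ℚ ≤ δ → ι 60 * δ ≤ η → η ≤ 1ℚ →
    Pointwise (Models (errorFactor η δ)) Bs ts →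
    Sound (6 ℕ.+ chains (concat Bs)) (concat Bs) (tree k δ ts) × Covers (1ℚ + η) (concat Bs) (tree k δ ts)
  tree-Models {η} zero _ _ _ _ [] = empty-Sound , empty-Covers {1ℚ + η}
  tree-Models {η} (suc k) _ _ _ _ [] = empty-Sound , empty-Covers {1ℚ + η}
  tree-Models {η} (suc k) {δ} {B ∷ []} {S ∷ []} _ 0≤δ _ _ (models s c ∷ []) rewrite List.++-identityʳ B =
    Sound-mono (ℕ.m≤n+m _ 6) s , Covers-mono {B = B} (errorFactor≤ {η} 0≤δ) s c
  tree-Models {η} (suc k) {δ} {Bs@(_ ∷ _ ∷ Bs′)} {ts@(_ ∷ _ ∷ us)} (ℕ.s≤s len) 0≤δ δ≤η η≤1 ms =
    subst (λ B → Sound (6 ℕ.+ chains B) B S × Covers (1ℚ + η) B S) (concat-pairUp Bs)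
      (tree-Models k (ℕ.≤-trans (ℕ.s≤s (length-pairUp _ us)) len) (0≤* 0≤decay 0≤δ)
        (≤-trans (*-monoˡ 0≤60 (decay-≤ 0≤δ)) δ≤η) η≤1
        (pairUp-Pointwise weaken level ms))
    where
    S = tree k (decay * δ) (pairUp (merge (1ℚ + δ)) ts)
    bound : (1ℚ + δ) * (1ℚ + δ) * errorFactor η δ ≤ errorFactor η (decay * δ)
    bound = errorFactor-step 0≤δ δ≤η η≤1
    weaken : ∀ {B S} → Models (errorFactor η δ) B S → Models (errorFactor η (decay * δ)) B S
    weaken {B} (models s c) = models s (Covers-mono {B = B} (errorFactor-decay {η} 0≤δ) s c)
    level : ∀ {B C R S} → Models (errorFactor η δ) B R → Models (errorFactor η δ) C S →
            Models (errorFactor η (decay * δ)) (B ++ C) (merge (1ℚ + δ) R S)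
    level {B} {C} {R} {S} = merge-Models {B = B} {C} {R} {S} 0≤δ (≤-trans 0≤1 (1≤errorFactor {η} {δ} δ≤η)) bound

  -- Table sizes and the cost of a tree

  Fits : (W wmin : ℚ) → Block → Set₁
  Fits W wmin B = loads B ≤ W × All (λ ℓ → ∀ {x} → sound ℓ x → wgt x ≡ 0ℚ ⊎ wmin ≤ wgt x) B

  0≤loads : ∀ B → 0ℚ ≤ loads B
  0≤loads []      = ≤-refl
  0≤loads (ℓ ∷ B) = 0≤+ (0≤load ℓ) (0≤loads B)

  Fits-++⁻ : ∀ {W wmin} B {C} → Fits W wmin (B ++ C) → Fits W wmin B × Fits W wmin C
  Fits-++⁻ {W} B {C} (h , at) = (≤-trans left h′ , All.++⁻ˡ B at) , (≤-trans right h′ , All.++⁻ʳ B at)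
    where
    h′ : loads B + loads C ≤ W
    h′ = ≤-trans (≤-reflexive (sym (loads-++ B C))) h
    left : loads B ≤ loads B + loads C
    left = ≤-trans (≤-reflexive (sym (+-identityʳ _))) (+-monoʳ-≤ (loads B) (0≤loads C))
    right : loads C ≤ loads B + loads C
    right = ≤-trans (≤-reflexive (sym (+-identityˡ _))) (+-monoˡ-≤ (loads C) (0≤loads B))

  -- Bounds the cube because the cost of a merge is a product of three such lengths, and because the
  -- bound then grows by a rational factor per level, without cube roots.
  record Small (X : ℚ) (S : Table) : Set where
    constructor small
    field cube≤ : ι (suc (length S)) ^ 3 ≤ X

  open Small public

  Small-mono : ∀ {X Y S} → X ≤ Y → Small X S → Small Y S
  Small-mono X≤Y (small h) = small (≤-trans h X≤Y)

  module Packing {wmin W : ℚ} (0<wmin : 0ℚ < wmin) (wmin≤W : wmin ≤ W) where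

    InRange : ℚ → Set
    InRange g = 0ℚ ≤ g × g ≤ W × (g ≡ 0ℚ ⊎ wmin ≤ g)

    ⨁-atomic : ∀ {B x} → All (λ ℓ → ∀ {x} → sound ℓ x → wgt x ≡ 0ℚ ⊎ wmin ≤ wgt x) B →
               ⨁ (sounds B) x → wgt x ≡ 0ℚ ⊎ wmin ≤ wgt x
    ⨁-atomic {[]}    []       []       = inj₁ refl
    ⨁-atomic {ℓ ∷ B} (h ∷ hs) (_∷_ {x = x} {y = y} p ps) with h p | ⨁-atomic {B} hs ps
    ... | inj₁ x≡0 | inj₁ y≡0    = inj₁ (cong₂ _+_ x≡0 y≡0)
    ... | inj₁ x≡0 | inj₂ wmin≤y = inj₂ (≤-trans wmin≤y (≤-reflexive (trans (sym (+-identityˡ _)) (cong (_+ wgt y) (sym x≡0)))))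
    ... | inj₂ wmin≤x | _        = inj₂ (≤-trans wmin≤x (≤-trans (≤-reflexive (sym (+-identityʳ _))) (+-monoʳ-≤ (wgt x) (⨁-sounds-nonneg {B} ps))))

    ⨁-InRange : ∀ {B x} → Fits W wmin B → ⨁ (sounds B) x → InRange (wgt x)
    ⨁-InRange {B} (h , at) s = ⨁-sounds-nonneg {B} s , ≤-trans (⨁-bounded {B} s) h , ⨁-atomic {B} at s

    packing : ∀ {r b z} zs → 1ℚ ≤ r → 0ℚ ≤ b → b ≤ anchor z → All (InRange ∘ anchor) (z ∷ zs) →
              Separated r (z ∷ zs) → b * r ^ length zs ≤ W
    packing {r} {b} [] 1≤r 0≤b b≤z ((_ , z≤W , _) ∷ _) _ =
      ≤-trans (≤-reflexive (*-identityʳ b)) (≤-trans b≤z z≤W)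
    packing {r} {b} {z} (z′ ∷ zs) 1≤r 0≤b b≤z (_ ∷ in-zs) ((z<z′ ∷ _) ∷ sep) =
      ≤-trans (≤-reflexive (rearrange b r (r ^ length zs)))
        (packing zs 1≤r (0≤* 0≤r 0≤b) (≤-trans (*-monoˡ 0≤r b≤z) (<⇒≤ z<z′)) in-zs sep)
      where
      0≤r = ≤-trans 0≤1 1≤r
      rearrange : ∀ b r x → b * (r * x) ≡ r * b * x
      rearrange = solve-∀ ℚ-ring

    -- The smallest anchor may be zero. The second exceeds `r` times a nonnegative number, so it is
    -- positive and hence at least `wmin`; from there on anchors grow by the factor `r` and stay at
    -- most `W`. The first two anchors come on top of the `k` growth steps.
    Separated-length : ∀ {r S} → 1ℚ ≤ r → All (InRange ∘ anchor) S → Separated r S →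
      ∃ λ k → length S ℕ.≤ 2 ℕ.+ k × wmin * r ^ k ≤ W
    Separated-length {S = []} _ _ _ = 0 , ℕ.z≤n , ≤-trans (≤-reflexive (*-identityʳ wmin)) wmin≤W
    Separated-length {S = y ∷ []} _ _ _ = 0 , ℕ.s≤s ℕ.z≤n , ≤-trans (≤-reflexive (*-identityʳ wmin)) wmin≤W
    Separated-length {r} {y ∷ z ∷ zs} 1≤r ((0≤y , _) ∷ in-zs@((_ , _ , z-atomic) ∷ _)) ((y<z ∷ _) ∷ sep) =
      length zs , ℕ.≤-refl , packing zs 1≤r (<⇒≤ 0<wmin) (positive-atom z-atomic) in-zs sep
      where
      positive-atom : anchor z ≡ 0ℚ ⊎ wmin ≤ anchor z → wmin ≤ anchor z
      positive-atom (inj₂ h) = h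
      positive-atom (inj₁ z≡0) = ⊥-elim (<-irrefl (sym z≡0) (≤-<-trans (0≤* (≤-trans 0≤1 1≤r) 0≤y) y<z))

    module TreeCost {ε x q : ℚ} (0≤ε : 0ℚ ≤ ε) (log : Max1Log≤ (1ℚ + ε) x q)
             (quotient : ∀ {y} → wmin * y ≤ W → y ≤ x) where

      -- Bounds `δ` times one more than the length of a merged table of precision `δ ≤ ε`. For at
      -- most 2 + k entries, `3 * δ ≤ 3 * ε * q` and `k * δ ≤ (ε + δ) * q ≤ 2 * ε * q`.
      K : ℚ
      K = ι 5 * ε * q

      Separated-Small : ∀ {δ X S} → 0ℚ < δ → δ ≤ ε → K ^ 3 ≤ X * δ ^ 3 →
        All (InRange ∘ anchor) S → Separated (1ℚ + δ) S → Small X S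
      Separated-Small {δ} {X} {S} 0<δ δ≤ε K³≤ in-S sep
        with Separated-length {1ℚ + δ} {S} (+-mono-≤ (≤-refl {1ℚ}) (<⇒≤ 0<δ)) in-S sep
      ... | k , len , packed = small (*-cancelʳ-≤-pos (δ ^ 3) {{δ³-pos}} (begin
        s ^ 3 * δ ^ 3    ≡⟨ ^-distrib-* s δ 3 ⟨
        (s * δ) ^ 3      ≤⟨ ^-monoˡ 3 (0≤* (0≤ι (suc (length S))) 0≤δ) sδ≤K ⟩
        K ^ 3            ≤⟨ K³≤ ⟩
        X * δ ^ 3        ∎))
        where
        open ≤-Reasoning
        open Max1Log≤ log
        s = ι (suc (length S))
        0≤δ = <⇒≤ 0<δ
        instance
          δ-pos : Positive δ
          δ-pos = positive 0<δ
        δ³-pos : Positive (δ ^ 3)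
        δ³-pos = pos*pos⇒pos δ (δ * (δ * 1ℚ)) {{pos*pos⇒pos δ (δ * 1ℚ) {{pos*pos⇒pos δ 1ℚ}}}}
        kδ≤ : ι k * δ ≤ (ε + δ) * q
        kδ≤ = log-bound {ε} {δ} {x} {q} {k} 0<δ 0≤ε log (quotient packed)
        expand : ∀ ε q → ι 3 * (q * ε) + (ε + ε) * q ≡ ι 5 * ε * q
        expand = solve-∀ ℚ-ring
        sδ≤K : s * δ ≤ K
        sδ≤K = begin
          s * δ                            ≤⟨ *-monoʳ 0≤δ (ι-mono (ℕ.s≤s len)) ⟩
          ι (3 ℕ.+ k) * δ                  ≡⟨ cong (_* δ) (ι-+ 3 k) ⟩
          (ι 3 + ι k) * δ                  ≡⟨ *-distribʳ-+ δ (ι 3) (ι k) ⟩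
          ι 3 * δ + ι k * δ                ≤⟨ +-mono-≤ (*-monoˡ (0≤ι 3) (≤-trans δ≤ε (≤-scale 1≤q 0≤ε)))
                                                       (≤-trans kδ≤ (*-monoʳ (≤-trans 0≤1 1≤q) (+-monoʳ-≤ ε δ≤ε))) ⟩
          ι 3 * (q * ε) + (ε + ε) * q      ≡⟨ expand ε q ⟩
          K                                ∎

      -- The size bound is conditional on `Fits`, which a block inherits from the whole and not from
      -- its parts: two blocks may fit separately and exceed `W` together.
      Bounded : ℚ → Block → Table → Set₁
      Bounded X B S = Sound (chains B) B S × (Fits W wmin B → Small X S)

      -- A merged table is a grid of precision `δ`, so the packing bound applies to it afresh; an
      -- unpaired table keeps its bound.
      pairUp-Bounded : ∀ {δ X Bs ts} → 0ℚ < δ → δ ≤ ε → K ^ 3 ≤ X * δ ^ 3 →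
        Pointwise (Bounded X) Bs ts → Pointwise (Bounded X) (pairUp _++_ Bs) (pairUp (merge (1ℚ + δ)) ts)
      pairUp-Bounded {δ} {X} 0<δ δ≤ε K³≤ = pairUp-Pointwise id level
        where
        1≤r : 1ℚ ≤ 1ℚ + δ
        1≤r = +-mono-≤ (≤-refl {1ℚ}) (<⇒≤ 0<δ)
        level : ∀ {B C R S} → Bounded X B R → Bounded X C S → Bounded X (B ++ C) (merge (1ℚ + δ) R S)
        level {B} {C} {R} {S} (sR , _) (sS , _) =
          All.map proj₂ (Grid.payloads (merge-Sound 1≤r {A = 0ℚ ≤_} {B} {C} {R} {S} id (⨁-sounds-nonneg {B ++ C}) sR sS)) ,
          λ fits → let g = merge-Sound 1≤r {A = InRange} {B} {C} {R} {S} proj₁ (⨁-InRange {B ++ C} fits) sR sS in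
            Separated-Small 0<δ δ≤ε K³≤ (All.map proj₁ (Grid.payloads g)) (Grid.separated g)

      all-Small : ∀ {X Bs ts} → Fits W wmin (concat Bs) → Pointwise (Bounded X) Bs ts → All (Small X) ts
      all-Small {Bs = []} fits [] = []
      all-Small {X} {B ∷ Bs} {S ∷ ts} fits ((_ , s) ∷ bs) =
        s (proj₁ (Fits-++⁻ B fits)) ∷ all-Small {X} {Bs} {ts} (proj₂ (Fits-++⁻ B fits)) bs

      mergeCost-bound : ∀ {X R S V} → Small X R → Small X S → Small X V →
        ι (mergeCost (length R) (length S) (length V)) ≤ ι 100 * X
      mergeCost-bound {X} {R} {S} {V} sR sS sV = begin
        ι (mergeCost a b c)                                  ≡⟨ cong ι (mergeCost≡ a b c) ⟩
        ι (100 ℕ.* (suc a ℕ.* (suc b ℕ.* suc c)))            ≡⟨ ι-* 100 (suc a ℕ.* (suc b ℕ.* suc c)) ⟩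
        ι 100 * ι (suc a ℕ.* (suc b ℕ.* suc c))              ≡⟨ cong (ι 100 *_) (trans (ι-* (suc a) (suc b ℕ.* suc c)) (cong (ι (suc a) *_) (ι-* (suc b) (suc c)))) ⟩
        ι 100 * (ι (suc a) * (ι (suc b) * ι (suc c)))        ≤⟨ *-monoˡ (0≤ι 100) (cube-product (0≤ι (suc a)) (0≤ι (suc b)) (0≤ι (suc c)) (cube≤ sR) (cube≤ sS) (cube≤ sV)) ⟩
        ι 100 * X                                            ∎
        where
        open ≤-Reasoning
        a = length R
        b = length S
        c = length V

      -- A pair costs at most 60 + 100 X, which is at most 160 X, that is 80 X per table.
      pairUpCost-bound : ∀ {r X ts} → 1ℚ ≤ X → All (Small X) ts → All (Small X) (pairUp (merge r) ts) →
        ι (pairUpCost r ts) ≤ ι 80 * (ι (length ts) * X)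
      pairUpCost-bound {X = X} {[]}    1≤X _ _ = 0≤* (0≤ι 80) (0≤* (0≤ι 0) (≤-trans 0≤1 1≤X))
      pairUpCost-bound {X = X} {_ ∷ []} 1≤X _ _ = 0≤* (0≤ι 80) (0≤* (0≤ι 1) (≤-trans 0≤1 1≤X))
      pairUpCost-bound {r} {X} {R ∷ S ∷ ts} 1≤X (sR ∷ sS ∷ sts) (sV ∷ svs) = begin
        ι (60 ℕ.+ (c ℕ.+ pairUpCost r ts))                      ≡⟨ trans (ι-+ 60 (c ℕ.+ pairUpCost r ts)) (cong (ι 60 +_) (ι-+ c (pairUpCost r ts))) ⟩
        ι 60 + (ι c + ι (pairUpCost r ts))                      ≤⟨ +-mono-≤ 60≤60X (+-mono-≤ (mergeCost-bound {R = R} {S} sR sS sV) (pairUpCost-bound {r} {ts = ts} 1≤X sts svs)) ⟩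
        ι 60 * X + (ι 100 * X + ι 80 * (ι (length ts) * X))     ≡⟨ collect X (ι (length ts)) ⟩
        ι 80 * ((ι 2 + ι (length ts)) * X)                      ≡⟨ cong (λ k → ι 80 * (k * X)) (ι-+ 2 (length ts)) ⟨
        ι 80 * (ι (2 ℕ.+ length ts) * X)                        ∎
        where
        open ≤-Reasoning
        c = mergeCost (length R) (length S) (length (merge r R S))
        60≤60X : ι 60 ≤ ι 60 * X
        60≤60X = ≤-trans (≤-reflexive (sym (*-identityʳ (ι 60)))) (*-monoˡ (0≤ι 60) 1≤X)
        collect : ∀ X n → ι 60 * X + (ι 100 * X + ι 80 * (n * X)) ≡ ι 80 * ((ι 2 + n) * X)
        collect = solve-∀ ℚ-ring

      -- `X` bounds the cubed sizes at the present level and `Y` that of the result. The number of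
      -- tables times `X` never increases, so it is still at most `Y` when one table is left. For
      -- the empty list that product vanishes, hence the separate hypothesis `X ≤ Y`.
      tree-cost : ∀ k {δ X Y Bs ts} → 0ℚ < δ → δ ≤ ε → ι 8 ≤ X → K ^ 3 ≤ X * δ ^ 3 →
        Fits W wmin (concat Bs) → Pointwise (Bounded X) Bs ts → X ≤ Y → ι (length ts) * X ≤ Y →
        ι (treeCost k δ ts) ≤ ι 87 * (ι 15 * (ι (length ts) * X)) × Small Y (tree k δ ts)

      tree-level : ∀ k {δ X Y B C Bs R S us} → 0ℚ < δ → δ ≤ ε → ι 8 ≤ X → K ^ 3 ≤ X * δ ^ 3 →
        Fits W wmin (concat (B ∷ C ∷ Bs)) → Pointwise (Bounded X) (B ∷ C ∷ Bs) (R ∷ S ∷ us) →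
        ι (length (R ∷ S ∷ us)) * X ≤ Y →
        ι (treeCost (suc k) δ (R ∷ S ∷ us)) ≤ ι 87 * (ι 15 * (ι (length (R ∷ S ∷ us)) * X)) ×
        Small Y (tree (suc k) δ (R ∷ S ∷ us))
      tree-level k {δ} {X} {Y} {B} {C} {Bs₀} {R} {S} {us} 0<δ δ≤ε 8≤X K³≤ fits bs NX≤Y = total , proj₂ rec-bound
        where
        r : ℚ
        r = 1ℚ + δ
        Bs : List Block
        Bs = B ∷ C ∷ Bs₀
        ts ts′ : List Table
        ts = R ∷ S ∷ us
        ts′ = pairUp (merge r) ts
        y : ℚ
        y  = ι (length ts) * X
        0≤X : 0ℚ ≤ X
        0≤X = ≤-trans (0≤ι 8) 8≤X
        0≤y : 0ℚ ≤ y
        0≤y = 0≤* (0≤ι (length ts)) 0≤X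
        bs′ : Pointwise (Bounded X) (pairUp _++_ Bs) ts′
        bs′ = pairUp-Bounded {δ} {X} {Bs} {ts} 0<δ δ≤ε K³≤ bs
        fits′ : Fits W wmin (concat (pairUp _++_ Bs))
        fits′ = subst (Fits W wmin) (sym (concat-pairUp Bs)) fits
        N′X′≤ : ι (length ts′) * (growth * X) ≤ shrink * y
        N′X′≤ = volume-step {length ts′} {length ts} {X} 0≤X (length-pairUp-2+ (merge r) R S us)
        N′X′≤Y : ι (length ts′) * (growth * X) ≤ Y
        N′X′≤Y = ≤-trans N′X′≤ (≤-trans (*-monoʳ 0≤y (≤ᵇ⇒≤ {shrink} {1ℚ} _)) (≤-trans (≤-reflexive (*-identityˡ y)) NX≤Y))
        X′≤Y : growth * X ≤ Y
        X′≤Y = ≤-trans (≤-scale {ι (length ts′)} {growth * X} (ι-mono {1} {length ts′} (ℕ.s≤s ℕ.z≤n)) (≤-trans 0≤X (≤-growth 0≤X))) N′X′≤Y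
        grow : ∀ {B S} → Bounded X B S → Bounded (growth * X) B S
        grow (s , f) = s , λ fit → Small-mono (≤-growth 0≤X) (f fit)
        rec-bound : ι (treeCost k (decay * δ) ts′) ≤ ι 87 * (ι 15 * (ι (length ts′) * (growth * X))) × Small Y (tree k (decay * δ) ts′)
        rec-bound = tree-cost k {decay * δ} {growth * X} {Y} {pairUp _++_ Bs} {ts′}
          (positive⁻¹ (decay * δ) {{pos*pos⇒pos decay δ {{positive 0<δ}}}}) (≤-trans (decay-≤ (<⇒≤ 0<δ)) δ≤ε)
          (≤-trans 8≤X (≤-growth 0≤X)) (precision-step {K ^ 3} {X} {δ} 0≤X (<⇒≤ 0<δ) K³≤) fits′
          (Pointwise.map grow bs′) X′≤Y N′X′≤Y
        16≤y : ι 2 * ι 8 ≤ y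
        16≤y = *-mono {ι 2} {ι (length ts)} {ι 8} {X} (0≤ι 2) 0≤X (ι-mono {2} {length ts} (ℕ.s≤s (ℕ.s≤s ℕ.z≤n))) 8≤X
        p t : ℕ
        p = pairUpCost r ts
        t = treeCost k (decay * δ) ts′
        p≤ : ι p ≤ ι 80 * y
        p≤ = pairUpCost-bound {r} {X} {ts} (≤-trans (≤ᵇ⇒≤ {1ℚ} {ι 8} _) 8≤X) (all-Small {X} {Bs} {ts} fits bs) (all-Small {X} {pairUp _++_ Bs} {ts′} fits′ bs′)
        total : ι (100 ℕ.+ (p ℕ.+ t)) ≤ ι 87 * (ι 15 * y)
        total = ≤-trans (≤-reflexive (trans (ι-+ 100 (p ℕ.+ t)) (cong (ι 100 +_) (ι-+ p t))))
          (cost-step {ι p} {ι t} {y} {ι (length ts′) * (growth * X)} 16≤y p≤ (proj₁ rec-bound) N′X′≤)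

      0≤cost : ∀ {X} k → ι 8 ≤ X → 0ℚ ≤ ι 87 * (ι 15 * (ι k * X))
      0≤cost k 8≤X = 0≤* (0≤ι 87) (0≤* (0≤ι 15) (0≤* (0≤ι k) (≤-trans (0≤ι 8) 8≤X)))

      -- The default table has one entry, and the cube of 1 + 1 is the 8 below `X`.
      tree-cost zero    {ts = ts} _ _ 8≤X _ _ _ X≤Y _     = 0≤cost (length ts) 8≤X , small (≤-trans 8≤X X≤Y)
      tree-cost (suc k) _ _ 8≤X _ _ [] X≤Y _              = 0≤cost 0 8≤X , small (≤-trans 8≤X X≤Y)
      tree-cost (suc k) {X = X} {Bs = Bs@(_ ∷ [])} {ts@(S ∷ [])} _ _ 8≤X _ fits bs X≤Y _  =
        0≤cost 1 8≤X , Small-mono X≤Y (All.head (all-Small {X} {Bs} {ts} fits bs))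
      tree-cost (suc k) {δ} {X} {Y} {B ∷ C ∷ Bs} {R ∷ S ∷ us} 0<δ δ≤ε 8≤X K³≤ fits bs _ NX≤Y =
        tree-level k {δ} {X} {Y} {B} {C} {Bs} {R} {S} {us} 0<δ δ≤ε 8≤X K³≤ fits bs NX≤Y

-- Selections of items as sums of independent choices

module Selections (I : Instance) where
  open Instance I using (Item; sumOver)
  open Operational Item
  open Tables Item

  sum-nonneg : ∀ {k} (f : Fin k → ℚ) → (∀ j → 0ℚ ≤ f j) → 0ℚ ≤ sum f
  sum-nonneg {zero}  f 0≤f = ≤-refl
  sum-nonneg {suc k} f 0≤f = 0≤+ (0≤f zero) (sum-nonneg (f ∘ suc) (0≤f ∘ suc))

  sumOver-nonneg : ∀ {k} (s : Subset k) {f} → (∀ j → 0ℚ ≤ f j) → 0ℚ ≤ sumOver s f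
  sumOver-nonneg Vec.[] 0≤f = ≤-refl
  sumOver-nonneg (true Vec.∷ s)  0≤f = 0≤+ (0≤f zero) (sumOver-nonneg s (0≤f ∘ suc))
  sumOver-nonneg (false Vec.∷ s) 0≤f = 0≤+ ≤-refl (sumOver-nonneg s (0≤f ∘ suc))

  sumOver≤sum : ∀ {k} (s : Subset k) {f} → (∀ j → 0ℚ ≤ f j) → sumOver s f ≤ sum f
  sumOver≤sum Vec.[] 0≤f = ≤-refl
  sumOver≤sum (true Vec.∷ s)  {f} 0≤f = +-mono-≤ (≤-refl {f zero}) (sumOver≤sum s (0≤f ∘ suc))
  sumOver≤sum (false Vec.∷ s) 0≤f = +-mono-≤ (0≤f zero) (sumOver≤sum s (0≤f ∘ suc))

  sumOver-atomic : ∀ {k c} (s : Subset k) {f} → (∀ j → 0ℚ ≤ f j) → (∀ j → 0ℚ < f j → c ≤ f j) →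
                   sumOver s f ≡ 0ℚ ⊎ c ≤ sumOver s f
  sumOver-atomic Vec.[] 0≤f at = inj₁ refl
  sumOver-atomic (false Vec.∷ s) {f} 0≤f at with sumOver-atomic s (0≤f ∘ suc) (at ∘ suc)
  ... | inj₁ s≡0 = inj₁ (trans (+-identityˡ _) s≡0)
  ... | inj₂ c≤s = inj₂ (≤-trans c≤s (≤-reflexive (sym (+-identityˡ _))))
  sumOver-atomic (true Vec.∷ s) {f} 0≤f at with <-cmp 0ℚ (f zero) | sumOver-atomic s (0≤f ∘ suc) (at ∘ suc)
  ... | tri< 0<f _ _ | _        = inj₂ (≤-trans (at zero 0<f) (≤-trans (≤-reflexive (sym (+-identityʳ _)))
                                    (+-monoʳ-≤ (f zero) (sumOver-nonneg s (0≤f ∘ suc)))))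
  ... | tri> _ _ f<0 | _        = ⊥-elim (<-irrefl refl (<-≤-trans f<0 (0≤f zero)))
  ... | tri≈ _ 0≡f _ | inj₁ s≡0 = inj₁ (cong₂ _+_ (sym 0≡f) s≡0)
  ... | tri≈ _ 0≡f _ | inj₂ c≤s = inj₂ (≤-trans c≤s (≤-reflexive (trans (sym (+-identityˡ _)) (cong (_+ sumOver s (f ∘ suc)) 0≡f))))

  members : ∀ {k} → (Fin k → Item) → Subset k → List Item
  members name Vec.[]            = []
  members name (true Vec.∷ s)  = name zero ∷ members (name ∘ suc) s
  members name (false Vec.∷ s) = members (name ∘ suc) s

  members⁺ : ∀ {k} (name : Fin k → Item) s {j} → Vec.lookup s j ≡ true → name j ∈ members name s
  members⁺ name (true Vec.∷ s)  {zero}  eq = here refl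
  members⁺ name (true Vec.∷ s)  {suc j} eq = there (members⁺ (name ∘ suc) s eq)
  members⁺ name (false Vec.∷ s) {suc j} eq = members⁺ (name ∘ suc) s eq

  members⁻ : ∀ {k} (name : Fin k → Item) s {x} → x ∈ members name s → ∃ λ j → x ≡ name j × Vec.lookup s j ≡ true
  members⁻ name (true Vec.∷ s) (here eq) = zero , eq , refl
  members⁻ name (true Vec.∷ s) (there x∈) with members⁻ (name ∘ suc) s x∈
  ... | j , eq , sj = suc j , eq , sj
  members⁻ name (false Vec.∷ s) x∈ with members⁻ (name ∘ suc) s x∈
  ... | j , eq , sj = suc j , eq , sj

  selection : ∀ {k} → (Fin k → Item) → (f g : Fin k → ℚ) → Subset k → Triple
  selection name f g s = members name s , sumOver s f , sumOver s g

  Chosen : Item → ℚ → ℚ → Triple → Set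
  Chosen i p q x = x ≡ ∅ ⊎ x ≡ (i ∷ [] , p , q)

  -- With its converse below, identifies the Minkowski sum of take-or-leave choices with the subsets
  -- of a category.
  ⨁-Chosen⁻ : ∀ {k} {name : Fin k → Item} {f g x} →
    ⨁ (tabulate λ j → Chosen (name j) (f j) (g j)) x → ∃ λ s → x ≡ selection name f g s
  ⨁-Chosen⁻ {zero} [] = Vec.[] , refl
  ⨁-Chosen⁻ {suc k} (c ∷ cs) with ⨁-Chosen⁻ {k} cs
  ⨁-Chosen⁻ {suc k} (inj₁ refl ∷ cs) | s , refl = false Vec.∷ s , refl
  ⨁-Chosen⁻ {suc k} (inj₂ refl ∷ cs) | s , refl = true Vec.∷ s , refl

  ⨁-Chosen⁺ : ∀ {k} {name : Fin k → Item} {f g} s →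
    ⨁ (tabulate λ j → Chosen (name j) (f j) (g j)) (selection name f g s)
  ⨁-Chosen⁺ Vec.[] = []
  ⨁-Chosen⁺ (true Vec.∷ s)  = inj₂ refl ∷ ⨁-Chosen⁺ s
  ⨁-Chosen⁺ (false Vec.∷ s) = inj₁ refl ∷ ⨁-Chosen⁺ s

  Picked : ∀ {k} → (Subset k → Triple) → (Subset k → Set) → Triple → Set
  Picked f P x = ∃ λ s → x ≡ f s × P s

  gather : ∀ {k} {size : Fin k → ℕ} → (∀ i → Subset (size i) → Triple) → (∀ i → Subset (size i)) → Triple
  gather f S = concat (tabulate λ i → proj₁ (f i (S i))) , sum (λ i → wgt (f i (S i))) , sum (λ i → gain (f i (S i)))

  ⨁-Picked⁻ : ∀ {k} {size : Fin k → ℕ} {f : ∀ i → Subset (size i) → Triple} {P : ∀ i → Subset (size i) → Set} {x} →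
    ⨁ (tabulate λ i → Picked (f i) (P i)) x → ∃ λ S → x ≡ gather f S × (∀ i → P i (S i))
  ⨁-Picked⁻ {zero} [] = (λ ()) , refl , λ ()
  ⨁-Picked⁻ {suc k} {size} {f} {P} ((s , refl , p) ∷ ps) with ⨁-Picked⁻ {k} ps
  ... | S , refl , h = S′ , refl , h′
    where
    S′ : ∀ i → Subset (size i)
    S′ zero    = s
    S′ (suc i) = S i
    h′ : ∀ i → P i (S′ i)
    h′ zero    = p
    h′ (suc i) = h i

  ⨁-Picked⁺ : ∀ {k} {size : Fin k → ℕ} {f : ∀ i → Subset (size i) → Triple} {P : ∀ i → Subset (size i) → Set} S →
    (∀ i → P i (S i)) → ⨁ (tabulate λ i → Picked (f i) (P i)) (gather f S)
  ⨁-Picked⁺ {zero}  S h = []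
  ⨁-Picked⁺ {suc k} S h = (S zero , refl , h zero) ∷ ⨁-Picked⁺ (S ∘ suc) (h ∘ suc)

-- Correctness on an instance

module Algorithm (I : Instance) where
  open Instance I hiding (sumOver) renaming (L to bound; W to totalWeight; value to totalValue; weight to weightOf)
  open Instance I using (sumOver)
  open Operational Item
  open Tables Item
  open Selections I

  ⊕-identityʳ : ∀ x → x ⊕ ∅ ≡ x
  ⊕-identityʳ (is , p , q) = cong₂ _,_ (List.++-identityʳ is) (cong₂ _,_ (+-identityʳ p) (+-identityʳ q))

  module Items (i : Fin m) where

    itemRecord : Fin (size i) → Item × ℚ × ℚ
    itemRecord j = (i , j) , w i j , v i j

    itemLeaf : Fin (size i) → Leaf
    itemLeaf j = record
      { sound         = Chosen (i , j) (w i j) (v i j)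
      ; target        = Chosen (i , j) (w i j) (v i j)
      ; load          = w i j
      -- The reserve of 5 units for a composition, and 4 for evaluating the `cons` in the closure of
      -- the leaf.
      ; chain         = 9
      ; 0≤load        = w≥0 i j
      ; sound-nonneg  = nonneg
      ; sound-bounded = λ { (inj₁ refl) → w≥0 i j ; (inj₂ refl) → ≤-refl }
      ; target-nonneg = nonneg
      }
      where
      nonneg : ∀ {x} → Chosen (i , j) (w i j) (v i j) x → 0ℚ ≤ wgt x
      nonneg (inj₁ refl) = ≤-refl
      nonneg (inj₂ refl) = w≥0 i j

    leaf-Sound : ∀ j → Sound (chains (itemLeaf j ∷ [])) (itemLeaf j ∷ []) (leaf (itemRecord j))
    leaf-Sound j =
      (∅ ⊕ ∅ , inj₁ refl ∷ [] , record
        { weighs = refl ; gains = refl ; pushes = λ _ → refl ; cheap = λ _ → ℕ.≤ᵇ⇒≤ 6 9 _ }) ∷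
      (((i , j) ∷ [] , w i j , v i j) ⊕ ∅ , inj₂ refl ∷ [] , record
        { weighs = sym (+-identityʳ _) ; gains = sym (+-identityʳ _) ; pushes = λ _ → refl ; cheap = λ _ → ℕ.≤-refl }) ∷ []

    leaf-Covers : ∀ j → Covers 1ℚ (itemLeaf j ∷ []) (leaf (itemRecord j))
    leaf-Covers j (inj₁ refl ∷ []) = _ , here refl , ≤-refl , ≤-refl , ≤-refl
    leaf-Covers j (inj₂ refl ∷ []) = _ , there (here refl) ,
      ≤-reflexive (sym (trans (*-identityˡ (w i j + 0ℚ)) (+-identityʳ (w i j)))) ,
      ≤-reflexive (trans (+-identityʳ (w i j)) (sym (*-identityˡ (w i j)))) , ≤-reflexive (+-identityʳ (v i j))

    block : Block
    block = tabulate itemLeaf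

    blocks : List Block
    blocks = map (_∷ []) block

    items : List (Item × ℚ × ℚ)
    items = tabulate itemRecord

    leaves-Pointwise : ∀ {R : Block → Table → Set₁} → (∀ j → R (itemLeaf j ∷ []) (leaf (itemRecord j))) →
                       Pointwise R blocks (map leaf items)
    leaves-Pointwise h = Pointwise.map⁺ (_∷ []) leaf (Pointwise.tabulate⁺ h)

    sounds-block : sounds block ≡ tabulate (λ j → Chosen (i , j) (w i j) (v i j))
    sounds-block = List.map-tabulate itemLeaf sound

    targets-block : targets block ≡ tabulate (λ j → Chosen (i , j) (w i j) (v i j))
    targets-block = List.map-tabulate itemLeaf target

    concat-blocks : concat blocks ≡ block
    concat-blocks = List.concat-map-[ block ]

    chains-block : chains block ≡ 9 ℕ.* size i
    chains-block = go itemLeaf (λ _ → refl)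
      where
      go : ∀ {k} (f : Fin k → Leaf) → (∀ j → chain (f j) ≡ 9) → chains (tabulate f) ≡ 9 ℕ.* k
      go {zero}  f h = refl
      go {suc k} f h = trans (cong₂ ℕ._+_ (h zero) (go (f ∘ suc) (h ∘ suc))) (sym (ℕ.*-suc 9 k))

    chosen : Subset (size i) → Triple
    chosen = selection (i ,_) (w i) (v i)

  open Items public using (chosen)

  restrict⁻ : ∀ {lo hi e} S → e ∈ restrict lo hi S → e ∈ S × lo ≤ wt e × wt e ≤ hi
  restrict⁻ {lo} {hi} (x ∷ xs) e∈ with ≤ᵇ-cases lo (wt x)
  restrict⁻ {lo} {hi} (x ∷ xs) e∈ | inj₂ (_ , eq) rewrite eq with restrict⁻ xs e∈
  ... | e∈xs , h = there e∈xs , h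
  restrict⁻ {lo} {hi} (x ∷ xs) e∈ | inj₁ (lo≤ , eq) rewrite eq with ≤ᵇ-cases (wt x) hi
  restrict⁻ (x ∷ xs) e∈         | inj₁ (lo≤ , _) | inj₂ (_ , eq) rewrite eq with restrict⁻ xs e∈
  ... | e∈xs , h = there e∈xs , h
  restrict⁻ (x ∷ xs) e∈         | inj₁ (lo≤ , _) | inj₁ (≤hi , eq) rewrite eq with e∈
  ... | here refl = here refl , lo≤ , ≤hi
  ... | there e∈′ with restrict⁻ xs e∈′
  ...   | e∈xs , h = there e∈xs , h

  restrict⁺ : ∀ {lo hi e S} → e ∈ S → lo ≤ wt e → wt e ≤ hi → e ∈ restrict lo hi S
  restrict⁺ {lo} {hi} {S = x ∷ xs} e∈ lo≤ ≤hi with ≤ᵇ-cases lo (wt x)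
  restrict⁺ (here refl) lo≤ ≤hi | inj₂ (<lo , _) = ⊥-elim (<-irrefl refl (<-≤-trans <lo lo≤))
  restrict⁺ (there e∈) lo≤ ≤hi  | inj₂ (_ , eq) rewrite eq = restrict⁺ e∈ lo≤ ≤hi
  restrict⁺ {lo} {hi} {S = x ∷ xs} e∈ lo≤ ≤hi | inj₁ (_ , eq) rewrite eq with ≤ᵇ-cases (wt x) hi
  restrict⁺ (here refl) lo≤ ≤hi | inj₁ _ | inj₂ (hi< , _) = ⊥-elim (<-irrefl refl (<-≤-trans hi< ≤hi))
  restrict⁺ (there e∈) lo≤ ≤hi  | inj₁ _ | inj₂ (_ , eq) rewrite eq = restrict⁺ e∈ lo≤ ≤hi
  restrict⁺ (here refl) lo≤ ≤hi | inj₁ _ | inj₁ (_ , eq) rewrite eq = here refl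
  restrict⁺ (there e∈) lo≤ ≤hi  | inj₁ _ | inj₁ (_ , eq) rewrite eq = there (restrict⁺ e∈ lo≤ ≤hi)

  module Categories (ε : ℚ) (0≤ε : 0ℚ ≤ ε) where

    Within Nearly : ∀ i → Subset (size i) → Set
    Within i s = l i ≤ sumOver s (w i) × sumOver s (w i) ≤ u i
    Nearly i s = (1ℚ - ε) * l i ≤ sumOver s (w i) × sumOver s (w i) ≤ (1ℚ + ε) * u i

    -- The interval constraint enters here: the target is the exact interval, whereas soundness
    -- grants the relaxed one that the filter enforces. The value of `chain` is the bound that the
    -- tree over the items leaves on its entries.
    categoryLeaf : Fin m → Leaf
    categoryLeaf i = record
      { sound         = Picked (chosen i) (Nearly i)
      ; target        = Picked (chosen i) (Within i)
      ; load          = sum (w i)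
      ; chain         = 6 ℕ.+ 9 ℕ.* size i
      ; 0≤load        = sum-nonneg (w i) (w≥0 i)
      ; sound-nonneg  = λ { (s , refl , _) → sumOver-nonneg s (w≥0 i) }
      ; sound-bounded = λ { (s , refl , _) → sumOver≤sum s (w≥0 i) }
      ; target-nonneg = λ { (s , refl , _) → sumOver-nonneg s (w≥0 i) }
      }

    module _ (δ : ℚ) where

      categoryRecord : Fin m → ℚ × ℚ × List (Item × ℚ × ℚ)
      categoryRecord i = l i , u i , Items.items i

      itemTree-Sound : ∀ i → Sound (6 ℕ.+ 9 ℕ.* size i) (Items.block i) (itemTree ε δ (Items.items i)) →
        Sound (chains (categoryLeaf i ∷ [])) (categoryLeaf i ∷ []) (category ε δ (categoryRecord i))
      itemTree-Sound i s = All.tabulate λ {e} e∈ → lift {e} (restrict⁻ (itemTree ε δ (Items.items i)) e∈)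
        where
        lift : ∀ {e} → e ∈ itemTree ε δ (Items.items i) × (1ℚ - ε) * l i ≤ wt e × wt e ≤ (1ℚ + ε) * u i →
               SoundPayload (chains (categoryLeaf i ∷ [])) (categoryLeaf i ∷ []) (proj₂ e)
        lift {e} (e∈ , lo , hi) with All.lookup s e∈
        ... | x , sx , ρ with ⨁-Chosen⁻ (subst (λ Ps → ⨁ Ps x) (Items.sounds-block i) sx)
        ...   | c , refl = chosen i c ⊕ ∅ ,
          (c , refl , subst ((1ℚ - ε) * l i ≤_) (Realizes.weighs ρ) lo , subst (_≤ (1ℚ + ε) * u i) (Realizes.weighs ρ) hi) ∷ [] ,
          subst (λ x → Realizes (chains (categoryLeaf i ∷ [])) x (proj₂ e)) (sym (⊕-identityʳ (chosen i c)))
            (Realizes-mono (ℕ.m≤m+n _ 0) ρ)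

      -- The filter keeps the entry `e` near a feasible selection. Its weight is at most `F * u i`,
      -- and `F * wt e` is at least `l i`; since `F ≤ 1 + ε` and `(1 + ε) * (1 - ε) ≤ 1`, both
      -- relaxed bounds hold.
      category-Covers : ∀ i {F} → 1ℚ ≤ F → F ≤ 1ℚ + ε → Covers F (Items.block i) (itemTree ε δ (Items.items i)) →
        Covers F (categoryLeaf i ∷ []) (category ε δ (categoryRecord i))
      category-Covers i {F} 1≤F F≤ c ((s , refl , lo , hi) ∷ []) =
        subst Found (sym (⊕-identityʳ x)) (found (c (subst (λ Ps → ⨁ Ps x) (sym (Items.targets-block i)) (⨁-Chosen⁺ s))))
        where
        x : Triple
        x = chosen i s
        Found : Triple → Set
        Found z = ∃ λ e → e ∈ category ε δ (categoryRecord i) × Near F e z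
        open ≤-Reasoning
        0<F : 0ℚ < F
        0<F = <-≤-trans 0<1 1≤F
        found : (∃ λ e → e ∈ itemTree ε δ (Items.items i) × Near F e x) → Found x
        found (e , e∈ , a , b , g) = e , restrict⁺ e∈ lower upper , a , b , g
          where
          upper : wt e ≤ (1ℚ + ε) * u i
          upper = begin
            wt e                           ≤⟨ a ⟩
            F * sumOver s (w i)            ≤⟨ *-mono (<⇒≤ 0<F) (≤-trans (l≥0 i) (l≤u i)) F≤ hi ⟩
            (1ℚ + ε) * u i                 ∎
          lower : (1ℚ - ε) * l i ≤ wt e
          lower with ≤-total 0ℚ (1ℚ - ε)
          ... | inj₁ 0≤1-ε = cancel-≤ 0<F (begin
            F * ((1ℚ - ε) * l i)           ≤⟨ *-monoʳ (0≤* 0≤1-ε (l≥0 i)) F≤ ⟩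
            (1ℚ + ε) * ((1ℚ - ε) * l i)    ≡⟨ difference ε (l i) ⟩
            l i - ε * (ε * l i)            ≤⟨ +-monoʳ-≤ (l i) (neg-antimono-≤ (0≤* 0≤ε (0≤* 0≤ε (l≥0 i)))) ⟩
            l i - 0ℚ                       ≡⟨ +-identityʳ (l i) ⟩
            l i                            ≤⟨ lo ⟩
            sumOver s (w i)                ≤⟨ b ⟩
            F * wt e                       ∎)
            where
            difference : ∀ ε x → (1ℚ + ε) * ((1ℚ - ε) * x) ≡ x - ε * (ε * x)
            difference = solve-∀ ℚ-ring
          -- For `ε` at least 1 the relaxed lower bound is at most zero, so nonnegativity of the
          -- weight suffices.
          ... | inj₂ 1-ε≤0 = begin
            (1ℚ - ε) * l i                 ≤⟨ *-monoʳ (l≥0 i) 1-ε≤0 ⟩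
            0ℚ * l i                       ≡⟨ *-zeroˡ (l i) ⟩
            0ℚ                             ≤⟨ 0≤wt ⟩
            wt e                           ∎
            where
            0≤wt : 0ℚ ≤ wt e
            0≤wt = cancel-≤ 0<F (≤-trans (≤-reflexive (*-zeroʳ F)) (≤-trans (sumOver-nonneg s (w≥0 i)) b))

  -- The start entry counts as a candidate too; each step then hands the better of two candidates to
  -- the induction.
  select-spec : ∀ L z S → let r = select L z S in
    (r ≡ z ⊎ r ∈ S) × (∀ {x} → x ≡ z ⊎ x ∈ S → L ≤ val x → L ≤ val r × wt r ≤ wt x)
  select-spec L z [] = inj₁ refl , λ { (inj₁ refl) L≤ → L≤ , ≤-refl }
  select-spec L z (x ∷ xs) with ≤ᵇ-cases L (val x)
  ... | inj₂ (<L , eq) rewrite eq with select-spec L z xs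
  ...   | origin , best =
    Sum.map id there origin , λ
      { (inj₁ refl) L≤         → best (inj₁ refl) L≤
      ; (inj₂ (here refl)) L≤  → ⊥-elim (<-irrefl refl (<-≤-trans <L L≤))
      ; (inj₂ (there y∈)) L≤   → best (inj₂ y∈) L≤ }
  select-spec L z (x ∷ xs) | inj₁ (L≤x , eq) rewrite eq with ≤ᵇ-cases L (val z)
  ... | inj₂ (<L , eq′) rewrite eq′ with select-spec L x xs
  ...   | origin , best =
    inj₂ (Sum.[ here , there ]′ origin) , λ
      { (inj₁ refl) L≤         → ⊥-elim (<-irrefl refl (<-≤-trans <L L≤))
      ; (inj₂ (here refl)) L≤  → best (inj₁ refl) L≤
      ; (inj₂ (there y∈)) L≤   → best (inj₂ y∈) L≤ }
  select-spec L z (x ∷ xs) | inj₁ (L≤x , eq) | inj₁ (L≤z , eq′) rewrite eq′ with ≤ᵇ-cases (wt x) (wt z)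
  ... | inj₁ (x≤z , eq″) rewrite eq″ with select-spec L x xs
  ...   | origin , best =
    inj₂ (Sum.[ here , there ]′ origin) , λ
      { (inj₁ refl) _          → proj₁ (best (inj₁ refl) L≤x) , ≤-trans (proj₂ (best (inj₁ refl) L≤x)) x≤z
      ; (inj₂ (here refl)) L≤  → best (inj₁ refl) L≤
      ; (inj₂ (there y∈)) L≤   → best (inj₂ y∈) L≤ }
  select-spec L z (x ∷ xs) | inj₁ (L≤x , eq) | inj₁ (L≤z , eq′) | inj₂ (z<x , eq″) rewrite eq″ with select-spec L z xs
  ...   | origin , best =
    Sum.map id there origin , λ
      { (inj₁ refl) L≤         → best (inj₁ refl) L≤
      ; (inj₂ (here refl)) _   → proj₁ (best (inj₁ refl) L≤z) , ≤-trans (proj₂ (best (inj₁ refl) L≤z)) (<⇒≤ z<x)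
      ; (inj₂ (there y∈)) L≤   → best (inj₂ y∈) L≤ }

  module Correctness {ε δ : ℚ} (0≤δ : 0ℚ ≤ δ) (δ≤ε : ι 120 * δ ≤ ε) (δ≤1 : ι 120 * δ ≤ 1ℚ) where

    0≤ε : 0ℚ ≤ ε
    0≤ε = ≤-trans (0≤* (0≤ι 120) 0≤δ) δ≤ε

    open Categories ε 0≤ε

    η : ℚ
    η = ι 60 * δ

    η≤120δ : η ≤ ι 120 * δ
    η≤120δ = *-monoʳ 0≤δ (≤ᵇ⇒≤ {ι 60} {ι 120} _)

    0≤η : 0ℚ ≤ η
    0≤η = 0≤* (0≤ι 60) 0≤δ

    itemTree-models : ∀ i → Sound (6 ℕ.+ 9 ℕ.* size i) (Items.block i) (itemTree ε δ (Items.items i)) ×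
                            Covers (1ℚ + η) (Items.block i) (itemTree ε δ (Items.items i))
    itemTree-models i =
      subst (λ κ → Sound (6 ℕ.+ κ) block S) chains-block (proj₁ models′) , proj₂ models′
      where
      open Items i
      S : Table
      S = itemTree ε δ items
      leaf-Models : ∀ j → Models (errorFactor η δ) (itemLeaf j ∷ []) (leaf (itemRecord j))
      leaf-Models j = models (leaf-Sound j)
        (Covers-mono {B = itemLeaf j ∷ []} (1≤errorFactor {η} {δ} ≤-refl) (leaf-Sound j) (leaf-Covers j))
      models′ : Sound (6 ℕ.+ chains block) block S × Covers (1ℚ + η) block S
      models′ = subst (λ B → Sound (6 ℕ.+ chains B) B S × Covers (1ℚ + η) B S) concat-blocks
        (tree-Models {η} (length (map leaf items)) {δ} {blocks} {map leaf items} ℕ.≤-refl 0≤δ ≤-refl (≤-trans η≤120δ δ≤1)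
          (leaves-Pointwise leaf-Models))

    -- The second tree has the budget `120 * δ` and starts with `60 * δ` of it spent, which is what
    -- the first tree has used. Its initial factor `1 + (120 * δ - 60 * δ)` is thus the final factor
    -- of the first.
    category-Models : ∀ i → Models (errorFactor (ι 120 * δ) δ) (categoryLeaf i ∷ []) (category ε δ (categoryRecord δ i))
    category-Models i = models (itemTree-Sound δ i (proj₁ (itemTree-models i)))
      (subst (λ F → Covers F (categoryLeaf i ∷ []) (category ε δ (categoryRecord δ i))) (start δ)
        (category-Covers δ i (≤-trans (≤-reflexive (sym (+-identityʳ 1ℚ))) (+-monoʳ-≤ 1ℚ 0≤η))
          (+-monoʳ-≤ 1ℚ (≤-trans η≤120δ δ≤ε)) (proj₂ (itemTree-models i))))
      where
      start : ∀ δ → 1ℚ + ι 60 * δ ≡ 1ℚ + (ι 120 * δ - ι 60 * δ)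
      start = solve-∀ ℚ-ring

    block : Block
    block = tabulate categoryLeaf

    records : List (ℚ × ℚ × List (Item × ℚ × ℚ))
    records = tabulate (categoryRecord δ)

    final : Table
    final = finalTable ε δ records

    final-models : Sound (6 ℕ.+ chains block) block final × Covers (1ℚ + ι 120 * δ) block final
    final-models = subst (λ B → Sound (6 ℕ.+ chains B) B final × Covers (1ℚ + ι 120 * δ) B final) List.concat-map-[ block ]
      (tree-Models {ι 120 * δ} (length (categoryTables ε δ records)) {δ} {map (_∷ []) block} {categoryTables ε δ records}
        ℕ.≤-refl 0≤δ η≤120δ δ≤1
        (Pointwise.map⁺ (_∷ []) (category ε δ) (Pointwise.tabulate⁺ category-Models)))

    chosen-entry : Entry
    chosen-entry = best ε δ (bound , records)

    covered : ∀ O → Feasible O → ∃ λ e → e ∈ final × Near (1ℚ + ι 120 * δ) e (gather chosen O)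
    covered O feasible = proj₂ final-models (subst (λ Ps → ⨁ Ps (gather chosen O)) (sym (List.map-tabulate categoryLeaf target))
      (⨁-Picked⁺ O λ i → lower i , upper i))
      where open Feasible feasible

    module _ (feasible : ∃ Feasible) where

      chosen-spec : ∀ O → Feasible O → chosen-entry ∈ final × bound ≤ val chosen-entry ×
                    wt chosen-entry ≤ (1ℚ + ε) * weightOf O
      chosen-spec O f = from (proj₁ spec) , valuable , ≤-trans (proj₂ optimal) (≤-trans near
        (*-monoʳ (sum-nonneg (categoryWeight O) λ i → sumOver-nonneg (O i) (w≥0 i)) (+-monoʳ-≤ 1ℚ δ≤ε)))
        where
        spec : (chosen-entry ≡ failure ε δ bound ⊎ chosen-entry ∈ final) ×
               (∀ {x} → x ≡ failure ε δ bound ⊎ x ∈ final → bound ≤ val x → bound ≤ val chosen-entry × wt chosen-entry ≤ wt x)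
        spec = select-spec bound (failure ε δ bound) final
        e : Entry
        e = proj₁ (covered O f)
        near : wt e ≤ (1ℚ + ι 120 * δ) * weightOf O
        near = proj₁ (proj₂ (proj₂ (covered O f)))
        optimal : bound ≤ val chosen-entry × wt chosen-entry ≤ wt e
        optimal = proj₂ spec (inj₂ (proj₁ (proj₂ (covered O f))))
          (≤-trans (Feasible.valuable f) (proj₂ (proj₂ (proj₂ (proj₂ (covered O f))))))
        valuable : bound ≤ val chosen-entry
        valuable = proj₁ optimal
        below : bound - 1ℚ < bound
        below = subst (bound - 1ℚ <_) (+-identityʳ bound) (+-monoʳ-< bound (negative⁻¹ (- 1ℚ)))
        from : chosen-entry ≡ failure ε δ bound ⊎ chosen-entry ∈ final → chosen-entry ∈ final
        from (inj₂ r∈) = r∈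
        from (inj₁ eq) = ⊥-elim (<-irrefl refl (<-≤-trans below (≤-trans valuable (≤-reflexive (cong val eq)))))

      decode : ∀ {κ p} → SoundPayload κ block p → ∃ λ S → (∀ i → Nearly i (S i)) × Realizes κ (gather chosen S) p
      decode (x , s , ρ) with ⨁-Picked⁻ (subst (λ Ps → ⨁ Ps x) (List.map-tabulate categoryLeaf sound) s)
      ... | S , refl , nearly = S , nearly , ρ

      decoded : ∃ λ S → (∀ i → Nearly i (S i)) × Realizes (6 ℕ.+ chains block) (gather chosen S) (proj₂ chosen-entry)
      decoded = decode (All.lookup (proj₁ final-models) (proj₁ (chosen-spec (proj₁ feasible) (proj₂ feasible))))

      approximate : ∃ λ S → Approximate ε S × (∀ is → proj₁ (push chosen-entry is) ≡ proj₁ (gather chosen S) ++ is)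
      approximate = S , record
        { lower    = proj₁ ∘ nearly
        ; upper    = proj₂ ∘ nearly
        ; valuable = ≤-trans (proj₁ (proj₂ (chosen-spec (proj₁ feasible) (proj₂ feasible)))) (≤-reflexive (Realizes.gains ρ))
        ; nearOpt  = λ O optimal → ≤-trans (≤-reflexive (sym (Realizes.weighs ρ))) (proj₂ (proj₂ (chosen-spec O (proj₁ optimal))))
        } , Realizes.pushes ρ
        where
        S : ItemSet
        S = proj₁ decoded
        nearly : ∀ i → Nearly i (S i)
        nearly = proj₁ (proj₂ decoded)
        ρ : Realizes (6 ℕ.+ chains block) (gather chosen S) (proj₂ chosen-entry)
        ρ = proj₂ (proj₂ decoded)

  gather⁺ : ∀ {S : ItemSet} {i j} → Vec.lookup (S i) j ≡ true → (i , j) ∈ proj₁ (gather chosen S)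
  gather⁺ {S} {i} eq = List.∈-concat⁺′ (members⁺ (i ,_) (S i) eq) (List.∈-tabulate⁺ i)

  gather⁻ : ∀ {S : ItemSet} {i j} → (i , j) ∈ proj₁ (gather chosen S) → Vec.lookup (S i) j ≡ true
  gather⁻ {S} ij∈ with List.∈-concat⁻′ (tabulate λ i → members (i ,_) (S i)) ij∈
  ... | _ , ij∈xs , xs∈ with List.∈-tabulate⁻ {f = λ i → members (i ,_) (S i)} xs∈
  ...   | i′ , refl with members⁻ (i′ ,_) (S i′) ij∈xs
  ...     | j′ , refl , eq = eq

  open DecMembership _≟ᴵ_ using (_∈?_)

  does-∈? : ∀ {x xs b} → (b ≡ true → x ∈ xs) → (x ∈ xs → b ≡ true) → does (x ∈? xs) ≡ b
  does-∈? {x} {xs} {true}  h k = dec-true (x ∈? xs) (h refl)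
  does-∈? {x} {xs} {false} h k = dec-false (x ∈? xs) λ x∈ → case (k x∈)
    where
    case : false ≢ true
    case ()

  output-gather : ∀ P S → proj₁ (run P I) ≡ proj₁ (gather chosen S) → ∀ i → output P I i ≡ S i
  output-gather P S eq i = trans (Vec.tabulate-cong λ j → does-∈? {i , j} {proj₁ (run P I)} {Vec.lookup (S i) j}
      (λ sj → subst ((i , j) ∈_) (sym eq) (gather⁺ {S} sj)) (λ ij∈ → gather⁻ {S} (subst ((i , j) ∈_) eq ij∈)))
    (Vec.tabulate∘lookup (S i))

  -- An `ItemSet` is a function, so the output is known to equal the decoded set only pointwise;
  -- this transports the claim without function extensionality.
  Approximate-resp : ∀ {ε S S′} → (∀ i → S′ i ≡ S i) → Approximate ε S → Approximate ε S′
  Approximate-resp {ε} {S} {S′} eq a = record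
    { lower    = λ i → subst (λ s → (1ℚ - ε) * l i ≤ sumOver s (w i)) (sym (eq i)) (lower i)
    ; upper    = λ i → subst (λ s → sumOver s (w i) ≤ (1ℚ + ε) * u i) (sym (eq i)) (upper i)
    ; valuable = ≤-trans valuable (≤-reflexive (sym (sum-cong-≗ λ i → cong (λ s → sumOver s (v i)) (eq i))))
    ; nearOpt  = λ O optimal → ≤-trans (≤-reflexive (sum-cong-≗ λ i → cong (λ s → sumOver s (w i)) (eq i))) (nearOpt O optimal)
    }
    where open Approximate a

  module _ {ε δ : ℚ} (0≤δ : 0ℚ ≤ δ) (δ≤ε : ι 120 * δ ≤ ε) (δ≤1 : ι 120 * δ ≤ 1ℚ) where

    open Correctness 0≤δ δ≤ε δ≤1

    run-program : proj₁ (run (programᵗ ε δ) I) ≡ proj₁ (push chosen-entry [])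
    run-program = result (evaluates (program⇓ ε δ (bound , records)))

    program-approximates : ∃ Feasible → Approximate ε (output (programᵗ ε δ) I)
    program-approximates feasible = Approximate-resp (output-gather (programᵗ ε δ) S eq) (proj₁ (proj₂ (approximate feasible)))
      where
      S : ItemSet
      S = proj₁ (approximate feasible)
      eq : proj₁ (run (programᵗ ε δ) I) ≡ proj₁ (gather chosen S)
      eq = trans run-program (trans (proj₂ (proj₂ (approximate feasible)) []) (List.++-identityʳ (proj₁ (gather chosen S))))

  -- Running time on an instance

  size≤n : ∀ i → size i ℕ.≤ n
  size≤n = go size
    where
    go : ∀ {k} (f : Fin k → ℕ) i → f i ℕ.≤ Vector.foldr ℕ._⊔_ 0 f
    go f zero    = ℕ.m≤m⊔n (f zero) (Vector.foldr ℕ._⊔_ 0 (f ∘ suc))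
    go f (suc i) = ℕ.≤-trans (go (f ∘ suc) i) (ℕ.m≤n⊔m (f zero) (Vector.foldr ℕ._⊔_ 0 (f ∘ suc)))

  0<m : 0 ℕ.< m
  0<m = ℕ.≤-trans (ℕ.s≤s ℕ.z≤n) (Fin.toℕ<n (proj₁ ∃w>0))

  0<n : 0 ℕ.< n
  0<n = ℕ.≤-trans (ℕ.≤-trans (ℕ.s≤s ℕ.z≤n) (Fin.toℕ<n (proj₁ (proj₂ ∃w>0)))) (size≤n (proj₁ ∃w>0))

  term≤sum : ∀ {k} (f : Fin k → ℚ) → (∀ i → 0ℚ ≤ f i) → ∀ i → f i ≤ sum f
  term≤sum f 0≤f zero    = ≤-trans (≤-reflexive (sym (+-identityʳ (f zero)))) (+-monoʳ-≤ (f zero) (sum-nonneg (f ∘ suc) (0≤f ∘ suc)))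
  term≤sum f 0≤f (suc i) = ≤-trans (term≤sum (f ∘ suc) (0≤f ∘ suc) i)
    (≤-trans (≤-reflexive (sym (+-identityˡ (sum (f ∘ suc))))) (+-monoˡ-≤ (sum (f ∘ suc)) (0≤f zero)))

  categoryTotal≤W : ∀ i → sum (w i) ≤ totalWeight
  categoryTotal≤W = term≤sum (λ i → sum (w i)) (λ i → sum-nonneg (w i) (w≥0 i))

  loads-tabulate : ∀ {k} (f : Fin k → Leaf) → loads (tabulate f) ≡ sum (λ j → load (f j))
  loads-tabulate {zero}  f = refl
  loads-tabulate {suc k} f = cong (load (f zero) +_) (loads-tabulate (f ∘ suc))

  chains-tabulate : ∀ {k c} (f : Fin k → Leaf) → (∀ j → chain (f j) ℕ.≤ c) → chains (tabulate f) ℕ.≤ k ℕ.* c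
  chains-tabulate {zero}  f h = ℕ.z≤n
  chains-tabulate {suc k} f h = ℕ.+-mono-≤ (h zero) (chains-tabulate (f ∘ suc) (h ∘ suc))

  mapCost-tabulate : ∀ {A : Set} {κ : A → ℕ} {k c} (f : Fin k → A) → (∀ j → ι (20 ℕ.+ κ (f j)) ≤ c) →
                     ι (mapCost κ (tabulate f)) ≤ ι k * c
  mapCost-tabulate {κ = κ} {zero}  {c} f h = ≤-reflexive (sym (*-zeroˡ c))
  mapCost-tabulate {κ = κ} {suc k} {c} f h = begin
    ι (20 ℕ.+ (κ (f zero) ℕ.+ mapCost κ rest))       ≡⟨ cong ι (sym (ℕ.+-assoc 20 (κ (f zero)) (mapCost κ rest))) ⟩
    ι ((20 ℕ.+ κ (f zero)) ℕ.+ mapCost κ rest)       ≡⟨ ι-+ (20 ℕ.+ κ (f zero)) (mapCost κ rest) ⟩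
    ι (20 ℕ.+ κ (f zero)) + ι (mapCost κ rest)       ≤⟨ +-mono-≤ (h zero) (mapCost-tabulate (f ∘ suc) (h ∘ suc)) ⟩
    c + ι k * c                                      ≡⟨ collect c (ι k) ⟩
    (1ℚ + ι k) * c                                   ≡⟨ cong (_* c) (ι-+ 1 k) ⟨
    ι (suc k) * c                                    ∎
    where
    open ≤-Reasoning
    rest = tabulate (f ∘ suc)
    collect : ∀ c k → c + k * c ≡ (1ℚ + k) * c
    collect = solve-∀ ℚ-ring

  length-restrict : ∀ lo hi S → length (restrict lo hi S) ℕ.≤ length S
  length-restrict lo hi [] = ℕ.z≤n
  length-restrict lo hi (x ∷ xs) with lo ≤ᵇ wt x | wt x ≤ᵇ hi
  ... | true  | true  = ℕ.s≤s (length-restrict lo hi xs)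
  ... | true  | false = ℕ.m≤n⇒m≤1+n (length-restrict lo hi xs)
  ... | false | _     = ℕ.m≤n⇒m≤1+n (length-restrict lo hi xs)

  Small-shorter : ∀ {X R S} → length R ℕ.≤ length S → Small X S → Small X R
  Small-shorter {R = R} R≤S (small h) = small (≤-trans (^-monoˡ 3 (0≤ι (suc (length R))) (ι-mono (ℕ.s≤s R≤S))) h)

  Small-length : ∀ {X S} → Small X S → ι (length S) ≤ X
  Small-length {X} {S} (small h) = begin
    ι (length S)              ≤⟨ ι-mono (ℕ.n≤1+n (length S)) ⟩
    s                         ≡⟨ *-identityʳ s ⟨
    s * 1ℚ                    ≤⟨ *-monoˡ (0≤ι (suc (length S))) (1≤^ 2 1≤s) ⟩
    s ^ 3                     ≤⟨ h ⟩
    X                         ∎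
    where
    open ≤-Reasoning
    s = ι (suc (length S))
    1≤s : 1ℚ ≤ s
    1≤s = ι-mono {1} {suc (length S)} (ℕ.s≤s ℕ.z≤n)

  -- Cost of a category together with its step of the enclosing map: the overhead 150 + 20, then 50
  -- + 20 per item, the tree, and 40 per filtered entry, all in units of `z`.
  categoryBound : ℚ → ℚ
  categoryBound z = ι 170 * z + ((ι 70 * z + ι 87 * (ι 15 * z)) + z * ι 40)

  module RunningTime {ε δ : ℚ} (0<δ : 0ℚ < δ) (δ≤ε : ι 120 * δ ≤ ε) (δ≤1 : ι 120 * δ ≤ 1ℚ)
                     {wmin q X : ℚ} (isMin : IsMinPositiveWeight wmin)
                     (log : Max1Log≤ (1ℚ + ε) ((totalWeight ÷ wmin) {{pos⇒nonZero wmin {{IsMinPositiveWeight.isPositive isMin}}}}) q)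
                     (27≤X : ι 27 ≤ X) (K³≤ : (ι 5 * ε * q) ^ 3 ≤ X * δ ^ 3) where

    open IsMinPositiveWeight isMin

    0≤δ : 0ℚ ≤ δ
    0≤δ = <⇒≤ 0<δ

    open Correctness {ε} {δ} 0≤δ δ≤ε δ≤1
    open Categories ε 0≤ε

    0<wmin : 0ℚ < wmin
    0<wmin = positive⁻¹ wmin {{isPositive}}

    wmin≤W : wmin ≤ totalWeight
    wmin≤W with attained
    ... | i , j , eq = ≤-trans (≤-reflexive (sym eq)) (≤-trans (term≤sum (w i) (w≥0 i) j) (categoryTotal≤W i))

    quotient : ∀ {y} → wmin * y ≤ totalWeight → y ≤ (totalWeight ÷ wmin) {{pos⇒nonZero wmin {{isPositive}}}}
    quotient {y} h = *-cancelˡ-≤-pos wmin {{isPositive}} (≤-trans h (≤-reflexive eq))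
      where
      instance
        wmin-nonZero : NonZero wmin
        wmin-nonZero = pos⇒nonZero wmin {{isPositive}}
      eq : totalWeight ≡ wmin * (totalWeight ÷ wmin)
      eq = sym (trans (*-comm wmin (totalWeight ÷ wmin)) (trans (*-assoc totalWeight (1/ wmin) wmin)
        (trans (cong (totalWeight *_) (*-inverseˡ wmin)) (*-identityʳ totalWeight))))

    open Packing 0<wmin wmin≤W
    open TreeCost {ε} {_} {q} 0≤ε log quotient

    δ≤ε′ : δ ≤ ε
    δ≤ε′ = ≤-trans (≤-scale (≤ᵇ⇒≤ {1ℚ} {ι 120} _) 0≤δ) δ≤ε

    -- `Z` bounds the cubed size of the table of a category and so serves as the `X` of the second
    -- tree, although that tree restarts at precision `δ`. `Y` bounds the cubed size of the final
    -- table and, up to a constant, the total cost.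
    Z Y : ℚ
    Z = ι n * X
    Y = ι m * Z

    8≤X : ι 8 ≤ X
    8≤X = ≤-trans (≤ᵇ⇒≤ {ι 8} {ι 27} _) 27≤X

    0≤X : 0ℚ ≤ X
    0≤X = ≤-trans (0≤ι 8) 8≤X

    X≤Z : X ≤ Z
    X≤Z = ≤-scale (ι-mono {1} {n} 0<n) 0≤X

    0≤Z : 0ℚ ≤ Z
    0≤Z = ≤-trans 0≤X X≤Z

    Z≤Y : Z ≤ Y
    Z≤Y = ≤-scale (ι-mono {1} {m} 0<m) 0≤Z

    1≤X : 1ℚ ≤ X
    1≤X = ≤-trans (≤ᵇ⇒≤ {1ℚ} {ι 8} _) 8≤X

    module _ (i : Fin m) where
      open Items i

      item-fits : Fits totalWeight wmin (concat blocks)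
      item-fits = subst (Fits totalWeight wmin) (sym concat-blocks)
        (≤-trans (≤-reflexive (loads-tabulate itemLeaf)) (categoryTotal≤W i) , All.tabulate⁺ atomic)
        where
        atomic : ∀ j {x} → Chosen (i , j) (w i j) (v i j) x → wgt x ≡ 0ℚ ⊎ wmin ≤ wgt x
        atomic j (inj₁ refl) = inj₁ refl
        atomic j (inj₂ refl) with <-cmp 0ℚ (w i j)
        ... | tri< 0<w _ _ = inj₂ (minimal i j 0<w)
        ... | tri≈ _ 0≡w _ = inj₁ (sym 0≡w)
        ... | tri> _ _ w<0 = ⊥-elim (<-irrefl refl (<-≤-trans w<0 (w≥0 i j)))

      item-Bounded : Pointwise (Bounded X) blocks (map leaf items)
      -- A leaf has two entries, and the cube of 1 + 2 is 27.
      item-Bounded = leaves-Pointwise λ j → leaf-Sound j , λ _ → small 27≤X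

      length≤n : length (map leaf items) ℕ.≤ n
      length≤n = ℕ.≤-trans (ℕ.≤-reflexive (trans (List.length-map leaf items) (List.length-tabulate itemRecord))) (size≤n i)

      item-cost : ι (treeCost (length (map leaf items)) δ (map leaf items)) ≤ ι 87 * (ι 15 * (ι (length (map leaf items)) * X)) ×
                  Small Z (itemTree ε δ items)
      item-cost = tree-cost (length (map leaf items)) {δ} {X} {Z} {blocks} {map leaf items} 0<δ δ≤ε′ 8≤X K³≤ item-fits item-Bounded
        X≤Z (*-monoʳ 0≤X (ι-mono length≤n))

      category-cost : ι (20 ℕ.+ categoryCost ε δ (categoryRecord δ i)) ≤ categoryBound Z
      category-cost = begin
        ι (170 ℕ.+ ((a ℕ.+ t) ℕ.+ k ℕ.* 40))         ≡⟨ ι-+ 170 ((a ℕ.+ t) ℕ.+ k ℕ.* 40) ⟩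
        ι 170 + ι ((a ℕ.+ t) ℕ.+ k ℕ.* 40)           ≡⟨ cong (ι 170 +_) (trans (ι-+ (a ℕ.+ t) (k ℕ.* 40)) (cong₂ _+_ (ι-+ a t) (ι-* k 40))) ⟩
        ι 170 + ((ι a + ι t) + ι k * ι 40)           ≤⟨ +-mono-≤ (≤-trans (≤-reflexive (sym (*-identityʳ (ι 170)))) (*-monoˡ (0≤ι 170) (≤-trans 1≤X X≤Z)))
                                                          (+-mono-≤ (+-mono-≤ a≤ t≤) (*-monoʳ (0≤ι 40) (Small-length {S = itemTree ε δ items} (proj₂ item-cost)))) ⟩
        categoryBound Z                              ∎
        where
        open ≤-Reasoning
        a t k : ℕ
        a = mapCost (λ _ → 50) items
        t = treeCost (length (map leaf items)) δ (map leaf items)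
        k = length (itemTree ε δ items)
        size≤Z : ι (size i) ≤ Z
        size≤Z = ≤-trans (ι-mono (size≤n i)) (≤-trans (≤-reflexive (sym (*-identityʳ (ι n)))) (*-monoˡ (0≤ι n) 1≤X))
        a≤ : ι a ≤ ι 70 * Z
        a≤ = ≤-trans (mapCost-tabulate {c = ι 70} itemRecord λ _ → ≤-refl)
          (≤-trans (≤-reflexive (*-comm (ι (size i)) (ι 70))) (*-monoˡ (0≤ι 70) size≤Z))
        t≤ : ι t ≤ ι 87 * (ι 15 * Z)
        t≤ = ≤-trans (proj₁ item-cost) (*-monoˡ (0≤ι 87) (*-monoˡ (0≤ι 15) (*-monoʳ 0≤X (ι-mono length≤n))))

    tables : List Table
    tables = categoryTables ε δ records

    blocks : List Block
    blocks = map (_∷ []) block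

    category-fits : Fits totalWeight wmin (concat blocks)
    category-fits = subst (Fits totalWeight wmin) (sym List.concat-map-[ block ])
      (≤-reflexive (loads-tabulate categoryLeaf) , All.tabulate⁺ atomic)
      where
      atomic : ∀ i {x} → Picked (chosen i) (Nearly i) x → wgt x ≡ 0ℚ ⊎ wmin ≤ wgt x
      atomic i (s , refl , _) = sumOver-atomic s (w≥0 i) (minimal i)

    category-Bounded : Pointwise (Bounded Z) blocks tables
    category-Bounded = Pointwise.map⁺ (_∷ []) (category ε δ) (Pointwise.tabulate⁺ λ i →
      Models.is-sound (category-Models i) ,
      λ _ → Small-shorter {S = itemTree ε δ (Items.items i)} (length-restrict ((1ℚ - ε) * l i) ((1ℚ + ε) * u i) (itemTree ε δ (Items.items i))) (proj₂ (item-cost i)))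

    length-tables : length tables ≡ m
    length-tables = trans (List.length-map (category ε δ) records) (List.length-tabulate (categoryRecord δ))

    final-cost : ι (treeCost (length tables) δ tables) ≤ ι 87 * (ι 15 * (ι (length tables) * Z)) × Small Y final
    final-cost = tree-cost (length tables) {δ} {Z} {Y} {blocks} {tables} 0<δ δ≤ε′ (≤-trans 8≤X X≤Z)
      (≤-trans K³≤ (*-monoʳ (0≤^ 3 0≤δ) X≤Z)) category-fits category-Bounded Z≤Y
      (≤-reflexive (cong (λ k → ι k * Z) length-tables))

    push-cost : proj₂ (push chosen-entry []) ℕ.≤ 6 ℕ.+ m ℕ.* (6 ℕ.+ 9 ℕ.* n)
    push-cost = ℕ.≤-trans (origin (proj₁ (select-spec bound (failure ε δ bound) final))) (ℕ.+-monoʳ-≤ 6 chains≤)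
      where
      chains≤ : chains block ℕ.≤ m ℕ.* (6 ℕ.+ 9 ℕ.* n)
      chains≤ = chains-tabulate categoryLeaf λ i → ℕ.+-monoʳ-≤ 6 (ℕ.*-monoʳ-≤ 9 (size≤n i))
      cheap : ∀ {p} → SoundPayload (6 ℕ.+ chains block) block p → proj₂ (proj₂ (proj₂ p) []) ℕ.≤ 6 ℕ.+ chains block
      cheap (_ , _ , ρ) = ℕ.m+n≤o⇒n≤o 5 (Realizes.cheap ρ [])
      origin : chosen-entry ≡ failure ε δ bound ⊎ chosen-entry ∈ final → proj₂ (push chosen-entry []) ℕ.≤ 6 ℕ.+ chains block
      origin (inj₁ eq) = subst (λ e → proj₂ (push e []) ℕ.≤ 6 ℕ.+ chains block) (sym eq) (ℕ.s≤s ℕ.z≤n)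
      origin (inj₂ e∈) = cheap (All.lookup (proj₁ final-models) e∈)

    -- The overheads 190 + 170 + 70 + 40 + 60 + 6 + 15 add up to 551, and the trees of the two
    -- stages contribute 87 · 15 each.
    run-cost : ι (runningTime (programᵗ ε δ) I) ≤ (ι 551 + ι 174 * ι 15) * Y
    run-cost = begin
      ι (runningTime (programᵗ ε δ) I)
        ≤⟨ ι-mono (cost (evaluates (program⇓ ε δ (bound , records)))) ⟩
      ι (190 ℕ.+ (((a ℕ.+ t) ℕ.+ k ℕ.* 60) ℕ.+ c))
        ≡⟨ trans (ι-+ 190 (((a ℕ.+ t) ℕ.+ k ℕ.* 60) ℕ.+ c)) (cong (ι 190 +_) (trans (ι-+ ((a ℕ.+ t) ℕ.+ k ℕ.* 60) c)
             (cong (_+ ι c) (trans (ι-+ (a ℕ.+ t) (k ℕ.* 60)) (cong₂ _+_ (ι-+ a t) (ι-* k 60)))))) ⟩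
      ι 190 + (((ι a + ι t) + ι k * ι 60) + ι c)
        ≤⟨ +-mono-≤ (scale (ι 190) (0≤ι 190) 1≤Y) (+-mono-≤ (+-mono-≤ (+-mono-≤ a≤ t≤) (*-monoʳ (0≤ι 60) (Small-length {S = final} (proj₂ final-cost)))) c≤) ⟩
      ι 190 * Y + (((categoryBound Y + ι 87 * (ι 15 * Y)) + Y * ι 60) + (ι 6 * Y + ι 15 * Y))
        ≡⟨ collect Y ⟩
      (ι 551 + ι 174 * ι 15) * Y
        ∎
      where
      open ≤-Reasoning
      a t k c : ℕ
      a = mapCost (categoryCost ε δ) records
      t = treeCost (length tables) δ tables
      k = length final
      c = proj₂ (push chosen-entry [])
      1≤Z : 1ℚ ≤ Z
      1≤Z = ≤-trans 1≤X X≤Z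
      1≤Y : 1ℚ ≤ Y
      1≤Y = ≤-trans 1≤Z Z≤Y
      scale : ∀ p {y} → 0ℚ ≤ p → 1ℚ ≤ y → p ≤ p * y
      scale p 0≤p 1≤y = ≤-trans (≤-reflexive (sym (*-identityʳ p))) (*-monoˡ 0≤p 1≤y)
      distribute : ∀ M Z → M * categoryBound Z ≡ categoryBound (M * Z)
      distribute = go
        where
        go : ∀ M z → M * (ι 170 * z + ((ι 70 * z + ι 87 * (ι 15 * z)) + z * ι 40)) ≡
             ι 170 * (M * z) + ((ι 70 * (M * z) + ι 87 * (ι 15 * (M * z))) + (M * z) * ι 40)
        go = solve-∀ ℚ-ring
      a≤ : ι a ≤ categoryBound Y
      a≤ = ≤-trans (mapCost-tabulate {κ = categoryCost ε δ} {c = categoryBound Z} (categoryRecord δ) category-cost) (≤-reflexive (distribute (ι m) Z))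
      t≤ : ι t ≤ ι 87 * (ι 15 * Y)
      t≤ = ≤-trans (proj₁ final-cost) (≤-reflexive (cong (λ k → ι 87 * (ι 15 * (ι k * Z))) length-tables))
      c≤ : ι c ≤ ι 6 * Y + ι 15 * Y
      c≤ = begin
        ι c                                          ≤⟨ ι-mono push-cost ⟩
        ι (6 ℕ.+ m ℕ.* (6 ℕ.+ 9 ℕ.* n))              ≡⟨ trans (ι-+ 6 (m ℕ.* (6 ℕ.+ 9 ℕ.* n))) (cong (ι 6 +_) (trans (ι-* m (6 ℕ.+ 9 ℕ.* n))
                                                          (cong (ι m *_) (trans (ι-+ 6 (9 ℕ.* n)) (cong (ι 6 +_) (ι-* 9 n)))))) ⟩
        ι 6 + ι m * (ι 6 + ι 9 * ι n)                ≤⟨ +-mono-≤ (scale (ι 6) (0≤ι 6) 1≤Y) (*-monoˡ (0≤ι m) (+-mono-≤ (scale (ι 6) (0≤ι 6) 1≤Z)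
                                                          (*-monoˡ (0≤ι 9) (scale (ι n) (0≤ι n) 1≤X)))) ⟩
        ι 6 * Y + ι m * (ι 6 * Z + ι 9 * Z)          ≡⟨ cong (ι 6 * Y +_) (regroup (ι m) Z) ⟩
        ι 6 * Y + ι 15 * Y                           ∎
        where
        regroup : ∀ M Z → M * (ι 6 * Z + ι 9 * Z) ≡ ι 15 * (M * Z)
        regroup = solve-∀ ℚ-ring
      collect : ∀ Y → ι 190 * Y + (((categoryBound Y + ι 87 * (ι 15 * Y)) + Y * ι 60) + (ι 6 * Y + ι 15 * Y)) ≡ (ι 551 + ι 174 * ι 15) * Y
      collect = go
        where
        go : ∀ Y → ι 190 * Y + (((ι 170 * Y + ((ι 70 * Y + ι 87 * (ι 15 * Y)) + Y * ι 40) + ι 87 * (ι 15 * Y)) + Y * ι 60) + (ι 6 * Y + ι 15 * Y))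
             ≡ (ι 551 + ι 174 * ι 15) * Y
        go = solve-∀ ℚ-ring

-- Choice of the precision and of the constant

module Parameters (ε̄ : ℚ) where

  -- The bound on the cubed sizes of the lowest tables will be `(b * q) ^ 3`. Since
  -- `ε ≤ E * (120 * δ)`, the choice of `b` makes `b * q * δ` at least `5 * ε * q`. The last factor
  -- `E` of `C` makes up for the division by `ε` in the claimed bound.
  E unit b C : ℚ
  E = ε̄ ⊔ 1ℚ
  unit = ι 551 + ι 174 * ι 15
  b = ι 5 * ι 120 * E
  C = unit * b ^ 3 * E

  1≤E : 1ℚ ≤ E
  1≤E = p≤q⊔p ε̄ 1ℚ

  0≤E : 0ℚ ≤ E
  0≤E = ≤-trans 0≤1 1≤E

  0≤b : 0ℚ ≤ b
  0≤b = 0≤* (0≤* (0≤ι 5) (0≤ι 120)) 0≤E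

  0≤unit : 0ℚ ≤ unit
  0≤unit = 0≤+ (0≤ι 551) (0≤* (0≤ι 174) (0≤ι 15))

  module Precision (ε : ℚ) (0<ε : 0ℚ < ε) (ε≤ε̄ : ε ≤ ε̄) where

    ε₁ δ : ℚ
    -- The cap at 1 keeps every error factor at most 2, as `errorFactor-step` requires.
    ε₁ = ε ⊓ 1ℚ
    δ = ε₁ * (ℤ.+ 1 / 120)

    0<ε₁ : 0ℚ < ε₁
    0<ε₁ with ⊓-sel ε 1ℚ
    ... | inj₁ eq = subst (0ℚ <_) (sym eq) 0<ε
    ... | inj₂ eq = subst (0ℚ <_) (sym eq) 0<1

    120δ≡ε₁ : ι 120 * δ ≡ ε₁
    120δ≡ε₁ = trans (swap (ι 120) ε₁ (ℤ.+ 1 / 120)) (*-identityʳ ε₁)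
      where
      swap : ∀ a x y → a * (x * y) ≡ x * (a * y)
      swap = solve-∀ ℚ-ring

    δ≤ε : ι 120 * δ ≤ ε
    δ≤ε = ≤-trans (≤-reflexive 120δ≡ε₁) (p⊓q≤p ε 1ℚ)

    δ≤1 : ι 120 * δ ≤ 1ℚ
    δ≤1 = ≤-trans (≤-reflexive 120δ≡ε₁) (p⊓q≤q ε 1ℚ)

    0<δ : 0ℚ < δ
    0<δ = positive⁻¹ δ {{pos*pos⇒pos ε₁ {{positive 0<ε₁}} (ℤ.+ 1 / 120)}}

    -- Capping at 1 shrinks `ε` by a factor of at most `E`, because `ε ≤ ε̄`. This bounds `ε / δ`,
    -- and with it the table sizes in terms of `q`, uniformly in `ε`.
    ε≤Eε₁ : ε ≤ E * ε₁
    ε≤Eε₁ with ⊓-sel ε 1ℚ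
    ... | inj₁ eq = subst (λ x → ε ≤ E * x) (sym eq) (≤-scale 1≤E (<⇒≤ 0<ε))
    ... | inj₂ eq = subst (λ x → ε ≤ E * x) (sym eq) (≤-trans (≤-trans ε≤ε̄ (p≤p⊔q ε̄ 1ℚ)) (≤-reflexive (sym (*-identityʳ E))))

    module _ {q : ℚ} (1≤q : 1ℚ ≤ q) where

      0≤q : 0ℚ ≤ q
      0≤q = ≤-trans 0≤1 1≤q

      enlarge : ∀ {x y} → 0ℚ ≤ x → 1ℚ ≤ y → x ≤ x * y
      enlarge {x} 0≤x 1≤y = ≤-trans (≤-reflexive (sym (*-identityʳ x))) (*-monoˡ 0≤x 1≤y)

      27≤ : ι 27 ≤ (b * q) ^ 3
      27≤ = ≤-trans (≤ᵇ⇒≤ {ι 27} {ι 3 ^ 3} _) (^-monoˡ 3 (0≤ι 3)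
        (≤-trans (≤ᵇ⇒≤ {ι 3} {ι 5 * ι 120} _) (≤-trans (enlarge (0≤* (0≤ι 5) (0≤ι 120)) 1≤E) (enlarge 0≤b 1≤q))))

      K³≤ : (ι 5 * ε * q) ^ 3 ≤ (b * q) ^ 3 * δ ^ 3
      K³≤ = ≤-trans (^-monoˡ 3 (0≤* (0≤* (0≤ι 5) (<⇒≤ 0<ε)) 0≤q) K≤) (≤-reflexive (^-distrib-* (b * q) δ 3))
        where
        open ≤-Reasoning
        rearrange : ∀ f g E q δ → f * (E * (g * δ)) * q ≡ f * g * E * q * δ
        rearrange = solve-∀ ℚ-ring
        K≤ : ι 5 * ε * q ≤ b * q * δ
        K≤ = begin
          ι 5 * ε * q                      ≤⟨ *-monoʳ 0≤q (*-monoˡ (0≤ι 5) ε≤Eε₁) ⟩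
          ι 5 * (E * ε₁) * q               ≡⟨ cong (λ x → ι 5 * (E * x) * q) 120δ≡ε₁ ⟨
          ι 5 * (E * (ι 120 * δ)) * q      ≡⟨ rearrange (ι 5) (ι 120) E q δ ⟩
          b * q * δ                        ∎

      -- Passes to the claimed form by inserting factors that are at least 1: a second `N`, the cube
      -- of `p`, and `E * r`, where `r` is the inverse of `ε`.
      total≤ : ∀ {M N p r} → 0ℚ ≤ M → 1ℚ ≤ N → 1ℚ ≤ p → 0ℚ ≤ r → ε * r ≡ 1ℚ →
        unit * (M * (N * (b * q) ^ 3)) ≤ C * (N ^ 2 * M * p ^ 3 * q ^ 3 * r)
      total≤ {M} {N} {p} {r} 0≤M 1≤N 1≤p 0≤r εr≡1 = begin
        unit * (M * (N * (b * q) ^ 3))                            ≡⟨ cong (λ x → unit * (M * (N * x))) (^-distrib-* b q 3) ⟩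
        unit * (M * (N * (b ^ 3 * q ^ 3)))                        ≡⟨ gather₁ unit M N (b ^ 3) (q ^ 3) ⟩
        unit * b ^ 3 * U                                          ≤⟨ *-monoˡ (0≤* 0≤unit (0≤^ 3 0≤b)) (≤-trans (enlarge 0≤U 1≤Np³) (enlarge 0≤UNp³ 1≤Er)) ⟩
        unit * b ^ 3 * (U * (N * p ^ 3) * (E * r))                ≡⟨ gather₂ (unit * b ^ 3) M N (p ^ 3) (q ^ 3) E r ⟩
        C * (N ^ 2 * M * p ^ 3 * q ^ 3 * r)                       ∎
        where
        open ≤-Reasoning
        U : ℚ
        U = N * M * q ^ 3
        0≤N : 0ℚ ≤ N
        0≤N = ≤-trans 0≤1 1≤N
        0≤U : 0ℚ ≤ U
        0≤U = 0≤* (0≤* 0≤N 0≤M) (0≤^ 3 0≤q)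
        1≤Np³ : 1ℚ ≤ N * p ^ 3
        1≤Np³ = ≤-trans 1≤N (enlarge 0≤N (1≤^ 3 1≤p))
        0≤UNp³ : 0ℚ ≤ U * (N * p ^ 3)
        0≤UNp³ = 0≤* 0≤U (≤-trans 0≤1 1≤Np³)
        1≤Er : 1ℚ ≤ E * r
        1≤Er = ≤-trans (≤-reflexive (sym εr≡1)) (*-monoʳ 0≤r (≤-trans ε≤ε̄ (p≤p⊔q ε̄ 1ℚ)))
        gather₁ : ∀ a M N B Q → a * (M * (N * (B * Q))) ≡ a * B * (N * M * Q)
        gather₁ = solve-∀ ℚ-ring
        gather₂ : ∀ a M N P Q E r → a * (N * M * Q * (N * P) * (E * r)) ≡ a * E * (N * (N * 1ℚ) * M * P * Q * r)
        gather₂ = solve-∀ ℚ-ring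

    program-within : .{{_ : Positive ε}} → ∀ I → WithinBound C ε I (runningTime (programᵗ ε δ) I)
    program-within I isMin {p} {q} log-m log = ≤-trans run-cost
      (total≤ (Max1Log≤.1≤q log) (0≤ι m) (ι-mono {1} {n} (Algorithm.0<n I)) (Max1Log≤.1≤q log-m)
        (<⇒≤ (positive⁻¹ ((1/ ε) {{pos⇒nonZero ε}}) {{1/pos⇒pos ε}})) (*-inverseʳ ε {{pos⇒nonZero ε}}))
      where
      open Instance I using (m; n)
      open Algorithm.RunningTime I {ε} {δ} 0<δ δ≤ε δ≤1 {_} {q} {(b * q) ^ 3} isMin log
        (27≤ (Max1Log≤.1≤q log)) (K³≤ (Max1Log≤.1≤q log)) using (run-cost)

theorem4p6 : ∀ (ε̄ : ℚ) →
    ∃[ C ] ((ε : ℚ) .{{_ : Positive ε}} → ε ≤ ε̄ →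
    ∃[ P ] ((I : Instance) →
    (∃ (Instance.Feasible I) → Instance.Approximate I ε (output P I)) ×
    WithinBound C ε I (runningTime P I)))
theorem4p6 ε̄ = C , solution
  where
  open Parameters ε̄
  solution : (ε : ℚ) .{{_ : Positive ε}} → ε ≤ ε̄ →
    ∃[ P ] ((I : Instance) →
    (∃ (Instance.Feasible I) → Instance.Approximate I ε (output P I)) ×
    WithinBound C ε I (runningTime P I))
  solution ε ε≤ε̄ = programᵗ ε δ , λ I →
    Algorithm.program-approximates I (<⇒≤ 0<δ) δ≤ε δ≤1 , program-within I
    where open Precision ε (positive⁻¹ ε) ε≤ε̄
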